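{- Let $\beta$ be a real number with $0<\beta$ sufficiently small compared with $1/(20\cdot 17^3)$, and let $n$ be a sufficiently large integer. Let $G$ be a graph on $n$ vertices with $\delta(G)\ge (n+1)/2$. If there exists a partition $V_1\cup V_2$ of $V(G)$ such that $|V_1|\ge (1/2-7\beta)n$ and $\Delta(G[V_1])\le \beta n$, then $G$ contains a spanning Halin subgraph.
   Context: $\Delta(G[V_1])$ is the maximum degree of the subgraph induced by $V_1$. A homeomorphically irreducible tree (HIT) is a tree with no vertex of degree 2. A Halin graph is obtained from a HIT with at least 4 vertices embedded in the plane by connecting its leaves into a cycle following the cyclic order determined by the embedding. A spanning Halin subgraph of $G$ is a Halin subgraph of $G$ with vertex set $V(G)$. -}

module Defs where

open import Data.Nat using (ℕ; zero; suc; _+_; _*_; _∸_; _≤_; _≡ᵇ_)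
open import Data.Fin using (Fin; _≟_)
open import Data.Bool using (Bool; true; false; _∧_; if_then_else_)
open import Data.List using (List; []; _∷_; length; filterᵇ; allFin; map; concatMap; zip; _++_; [_])
open import Data.List.Relation.Unary.Unique.Propositional using (Unique)
open import Data.List.Membership.Propositional using (_∈_)
open import Data.Product using (Σ; _×_; _,_; proj₁; proj₂)
open import Data.Sum using (_⊎_)
open import Data.Unit using (⊤)
open import Data.Empty using (⊥)
open import Relation.Nullary using (¬_; does)
open import Relation.Binary.PropositionalEquality using (_≡_; _≢_)

record Graph (n : ℕ) : Set where
  field
    Adj    : Fin n → Fin n → Bool
    sym    : ∀ u v → Adj u v ≡ Adj v u
    irrefl : ∀ v → Adj v v ≡ false
open Graph public

module _ {n : ℕ} where

  nbrs : Graph n → Fin n → List (Fin n)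
  nbrs G v = filterᵇ (Adj G v) (allFin n)

  degree : Graph n → Fin n → ℕ
  degree G v = length (nbrs G v)

  -- a vertex subset V₁ (its complement is V₂) and its size
  size : (Fin n → Bool) → ℕ
  size V = length (filterᵇ V (allFin n))

  degreeIn : Graph n → (Fin n → Bool) → Fin n → ℕ
  degreeIn G V v = length (filterᵇ (λ u → V u ∧ Adj G v u) (allFin n))

  _⊆ᴳ_ : Graph n → Graph n → Set
  H ⊆ᴳ G = ∀ u v → Adj H u v ≡ true → Adj G u v ≡ true

  data Walk (G : Graph n) : Fin n → Fin n → Set where
    here : ∀ {u} → Walk G u u
    step : ∀ {u w v} → Adj G u w ≡ true → Walk G w v → Walk G u v

  Connected : Graph n → Set
  Connected G = ∀ u v → Walk G u v

  chain : Graph n → List (Fin n) → Set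
  chain G []           = ⊤
  chain G (x ∷ [])     = ⊤
  chain G (x ∷ y ∷ xs) = (Adj G x y ≡ true) × chain G (y ∷ xs)

  lastOr : Fin n → List (Fin n) → Fin n
  lastOr x []       = x
  lastOr x (y ∷ ys) = lastOr y ys

  closes : Graph n → List (Fin n) → Set
  closes G []       = ⊥
  closes G (x ∷ xs) = Adj G (lastOr x xs) x ≡ true

  IsCycle : Graph n → List (Fin n) → Set
  IsCycle G vs = (3 ≤ length vs) × Unique vs × chain G vs × closes G vs

  IsTree : Graph n → Set
  IsTree G = Connected G × (∀ vs → ¬ IsCycle G vs)

  IsHIT : Graph n → Set
  IsHIT T = IsTree T × (∀ v → degree T v ≢ 2)

  -- plane embeddings of a tree, as rotation systems: at every vertex a
  -- cyclic order (a duplicate-free list) of its neighbours.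

  record Rotation (T : Graph n) : Set where
    field
      rot      : Fin n → List (Fin n)
      rot-uniq : ∀ v → Unique (rot v)
      rot-sound : ∀ v u → u ∈ rot v → Adj T v u ≡ true
      rot-compl : ∀ v u → Adj T v u ≡ true → u ∈ rot v
  open Rotation public

  succIn : Fin n → List (Fin n) → Fin n → Fin n
  succIn f []       u = u
  succIn f (x ∷ xs) u =
    if does (x ≟ u) then nxt xs else succIn f xs u
    where
      nxt : List (Fin n) → Fin n
      nxt []      = f
      nxt (y ∷ _) = y

  σ : {T : Graph n} → Rotation T → Fin n → Fin n → Fin n
  σ ρ v u with rot ρ v
  ... | []     = u
  ... | f ∷ fs = succIn f (f ∷ fs) u

  Dart : Set
  Dart = Fin n × Fin n

  -- face tracing: after traversing dart (u , v), leave v along the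
  -- successor of u in the rotation at v
  faceStep : {T : Graph n} → Rotation T → Dart → Dart
  faceStep ρ (u , v) = v , σ ρ v u

  faceWalk : {T : Graph n} → Rotation T → ℕ → Dart → List Dart
  faceWalk ρ zero    d = []
  faceWalk ρ (suc k) d = d ∷ faceWalk ρ k (faceStep ρ d)

  darts : {T : Graph n} → Rotation T → List Dart
  darts ρ = concatMap (λ u → map (u ,_) (rot ρ u)) (allFin n)

  -- the boundary walk of the (unique) face of the plane tree, traversing
  -- all 2(n-1) darts, started at the first dart
  boundary : {T : Graph n} → Rotation T → List Dart
  boundary ρ with darts ρ
  ... | []    = []
  ... | d ∷ _ = faceWalk ρ (2 * (n ∸ 1)) d

  leafOrder : (T : Graph n) → Rotation T → List (Fin n)
  leafOrder T ρ =
    filterᵇ (λ v → degree T v ≡ᵇ 1) (map proj₂ (boundary ρ))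

  cycPairs : List (Fin n) → List (Fin n × Fin n)
  cycPairs []       = []
  cycPairs (x ∷ xs) = zip (x ∷ xs) (xs ++ [ x ])

  HalinEdge : (T : Graph n) → Rotation T → Fin n → Fin n → Set
  HalinEdge T ρ u v =
    (Adj T u v ≡ true)
    ⊎ ((u , v) ∈ cycPairs (leafOrder T ρ))
    ⊎ ((v , u) ∈ cycPairs (leafOrder T ρ))

  IsHalin : Graph n → Set
  IsHalin H =
    (4 ≤ n) ×
    Σ (Graph n) λ T → Σ (Rotation T) λ ρ →
      IsHIT T ×
      (∀ u v → (Adj H u v ≡ true → HalinEdge T ρ u v)
             × (HalinEdge T ρ u v → Adj H u v ≡ true))

  HasSpanningHalin : Graph n → Set
  HasSpanningHalin G = Σ (Graph n) λ H → IsHalin H × (H ⊆ᴳ G)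

{-# OPTIONS --safe #-}
module Submission where

-- G is close to a complete bipartite graph between V₁ and its complement. Vertices joined badly to the
-- opposite side change sides, and so do vertices of the larger side with many neighbours in it, until
-- the sizes differ by d ≤ 1 or all degrees inside the larger side are small. The minimum degree then
-- yields d + 1 disjoint edges inside the larger side (for d = 0, one edge inside each side); the only
-- exception is a star with d = 1, which leads to a spanning wheel. Otherwise the Halin graph is a
-- caterpillar whose spine and leaf path are the rails of a bipartite ladder, where each inner edge
-- spans a triangle and thereby absorbs a surplus vertex. A short such ladder through all atypical
-- vertices is built greedily, and the remaining vertices are inserted into it in pairs.

open import Defs
open import Data.Nat using (ℕ; zero; suc; _+_; _*_; _∸_; _≤_; _<_; _≡ᵇ_; _≤ᵇ_; _≤?_; _<?_; z≤n; s≤s; z<s; s<s; NonZero; >-nonZero)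
open import Data.Nat.Properties hiding (_≟_)
open import Data.Nat.ListAction using (sum)
open import Data.Nat.Solver using () renaming (module +-*-Solver to ℕ-Solver)
import Data.Nat.DivMod as DM
open import Algebra.Properties.CommutativeSemigroup +-commutativeSemigroup using (interchange) renaming (x∙yz≈y∙xz to +-left-comm)
open import Algebra.Properties.CommutativeSemigroup *-commutativeSemigroup using () renaming (x∙yz≈y∙xz to *-left-comm)
open import Data.Fin using (Fin; _≟_)
import Data.Fin.Properties as Fin
open import Data.Bool using (Bool; true; false; _∧_; _∨_; not; T; if_then_else_)
open import Data.Bool.ListAction using (any)
import Data.Bool.Properties as Bool
import Data.Integer as ℤ
import Data.Integer.Properties as ℤ
open import Data.Rational using (ℚ; _/_; 0ℚ; 1ℚ; ½)
import Data.Rational as Q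
import Data.Rational.Properties as Q
open import Data.Rational.Solver using () renaming (module +-*-Solver to ℚ-Solver)
import Data.Rational.Unnormalised as ℚᵘ
import Data.Rational.Unnormalised.Properties as ℚᵘ
open import Data.List using (List; []; _∷_; _++_; [_]; map; length; filterᵇ; allFin; zip)
open import Data.List.Properties using (map-++; filter-++; length-++; length-map; ++-assoc; ++-identityʳ; length-tabulate)
open import Data.List.Membership.Propositional using (_∈_; _∉_)
open import Data.List.Membership.Propositional.Properties using (∈-++⁺ˡ; ∈-++⁺ʳ; ∈-++⁻; ∈-map⁺; ∈-map⁻; ∈-filter⁺; ∈-filter⁻; ∈-allFin; ∈-∃++; ∈-concatMap⁺; ∈-concatMap⁻)
open import Data.List.Membership.Propositional.Properties.WithK using (unique∧set⇒bag)
import Data.List.Membership.DecPropositional as DecMembership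
open import Data.List.Relation.Binary.BagAndSetEquality using (∼bag⇒↭)
open import Data.List.Relation.Binary.Permutation.Propositional using (_↭_; ↭-sym; ↭-trans; ↭-refl; ↭-reflexive; ↭⇒↭ₛ; prep; swap)
open import Data.List.Relation.Binary.Permutation.Propositional.Properties using (↭-length; shift; shifts; ∈-resp-↭; filter-↭) renaming (++⁺ˡ to ↭-++⁺ˡ; ++⁺ʳ to ↭-++⁺ʳ; ++-comm to ↭-++-comm)
import Data.List.Relation.Binary.Permutation.Setoid.Properties as ↭ₛ
open import Data.List.Relation.Unary.All as All using (All; []; _∷_)
import Data.List.Relation.Unary.All.Properties as All
open import Data.List.Relation.Unary.Any as Any using (here; there; satisfied)
open import Data.List.Relation.Unary.AllPairs as AllPairs using ([]; _∷_)
open import Data.List.Relation.Unary.Unique.Propositional using (Unique)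
import Data.List.Relation.Unary.Unique.Propositional.Properties as Unique
open import Data.Product using (Σ; ∃; ∃₂; _×_; _,_; proj₁; proj₂)
open import Data.Product.Properties using (≡-dec)
open import Data.Sum as Sum using (_⊎_; inj₁; inj₂)
open import Data.Unit using (⊤; tt)
open import Data.Empty using (⊥)
open import Function using (_∘_; id; mk⇔; Equivalence)
open import Relation.Nullary using (¬_; Dec; yes; no; does; contradiction)
open import Relation.Nullary.Decidable using (dec-true; dec-false; does-⇔; _⊎-dec_; _×-dec_; ¬?; T?)
open import Relation.Binary.PropositionalEquality as ≡ using (_≡_; _≢_; refl; cong; cong₂; subst)

-- The first and the last spine vertex of a caterpillar each have two leaves consecutive on the leaf
-- cycle, so there is a triangle at either end, and every triangle contains an edge inside a side.
-- Hence two inner edges are needed even when the sides are equal. Two end triangles on edges of the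
-- larger side use one more vertex of it than of the other side, and every further triangle of this
-- kind adds one more; so a surplus d takes d + 1 edges. Of an inner edge only one end is required
-- to be typical. An atypical vertex is reached only through its own neighbours across, which are
-- many, so it has to enter the ladder while almost everything is still free. Every later vertex is
-- typical, and a long enough ladder offers a place for any pair of typical vertices. The constants
-- follow one scale μ, about n/L. At most μ vertices are exceptional, the others miss at most 3μ
-- vertices across, and 2μ vertices may change sides, whence τ = 5μ. With q about 14n/M, which
-- bounds the degrees inside V₁ and the deficit of 2|V₁| against n, the double count of exceptional
-- vertices needs n q ≤ μ², and this holds for M ≥ 56 L².

does⇒ : ∀ {P : Set} (d : Dec P) → does d ≡ true → P
does⇒ (yes p) _ = p

-- Lists without repetition

module _ {A : Set} where

  ∉-head : {x : A} {xs : List A} → Unique (x ∷ xs) → x ∉ xs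
  ∉-head (x≢ ∷ _) x∈ = All.lookup x≢ x∈ refl

  ∉⇒All≢ : {x : A} {xs : List A} → x ∉ xs → All (x ≢_) xs
  ∉⇒All≢ x∉ = All.tabulate (λ { y∈ refl → x∉ y∈ })

  unique-∷ : {x : A} {xs : List A} → x ∉ xs → Unique xs → Unique (x ∷ xs)
  unique-∷ x∉ u = ∉⇒All≢ x∉ ∷ u

  unique-++⁻ : (xs : List A) {ys : List A} → Unique (xs ++ ys) →
               Unique xs × Unique ys × (∀ {x} → x ∈ xs → x ∉ ys)
  unique-++⁻ [] u = [] , u , λ ()
  unique-++⁻ (x ∷ xs) (x≢ ∷ u) with unique-++⁻ xs u
  ... | ux , uy , dis = (All.++⁻ˡ xs x≢ ∷ ux) , uy ,
    λ { (here refl) x∈ → All.lookup (All.++⁻ʳ xs x≢) x∈ refl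
      ; (there x∈) → dis x∈ }

  same-members⇒↭ : {xs ys : List A} → Unique xs → Unique ys →
                   (∀ {x} → x ∈ xs → x ∈ ys) → (∀ {x} → x ∈ ys → x ∈ xs) → xs ↭ ys
  same-members⇒↭ ux uy f g = ∼bag⇒↭ (unique∧set⇒bag ux uy (mk⇔ f g))

  ∈-filterᵇ⁺ : {p : A → Bool} {x : A} {xs : List A} → x ∈ xs → p x ≡ true → x ∈ filterᵇ p xs
  ∈-filterᵇ⁺ {p} {x} x∈ px = ∈-filter⁺ (T? ∘ p) x∈ (subst (λ b → T b) (≡.sym px) _)

  ∈-filterᵇ⁻ : {p : A → Bool} {x : A} (xs : List A) → x ∈ filterᵇ p xs → x ∈ xs × p x ≡ true
  ∈-filterᵇ⁻ {p} {x} xs x∈ with ∈-filter⁻ (T? ∘ p) {xs = xs} x∈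
  ... | x∈′ , t with p x
  ... | true = x∈′ , refl

-- Plane trees

-- A plane forest, coded as its first tree's root and kids, and the remaining siblings.
data Forest (A : Set) : Set where
  nil  : Forest A
  node : A → Forest A → Forest A → Forest A

module _ {A : Set} where

  roots : Forest A → List A
  roots nil          = []
  roots (node v k s) = v ∷ roots s

  labels : Forest A → List A
  labels nil          = []
  labels (node v k s) = v ∷ labels k ++ labels s

  leaves : Forest A → List A
  leaves nil = []
  leaves (node v nil s) = v ∷ leaves s
  leaves (node v k@(node _ _ _) s) = leaves k ++ leaves s

  edges : A → Forest A → List (A × A)
  edges p nil          = []
  edges p (node v k s) = (p , v) ∷ edges v k ++ edges p s

  -- The parent comes first and the kids follow from left to right, so the cyclic successor of the
  -- last kid is the parent: tracing the face then is depth-first traversal, as in `tour`.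
  rotations : A → Forest A → List (A × List A)
  rotations p nil          = []
  rotations p (node v k s) = (v , p ∷ roots k) ∷ rotations v k ++ rotations p s

  tour : A → Forest A → List (A × A)
  tour p nil          = []
  tour p (node v k s) = (p , v) ∷ tour v k ++ (v , p) ∷ tour p s

  firstRoot : A → Forest A → A
  firstRoot w nil          = w
  firstRoot w (node v _ _) = v

  -- Below the root the degree is one more than the number of kids, so forbidding a single kid
  -- forbids degree 2. The root has no parent and is constrained separately, by having at least
  -- three kids.
  data NoUnaryNode : Forest A → Set where
    nil  : NoUnaryNode nil
    leaf : ∀ {v s} → NoUnaryNode s → NoUnaryNode (node v nil s)
    node : ∀ {v k s} → 2 ≤ length (roots k) → NoUnaryNode k → NoUnaryNode s → NoUnaryNode (node v k s)

  map-proj₂-edges : ∀ p f → map proj₂ (edges p f) ≡ labels f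
  map-proj₂-edges p nil = refl
  map-proj₂-edges p (node v k s) = cong (v ∷_) (≡.trans (map-++ proj₂ (edges v k) _)
    (cong₂ _++_ (map-proj₂-edges v k) (map-proj₂-edges p s)))

  map-proj₁-rotations : ∀ p f → map proj₁ (rotations p f) ≡ labels f
  map-proj₁-rotations p nil = refl
  map-proj₁-rotations p (node v k s) = cong (v ∷_) (≡.trans (map-++ proj₁ (rotations v k) _)
    (cong₂ _++_ (map-proj₁-rotations v k) (map-proj₁-rotations p s)))

  roots⇒edge : ∀ {p u} f → u ∈ roots f → (p , u) ∈ edges p f
  roots⇒edge (node v k s) (here refl) = here refl
  roots⇒edge (node v k s) (there u∈)  = there (∈-++⁺ʳ (edges v k) (roots⇒edge s u∈))

  edge⇒tour : ∀ {p u v} f → (u , v) ∈ edges p f → (u , v) ∈ tour p f × (v , u) ∈ tour p f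
  edge⇒tour (node x k s) (here refl) = here refl , there (∈-++⁺ʳ (tour x k) (here refl))
  edge⇒tour (node x k s) (there e∈) with ∈-++⁻ (edges x k) e∈
  ... | inj₁ e∈k = there (∈-++⁺ˡ (proj₁ (edge⇒tour k e∈k))) , there (∈-++⁺ˡ (proj₂ (edge⇒tour k e∈k)))
  ... | inj₂ e∈s = there (∈-++⁺ʳ (tour x k) (there (proj₁ (edge⇒tour s e∈s)))) ,
                   there (∈-++⁺ʳ (tour x k) (there (proj₂ (edge⇒tour s e∈s))))

  length-tour : ∀ p f → length (tour p f) ≡ 2 * length (labels f)
  length-tour p nil = refl
  length-tour p (node v k s)
    rewrite length-++ (tour v k) {(v , p) ∷ tour p s} | length-tour v k | length-tour p s
          | length-++ (labels k) {labels s}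
          | *-distribˡ-+ 2 (suc (length (labels k))) (length (labels s))
          | +-suc (length (labels k)) (length (labels k) + 0)
          | +-suc (2 * length (labels k)) (2 * length (labels s)) = refl

  rotation⇒edge : ∀ {p v l u} f → (v , l) ∈ rotations p f → u ∈ l →
                  (v , u) ∈ edges p f ⊎ (u , v) ∈ edges p f
  rotation⇒edge (node x k s) (here refl) (here refl) = inj₂ (here refl)
  rotation⇒edge (node x k s) (here refl) (there u∈)  = inj₁ (there (∈-++⁺ˡ (roots⇒edge k u∈)))
  rotation⇒edge (node x k s) (there r∈) u∈ with ∈-++⁻ (rotations x k) r∈
  ... | inj₁ r∈k = Sum.map (there ∘ ∈-++⁺ˡ) (there ∘ ∈-++⁺ˡ) (rotation⇒edge k r∈k u∈)
  ... | inj₂ r∈s = Sum.map (there ∘ ∈-++⁺ʳ (edges x k)) (there ∘ ∈-++⁺ʳ (edges x k)) (rotation⇒edge s r∈s u∈)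

  InRotation : List (A × List A) → A → A → Set
  InRotation E v u = ∃ λ l → (v , l) ∈ E × u ∈ l

  -- In the recursion over siblings `l` remains the whole rotation of `p` while `f` shrinks; hence
  -- inclusions rather than equations as hypotheses.
  edge⇒rotation : ∀ {E p u v l} f → (∀ {e} → e ∈ rotations p f → e ∈ E) →
                  (p , l) ∈ E → (∀ {x} → x ∈ roots f → x ∈ l) →
                  (u , v) ∈ edges p f → InRotation E u v × InRotation E v u
  edge⇒rotation {p = p} (node x k s) inc p∈ sub (here refl) =
    (_ , p∈ , sub (here refl)) , (p ∷ roots k , inc (here refl) , here refl)
  edge⇒rotation (node x k s) inc p∈ sub (there e∈) with ∈-++⁻ (edges x k) e∈
  ... | inj₁ e∈k = edge⇒rotation k (inc ∘ there ∘ ∈-++⁺ˡ) (inc (here refl)) there e∈k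
  ... | inj₂ e∈s = edge⇒rotation s (inc ∘ there ∘ ∈-++⁺ʳ (rotations x k)) p∈ (sub ∘ there) e∈s

  data Before (u v : A) : List A → Set where
    now   : ∀ {xs} → v ∈ xs → Before u v (u ∷ xs)
    later : ∀ {x xs} → Before u v xs → Before u v (x ∷ xs)

  before-++ˡ : ∀ {u v xs ys} → Before u v xs → Before u v (xs ++ ys)
  before-++ˡ (now v∈)  = now (∈-++⁺ˡ v∈)
  before-++ˡ (later b) = later (before-++ˡ b)

  before-++ʳ : ∀ {u v} xs {ys} → Before u v ys → Before u v (xs ++ ys)
  before-++ʳ []       b = b
  before-++ʳ (x ∷ xs) b = later (before-++ʳ xs b)

  -- `labels` is a preorder, in which a parent precedes its kids. Positions in it are the rank that
  -- excludes cycles.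
  edge⇒before : ∀ {p u v} f → (u , v) ∈ edges p f → Before u v (p ∷ labels f)
  edge⇒before (node x k s) (here refl) = now (here refl)
  edge⇒before (node x k s) (there e∈) with ∈-++⁻ (edges x k) e∈
  ... | inj₁ e∈k = later (before-++ˡ (edge⇒before k e∈k))
  ... | inj₂ e∈s with edge⇒before s e∈s
  ... | now v∈  = now (there (∈-++⁺ʳ (labels k) v∈))
  ... | later b = later (later (before-++ʳ (labels k) b))

  unique-proj₂ : ∀ {u u′ v : A} {es : List (A × A)} → Unique (map proj₂ es) →
                 (u , v) ∈ es → (u′ , v) ∈ es → u ≡ u′
  unique-proj₂ un (here refl) (here refl) = refl
  unique-proj₂ un (here refl) (there e′)  = contradiction (∈-map⁺ proj₂ e′) (∉-head un)
  unique-proj₂ un (there e)   (here refl) = contradiction (∈-map⁺ proj₂ e) (∉-head un)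
  unique-proj₂ (_ ∷ un) (there e) (there e′) = unique-proj₂ un e e′

  rotations-unique : ∀ {p} f → Unique (p ∷ labels f) → All (Unique ∘ proj₂) (rotations p f)
  roots-unique : ∀ {p} f → Unique (p ∷ labels f) → Unique (p ∷ roots f)

  roots-unique nil u = [] ∷ []
  roots-unique {p} (node v k s) (p≢ ∷ v≢ ∷ u) with unique-++⁻ (labels k) u
  ... | uk , us , _ with roots-unique s (All.++⁻ʳ (labels k) (All.tail p≢) ∷ us)
                       | roots-unique s (All.++⁻ʳ (labels k) v≢ ∷ us)
  ... | pr ∷ _ | vr ∷ ur = (All.head p≢ ∷ pr) ∷ vr ∷ ur

  rotations-unique nil u = []
  rotations-unique {p} (node v k s) ((p≢v ∷ p≢) ∷ v≢ ∷ u) with unique-++⁻ (labels k) u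
  ... | uk , us , _ with roots-unique k (All.++⁻ˡ (labels k) p≢ ∷ uk) | roots-unique k (All.++⁻ˡ (labels k) v≢ ∷ uk)
  ... | pr ∷ ur | _ = (pr ∷ ur) ∷ All.++⁺ (rotations-unique k (All.++⁻ˡ (labels k) v≢ ∷ uk))
                                     (rotations-unique s (All.++⁻ʳ (labels k) p≢ ∷ us))

  rotations-≢2 : ∀ {p} f → NoUnaryNode f → All (λ e → length (proj₂ e) ≢ 2) (rotations p f)
  rotations-≢2 nil _ = []
  rotations-≢2 (node v nil s) (leaf hs) = (λ ()) ∷ rotations-≢2 s hs
  rotations-≢2 (node v k s) (node 2≤ hk hs) =
    (λ eq → contradiction (subst (3 ≤_) eq (s≤s 2≤)) λ { (s≤s (s≤s ())) }) ∷
    All.++⁺ (rotations-≢2 k hk) (rotations-≢2 s hs)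

module _ {n : ℕ} where

  private V = Fin n

  assoc : List (V × List V) → V → List V
  assoc []             v = []
  assoc ((u , l) ∷ es) v = if does (u ≟ v) then l else assoc es v

  assoc-∈ : ∀ {es v l} → Unique (map proj₁ es) → (v , l) ∈ es → assoc es v ≡ l
  assoc-∈ {(u , l) ∷ es} {v} un e∈ with u ≟ v
  assoc-∈ un (here refl) | yes _    = refl
  assoc-∈ un (there e∈)  | yes refl = contradiction (∈-map⁺ proj₁ e∈) (∉-head un)
  assoc-∈ un (here refl) | no u≢    = contradiction refl u≢
  assoc-∈ (_ ∷ un) (there e∈) | no _ = assoc-∈ un e∈

  ∈-assoc : ∀ es {v u} → u ∈ assoc es v → InRotation es v u
  ∈-assoc ((x , l) ∷ es) {v} u∈ with x ≟ v
  ... | yes refl = l , here refl , u∈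
  ... | no _ with ∈-assoc es u∈
  ... | l′ , e∈ , u∈′ = l′ , there e∈ , u∈′

  rank : List V → V → ℕ
  rank []       v = 0
  rank (x ∷ xs) v = if does (x ≟ v) then 0 else suc (rank xs v)

  before⇒rank< : ∀ {u v} xs → Unique xs → Before u v xs → rank xs u < rank xs v
  before⇒rank< {u} {v} (x ∷ xs) un b with x ≟ u | x ≟ v
  before⇒rank< (x ∷ xs) un (now v∈)  | _        | yes refl = contradiction v∈ (∉-head un)
  before⇒rank< (x ∷ xs) un (now v∈)  | yes refl | no _     = z<s
  before⇒rank< (x ∷ xs) un (now v∈)  | no x≢    | no _     = contradiction refl x≢
  before⇒rank< (x ∷ xs) un (later b) | _        | yes refl = contradiction (snd b) (∉-head un)
    where
    snd : ∀ {u v ys} → Before u v ys → v ∈ ys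
    snd (now v∈)  = there v∈
    snd (later b) = there (snd b)
  before⇒rank< (x ∷ xs) un (later b) | yes refl | no _ = z<s
  before⇒rank< (x ∷ xs) (_ ∷ un) (later b) | no _ | no _ = s<s (before⇒rank< xs un b)

  lastOr-∈ : ∀ (x : V) xs → lastOr x xs ∈ x ∷ xs
  lastOr-∈ x []       = here refl
  lastOr-∈ x (y ∷ ys) = there (lastOr-∈ y ys)

  -- A tree walk that has once gone down to a child keeps going down, so a closed walk without
  -- repetition is impossible: all its steps would go the same way.
  module Acyclic (T : Graph n) (D : V → V → Set) (rk : V → ℕ)
                 (D-adj : ∀ {u v} → Adj T u v ≡ true → D u v ⊎ D v u)
                 (D-rk : ∀ {u v} → D u v → rk u < rk v)
                 (D-fun : ∀ {u u′ v} → D u v → D u′ v → u ≡ u′) where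

    -- Parents are unique, so after a step down from y to x a step up could only return to y. The
    -- parent of the last vertex is therefore on the path; the final component says that it is not y
    -- once a second step is made, which is what contradicts a closing edge below y.
    down : ∀ y x xs → D y x → chain T (x ∷ xs) → Unique (y ∷ x ∷ xs) →
           rk y < rk (lastOr x xs) × ∃ λ w → D w (lastOr x xs) × w ∈ y ∷ x ∷ xs ×
             (∀ {z zs} → xs ≡ z ∷ zs → w ∈ x ∷ xs)
    down y x [] d c u = D-rk d , y , d , here refl , λ ()
    down y x (x′ ∷ xs) d (a , c) u@(_ ∷ u′) with D-adj a
    ... | inj₂ d′ = contradiction (there (here (D-fun d d′))) (∉-head u)
    ... | inj₁ d′ with down x x′ xs d′ c u′
    ... | lt , w , dw , w∈ , _ = <-trans (D-rk d) lt , w , dw , there w∈ , λ _ → w∈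

    -- A turn downwards would put the parent of the last vertex on the path by `down`, but that
    -- parent c is off it. So all steps go up.
    up : ∀ {c} y x xs → D x y → chain T (x ∷ xs) → Unique (y ∷ x ∷ xs) →
         D c (lastOr x xs) → c ∉ x ∷ xs → rk (lastOr x xs) < rk y
    up y x [] d ch u dc c∉ = D-rk d
    up y x (x′ ∷ xs) d (a , ch) (_ ∷ u) dc c∉ with D-adj a
    ... | inj₂ d′ = <-trans (up x x′ xs d′ ch u dc (c∉ ∘ there)) (D-rk d)
    ... | inj₁ d′ with down x x′ xs d′ ch u
    ... | _ , w , dw , w∈ , _ = contradiction (subst (_∈ _) (D-fun dw dc) w∈) c∉

    acyclic : ∀ vs → ¬ IsCycle T vs
    acyclic (x ∷ y ∷ []) (s≤s (s≤s ()) , _)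
    acyclic (x ∷ y ∷ z ∷ zs) (_ , u , (a , ch) , cl) with D-adj a | D-adj cl
    ... | inj₁ d | inj₁ d′ = <-asym (D-rk d′) (proj₁ (down x y (z ∷ zs) d ch u))
    ... | inj₁ d | inj₂ d′ with down x y (z ∷ zs) d ch u
    ... | _ , w , dw , _ , w∈ = ∉-head u (subst (_∈ _) (D-fun dw d′) (w∈ refl))
    acyclic (x ∷ y ∷ z ∷ zs) (_ , (_ ∷ u) , (a , ch) , cl) | inj₂ d | inj₁ d′ =
      ∉-head u (subst (_∈ z ∷ zs) (D-fun d′ d) (lastOr-∈ z zs))
    acyclic (x ∷ y ∷ z ∷ zs) (_ , u , (a , ch) , cl) | inj₂ d | inj₂ d′ =
      <-asym (D-rk d′) (up x y (z ∷ zs) d ch u d′ (∉-head u))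

  walk-++ : ∀ {T : Graph n} {u v w} → Walk T u v → Walk T v w → Walk T u w
  walk-++ here       q = q
  walk-++ (step a p) q = step a (walk-++ p q)

  walk-reverse : ∀ {T : Graph n} {u v} → Walk T u v → Walk T v u
  walk-reverse here = here
  walk-reverse {T} (step {u} {w} a p) = walk-++ (walk-reverse p) (step (≡.trans (sym T w u) a) here)

module _ {n : ℕ} where

  private V = Fin n

  first : V → List V → V
  first w []      = w
  first w (x ∷ _) = x

  succIn-first : ∀ (w : V) pre {x} post → x ∉ pre → succIn w (pre ++ x ∷ post) x ≡ first w post
  succIn-first w [] {x} [] x∉ rewrite dec-true (x ≟ x) refl = refl
  succIn-first w [] {x} (y ∷ post) x∉ rewrite dec-true (x ≟ x) refl = refl
  succIn-first w (z ∷ pre) {x} post x∉ rewrite dec-false (z ≟ x) (λ { refl → x∉ (here refl) }) =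
    succIn-first w pre post (x∉ ∘ there)

  first-roots : ∀ w f → first w (roots f) ≡ firstRoot w f
  first-roots w nil          = refl
  first-roots w (node _ _ _) = refl

  module _ (G : Graph n) where

    chain-++⁻ : ∀ xs {ys} → chain G (xs ++ ys) → chain G xs × chain G ys
    chain-++⁻ [] c = tt , c
    chain-++⁻ (x ∷ []) {[]} c = tt , tt
    chain-++⁻ (x ∷ []) {y ∷ ys} (_ , c) = tt , c
    chain-++⁻ (x ∷ x′ ∷ xs) (a , c) with chain-++⁻ (x′ ∷ xs) c
    ... | l , r = (a , l) , r

    chain-++⁺ : ∀ x xs y ys → chain G (x ∷ xs) → chain G (y ∷ ys) → Adj G (lastOr x xs) y ≡ true →
                chain G ((x ∷ xs) ++ y ∷ ys)
    chain-++⁺ x []       y ys c d a = a , d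
    chain-++⁺ x (z ∷ xs) y ys (b , c) d a = b , chain-++⁺ z xs y ys c d a

    chain-++-link : ∀ x xs y ys → chain G ((x ∷ xs) ++ y ∷ ys) → Adj G (lastOr x xs) y ≡ true
    chain-++-link x []       y ys (a , _) = a
    chain-++-link x (z ∷ xs) y ys (_ , c) = chain-++-link z xs y ys c

  lastOr-++ : ∀ (x : V) xs y ys → lastOr x (xs ++ y ∷ ys) ≡ lastOr y ys
  lastOr-++ x []       y ys = refl
  lastOr-++ x (z ∷ xs) y ys = lastOr-++ z xs y ys

  module _ (G : Graph n) where

    CyclicallyAdjacent : List V → Set
    CyclicallyAdjacent xs = chain G xs × closes G xs

    cyclicallyAdjacent-rotate : ∀ xs ys → CyclicallyAdjacent (xs ++ ys) → CyclicallyAdjacent (ys ++ xs)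
    cyclicallyAdjacent-rotate [] ys c = subst CyclicallyAdjacent (≡.sym (++-identityʳ ys)) c
    cyclicallyAdjacent-rotate (x ∷ xs) [] c = subst CyclicallyAdjacent (++-identityʳ (x ∷ xs)) c
    cyclicallyAdjacent-rotate (x ∷ xs) (y ∷ ys) (c , cl) with chain-++⁻ G (x ∷ xs) c
    ... | cx , cy =
      chain-++⁺ G y ys x xs cy cx (subst (λ z → Adj G z x ≡ true) (lastOr-++ x xs y ys) cl) ,
      subst (λ z → Adj G z y ≡ true) (≡.sym (lastOr-++ y ys x xs)) (chain-++-link G x xs y ys c)

    cycPairs-adjacent : ∀ xs {u v} → CyclicallyAdjacent xs → (u , v) ∈ cycPairs xs → Adj G u v ≡ true
    cycPairs-adjacent (x ∷ xs) (c , cl) p∈ = go x xs c cl p∈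
      where
      go : ∀ y ys {u v} → chain G (y ∷ ys) → Adj G (lastOr y ys) x ≡ true →
           (u , v) ∈ zip (y ∷ ys) (ys ++ [ x ]) → Adj G u v ≡ true
      go y [] c cl (here refl) = cl
      go y (z ∷ ys) (a , c) cl (here refl) = a
      go y (z ∷ ys) (a , c) cl (there p∈) = go z ys c cl p∈

  module Plane (r : V) (f : Forest V) (uniq : Unique (r ∷ labels f)) (cover : ∀ v → v ∈ r ∷ labels f) where

    edge-list : List (V × V)
    edge-list = edges r f

    private
      module M = DecMembership (≡-dec {A = V} {B = λ _ → V} _≟_ (λ {_} → _≟_))

    edge? : ∀ u v → Dec ((u , v) ∈ edge-list ⊎ (v , u) ∈ edge-list)
    edge? u v = ((u , v) M.∈? edge-list) ⊎-dec ((v , u) M.∈? edge-list)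

    parent-unique : ∀ {u u′ v} → (u , v) ∈ edge-list → (u′ , v) ∈ edge-list → u ≡ u′
    parent-unique = unique-proj₂ (subst Unique (≡.sym (map-proj₂-edges r f)) (AllPairs.tail uniq))

    edge-rank< : ∀ {u v} → (u , v) ∈ edge-list → rank (r ∷ labels f) u < rank (r ∷ labels f) v
    edge-rank< e = before⇒rank< _ uniq (edge⇒before f e)

    tree : Graph n
    tree = record
      { Adj    = λ u v → does (edge? u v)
      ; sym    = λ u v → does-⇔ (mk⇔ Sum.swap Sum.swap) (edge? u v) (edge? v u)
      ; irrefl = λ v → dec-false (edge? v v) λ { (inj₁ e) → <-irrefl refl (edge-rank< e)
                                               ; (inj₂ e) → <-irrefl refl (edge-rank< e) }
      }

    tree-edge : ∀ {u v} → Adj tree u v ≡ true → (u , v) ∈ edge-list ⊎ (v , u) ∈ edge-list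
    tree-edge {u} {v} = does⇒ (edge? u v)

    edge-tree : ∀ {u v} → (u , v) ∈ edge-list ⊎ (v , u) ∈ edge-list → Adj tree u v ≡ true
    edge-tree {u} {v} = dec-true (edge? u v)

    rotation-list : List (V × List V)
    rotation-list = (r , roots f) ∷ rotations r f

    keys-unique : Unique (map proj₁ rotation-list)
    keys-unique = subst (λ ls → Unique (r ∷ ls)) (≡.sym (map-proj₁-rotations r f)) uniq

    rotationAt : V → List V
    rotationAt = assoc rotation-list

    rotationAt-∈ : ∀ {v l} → (v , l) ∈ rotation-list → rotationAt v ≡ l
    rotationAt-∈ = assoc-∈ keys-unique

    rotation-at-key : ∀ v → ∃ λ l → (v , l) ∈ rotation-list × rotationAt v ≡ l
    rotation-at-key v with ∈-map⁻ proj₁ (subst (λ ls → v ∈ r ∷ ls) (≡.sym (map-proj₁-rotations r f)) (cover v))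
    ... | (_ , l) , e∈ , refl = l , e∈ , rotationAt-∈ e∈

    all-rotations : ∀ {P : List V → Set} → All (P ∘ proj₂) rotation-list → ∀ v → P (rotationAt v)
    all-rotations {P} ps v with rotation-at-key v
    ... | l , e∈ , eq = subst P (≡.sym eq) (All.lookup ps e∈)

    rotationAt-unique : ∀ v → Unique (rotationAt v)
    rotationAt-unique = all-rotations {Unique} (AllPairs.tail (roots-unique f uniq) ∷ rotations-unique f uniq)

    rotationAt-sound : ∀ v u → u ∈ rotationAt v → Adj tree v u ≡ true
    rotationAt-sound v u u∈ with ∈-assoc rotation-list u∈
    ... | l , here refl , u∈l = edge-tree (inj₁ (roots⇒edge f u∈l))
    ... | l , there e∈ , u∈l = edge-tree (rotation⇒edge f e∈ u∈l)

    rotationAt-complete : ∀ v u → Adj tree v u ≡ true → u ∈ rotationAt v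
    rotationAt-complete v u a with tree-edge a
    ... | inj₁ e with edge⇒rotation {E = rotation-list} f there (here refl) id e
    ... | (l , e∈ , u∈) , _ = subst (u ∈_) (≡.sym (rotationAt-∈ e∈)) u∈
    rotationAt-complete v u a | inj₂ e with edge⇒rotation {E = rotation-list} f there (here refl) id e
    ... | _ , (l , e∈ , u∈) = subst (u ∈_) (≡.sym (rotationAt-∈ e∈)) u∈

    rotation : Rotation tree
    rotation = record { rot = rotationAt ; rot-uniq = rotationAt-unique
                      ; rot-sound = rotationAt-sound ; rot-compl = rotationAt-complete }

    degree≡ : ∀ v → degree tree v ≡ length (rotationAt v)
    degree≡ v = ↭-length (same-members⇒↭ (Unique.filter⁺ (λ u → T? (Adj tree v u)) (Unique.allFin⁺ n)) (rotationAt-unique v)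
      (λ u∈ → rotationAt-complete v _ (proj₂ (∈-filterᵇ⁻ (allFin n) u∈)))
      (λ u∈ → ∈-filterᵇ⁺ (∈-allFin _) (rotationAt-sound v _ u∈)))

    walk-down : ∀ {p v} g → (∀ {e} → e ∈ edges p g → e ∈ edge-list) → v ∈ labels g → Walk tree p v
    walk-down (node x k s) inc (here refl) = step (edge-tree (inj₁ (inc (here refl)))) here
    walk-down (node x k s) inc (there v∈) with ∈-++⁻ (labels k) v∈
    ... | inj₁ v∈k = step (edge-tree (inj₁ (inc (here refl)))) (walk-down k (inc ∘ there ∘ ∈-++⁺ˡ) v∈k)
    ... | inj₂ v∈s = walk-down s (inc ∘ there ∘ ∈-++⁺ʳ (edges x k)) v∈s

    walk-from-root : ∀ v → Walk tree r v
    walk-from-root v with cover v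
    ... | here refl = here
    ... | there v∈  = walk-down f id v∈

    tree-isTree : IsTree tree
    tree-isTree = (λ u v → walk-++ (walk-reverse (walk-from-root u)) (walk-from-root v)) ,
      Acyclic.acyclic tree (λ u v → (u , v) ∈ edge-list) (rank (r ∷ labels f)) tree-edge edge-rank< parent-unique

    data FaceWalk : V × V → List (V × V) → V × V → Set where
      []  : ∀ {d} → FaceWalk d [] d
      _∷_ : ∀ d {ds e} → FaceWalk (faceStep rotation d) ds e → FaceWalk d (d ∷ ds) e

    faceWalk-++ : ∀ {d e g ds es} → FaceWalk d ds e → FaceWalk e es g → FaceWalk d (ds ++ es) g
    faceWalk-++ []      q = q
    faceWalk-++ (d ∷ p) q = d ∷ faceWalk-++ p q

    faceWalk-++⁻ : ∀ {d g} ds {e es} → FaceWalk d (ds ++ e ∷ es) g → FaceWalk d ds e × FaceWalk e (e ∷ es) g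
    faceWalk-++⁻ []       (d ∷ p) = [] , d ∷ p
    faceWalk-++⁻ (_ ∷ ds) (d ∷ p) with faceWalk-++⁻ ds p
    ... | q , s = d ∷ q , s

    faceWalk-from : ∀ {d d′ ds e} → d ≡ d′ → FaceWalk d ds e → FaceWalk d′ ds e
    faceWalk-from refl p = p

    faceWalk-≡ : ∀ {d ds e} → FaceWalk d ds e → faceWalk rotation (length ds) d ≡ ds
    faceWalk-≡ []      = refl
    faceWalk-≡ (d ∷ p) = cong (d ∷_) (faceWalk-≡ p)

    σ-next : ∀ {v l x} pre post → (v , l) ∈ rotation-list → l ≡ pre ++ x ∷ post → x ∉ pre →
             σ rotation v x ≡ first (first x l) post
    σ-next {v} {l} [] post e∈ refl x∉ rewrite rotationAt-∈ e∈ = succIn-first _ [] post (λ ())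
    σ-next {v} {l} (z ∷ pre) post e∈ refl x∉ rewrite rotationAt-∈ e∈ = succIn-first z (z ∷ pre) post x∉

    -- The walk tours one tree, comes back to p and goes on to the next entry of the rotation `l`,
    -- of which `pre` has been passed already. After the last tree the rotation wraps around to its
    -- first entry w: the parent if p is below the root, the first kid if p is the root.
    subforest-walk : ∀ {p w l} pre g → (p , l) ∈ rotation-list → l ≡ pre ++ roots g → w ≡ first w l →
                     (∀ {e} → e ∈ rotations p g → e ∈ rotation-list) → Unique (p ∷ labels g) → Unique l →
                     FaceWalk (p , firstRoot w g) (tour p g) (p , w)
    subforest-walk pre nil p∈ eq weq inc un ul = []
    subforest-walk {p} {w} {l} pre (node v k s) p∈ eq weq inc ((p≢v ∷ p≢) ∷ v≢ ∷ un) ul with unique-++⁻ (labels k) un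
    ... | uk , us , _ = (p , v) ∷ faceWalk-from (cong (v ,_) (≡.sym enter))
      (faceWalk-++ kids ((v , p) ∷ faceWalk-from (cong (p ,_) (≡.sym leave)) sibs))
      where
      enter : σ rotation v p ≡ firstRoot p k
      enter = ≡.trans (σ-next [] (roots k) (inc (here refl)) refl (λ ())) (first-roots p k)
      kids : FaceWalk (v , firstRoot p k) (tour v k) (v , p)
      kids = subforest-walk [ p ] k (inc (here refl)) refl refl (inc ∘ there ∘ ∈-++⁺ˡ) (All.++⁻ˡ (labels k) v≢ ∷ uk)
               (roots-unique {p = p} k (All.++⁻ˡ (labels k) p≢ ∷ uk))
      v∉pre : v ∉ pre
      v∉pre v∈ = proj₂ (proj₂ (unique-++⁻ pre (subst Unique eq ul))) v∈ (here refl)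
      wrap : ∀ pre l → l ≡ pre ++ v ∷ roots s → w ≡ first w l → first (first v l) (roots s) ≡ firstRoot w s
      wrap []      _ refl weq = ≡.trans (cong (λ z → first z (roots s)) (≡.sym weq)) (first-roots w s)
      wrap (_ ∷ _) _ refl weq = ≡.trans (cong (λ z → first z (roots s)) (≡.sym weq)) (first-roots w s)
      leave : σ rotation p v ≡ firstRoot w s
      leave = ≡.trans (σ-next pre (roots s) p∈ eq v∉pre) (wrap pre l eq weq)
      sibs : FaceWalk (p , firstRoot w s) (tour p s) (p , w)
      sibs = subforest-walk (pre ++ [ v ]) s p∈ (≡.trans eq (≡.sym (++-assoc pre [ v ] (roots s)))) weq
               (inc ∘ there ∘ ∈-++⁺ʳ (rotations v k)) (All.++⁻ʳ (labels k) p≢ ∷ us) ul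

    closed-tour : FaceWalk (r , firstRoot r f) (tour r f) (r , firstRoot r f)
    closed-tour = go f refl
      where
      go : ∀ g → g ≡ f → FaceWalk (r , firstRoot r f) (tour r f) (r , firstRoot r f)
      go nil refl = []
      go (node v k s) refl = subforest-walk [] f (here refl) refl refl there uniq (AllPairs.tail (roots-unique f uniq))

    n≡ : n ≡ suc (length (labels f))
    n≡ = ≡.trans (≡.sym (length-tabulate id))
           (↭-length (same-members⇒↭ (Unique.allFin⁺ n) uniq (λ _ → cover _) (λ _ → ∈-allFin _)))

    dart∈tour : ∀ {d} → d ∈ darts rotation → d ∈ tour r f
    dart∈tour {u , w} d∈ with satisfied (∈-concatMap⁻ (λ u → map (u ,_) (rotationAt u)) {xs = allFin n} d∈)
    ... | u , d∈′ with ∈-map⁻ (u ,_) d∈′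
    ... | w , w∈ , refl with tree-edge (rotationAt-sound u w w∈)
    ... | inj₁ e = proj₁ (edge⇒tour f e)
    ... | inj₂ e = proj₂ (edge⇒tour f e)

    -- `boundary` starts at the first listed dart, which need not leave the root. The tour is a
    -- closed face walk through all darts, so a different start only rotates it, and its length is
    -- exactly the 2(n - 1) steps made by `boundary`.
    boundary-rotates : ∃₂ λ ds es → tour r f ≡ ds ++ es × boundary rotation ≡ es ++ ds
    boundary-rotates with darts rotation in eq
    ... | [] = [] , [] , tour-empty f refl , refl
      where
      no-darts : ∀ {u w} → w ∉ rotationAt u
      no-darts {u} {w} w∈ with subst ((u , w) ∈_) eq (∈-concatMap⁺′ w∈)
        where
        ∈-concatMap⁺′ : w ∈ rotationAt u → (u , w) ∈ darts rotation
        ∈-concatMap⁺′ w∈ = ∈-concatMap⁺ (λ u → map (u ,_) (rotationAt u))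
                             (Any.map (λ { refl → ∈-map⁺ (u ,_) w∈ }) (∈-allFin u))
      ... | ()
      tour-empty : ∀ g → g ≡ f → tour r g ≡ []
      tour-empty nil _ = refl
      tour-empty (node v k s) refl = contradiction (rotationAt-complete r v (edge-tree (inj₁ (here refl)))) no-darts
    ... | d ∷ _ with ∈-∃++ (dart∈tour {d} (subst (d ∈_) (≡.sym eq) (here refl)))
    ... | ds , es , teq with faceWalk-++⁻ ds (subst (λ t → FaceWalk (r , firstRoot r f) t (r , firstRoot r f)) teq closed-tour)
    ... | p , q = ds , d ∷ es , teq , ≡.trans (cong (λ m → faceWalk rotation m d) len) (faceWalk-≡ (faceWalk-++ q p))
      where
      open ≡.≡-Reasoning
      len : 2 * (n ∸ 1) ≡ length ((d ∷ es) ++ ds)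
      len = begin
        2 * (n ∸ 1)               ≡⟨ cong (λ m → 2 * (m ∸ 1)) n≡ ⟩
        2 * length (labels f)     ≡⟨ length-tour r f ⟨
        length (tour r f)         ≡⟨ cong length teq ⟩
        length (ds ++ d ∷ es)     ≡⟨ length-++ ds ⟩
        length ds + length (d ∷ es) ≡⟨ +-comm (length ds) _ ⟩
        length (d ∷ es) + length ds ≡⟨ length-++ (d ∷ es) ⟨
        length ((d ∷ es) ++ ds)   ∎

    isLeaf : V → Bool
    isLeaf v = degree tree v ≡ᵇ 1

    isLeaf-rotation : ∀ {v l} → (v , l) ∈ rotation-list → isLeaf v ≡ (length l ≡ᵇ 1)
    isLeaf-rotation {v} e∈ = cong (_≡ᵇ 1) (≡.trans (degree≡ v) (cong length (rotationAt-∈ e∈)))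

    -- A leaf is the target of a single dart of the tour. An inner vertex is the target of several,
    -- from its parent and from each kid, and the filter drops all of them.
    filter-leaves : ∀ {p} g → isLeaf p ≡ false → NoUnaryNode g → (∀ {e} → e ∈ rotations p g → e ∈ rotation-list) →
                    filterᵇ isLeaf (map proj₂ (tour p g)) ≡ leaves g
    filter-leaves nil pl _ inc = refl
    filter-leaves (node v nil s) pl (leaf hs) inc rewrite isLeaf-rotation (inc (here refl)) | pl =
      cong (v ∷_) (filter-leaves s pl hs (inc ∘ there))
    filter-leaves (node v nil s) pl (node () _ _)
    filter-leaves {p} (node v k@(node _ _ _) s) pl (node 2≤ hk hs) inc = begin
      filterᵇ isLeaf (v ∷ map proj₂ (tour v k ++ (v , p) ∷ tour p s))   ≡⟨ drop-v ⟩
      filterᵇ isLeaf (map proj₂ (tour v k ++ (v , p) ∷ tour p s))       ≡⟨ cong (filterᵇ isLeaf) (map-++ proj₂ (tour v k) _) ⟩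
      filterᵇ isLeaf (map proj₂ (tour v k) ++ p ∷ map proj₂ (tour p s)) ≡⟨ filter-++ (T? ∘ isLeaf) (map proj₂ (tour v k)) _ ⟩
      filterᵇ isLeaf (map proj₂ (tour v k)) ++ filterᵇ isLeaf (p ∷ map proj₂ (tour p s))
        ≡⟨ cong₂ _++_ (filter-leaves k v-inner hk (inc ∘ there ∘ ∈-++⁺ˡ)) drop-p ⟩
      leaves k ++ leaves s ∎
      where
      open ≡.≡-Reasoning
      v-inner : isLeaf v ≡ false
      v-inner = isLeaf-rotation (inc (here refl))
      drop-v : ∀ {xs} → filterᵇ isLeaf (v ∷ xs) ≡ filterᵇ isLeaf xs
      drop-v rewrite v-inner = refl
      drop-p : filterᵇ isLeaf (p ∷ map proj₂ (tour p s)) ≡ leaves s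
      drop-p rewrite pl = filter-leaves s pl hs (inc ∘ there ∘ ∈-++⁺ʳ (rotations v k))

    module _ (3≤ : 3 ≤ length (roots f)) (nu : NoUnaryNode f) where

      tree-isHIT : IsHIT tree
      tree-isHIT = tree-isTree , λ v d≡2 → all-rotations {λ l → length l ≢ 2}
        ((λ eq → contradiction (subst (3 ≤_) eq 3≤) λ { (s≤s (s≤s ())) }) ∷ rotations-≢2 f nu) v
        (≡.trans (≡.sym (degree≡ v)) d≡2)

      root-inner : isLeaf r ≡ false
      root-inner = ≡.trans (isLeaf-rotation (here refl)) (≥3⇒≢1 (length (roots f)) 3≤)
        where
        ≥3⇒≢1 : ∀ m → 3 ≤ m → (m ≡ᵇ 1) ≡ false
        ≥3⇒≢1 (suc (suc m)) _ = refl
        ≥3⇒≢1 1 (s≤s ())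

      leafOrder-rotates : ∃₂ λ xs ys → leaves f ≡ xs ++ ys × leafOrder tree rotation ≡ ys ++ xs
      leafOrder-rotates with boundary-rotates
      ... | ds , es , teq , beq = lf ds , lf es ,
        ≡.trans (≡.sym (filter-leaves f root-inner nu there)) (≡.trans (cong lf teq) (lf-++ ds es)) ,
        ≡.trans (cong lf beq) (lf-++ es ds)
        where
        lf : List (V × V) → List V
        lf ds = filterᵇ isLeaf (map proj₂ ds)
        lf-++ : ∀ ds es → lf (ds ++ es) ≡ lf ds ++ lf es
        lf-++ ds es = ≡.trans (cong (filterᵇ isLeaf) (map-++ proj₂ ds es)) (filter-++ (T? ∘ isLeaf) (map proj₂ ds) _)

      halin : (G : Graph n) → All (λ e → Adj G (proj₁ e) (proj₂ e) ≡ true) (edges r f) →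
              CyclicallyAdjacent G (leaves f) → HasSpanningHalin G
      halin G eG cG = H , (4≤n , tree , rotation , tree-isHIT , λ u v → does⇒ (halinEdge? u v) , dec-true (halinEdge? u v)) ,
                      λ u v a → halinEdge⇒G (does⇒ (halinEdge? u v) a)
        where
        halinEdge? : ∀ u v → Dec (HalinEdge tree rotation u v)
        halinEdge? u v = (Adj tree u v Bool.≟ true) ⊎-dec (((u , v) M.∈? _) ⊎-dec ((v , u) M.∈? _))

        halinEdge-sym : ∀ {u v} → HalinEdge tree rotation u v → HalinEdge tree rotation v u
        halinEdge-sym {u} {v} = Sum.map (≡.trans (Graph.sym tree v u)) Sum.swap

        cycle-adjacent : CyclicallyAdjacent G (leafOrder tree rotation)
        cycle-adjacent with leafOrder-rotates
        ... | xs , ys , leq , oeq = subst (CyclicallyAdjacent G) (≡.sym oeq)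
          (cyclicallyAdjacent-rotate G xs ys (subst (CyclicallyAdjacent G) leq cG))

        symG : ∀ {u v} → Adj G u v ≡ true → Adj G v u ≡ true
        symG {u} {v} a = ≡.trans (Graph.sym G v u) a

        halinEdge⇒G : ∀ {u v} → HalinEdge tree rotation u v → Adj G u v ≡ true
        halinEdge⇒G (inj₁ a) with tree-edge a
        ... | inj₁ e = All.lookup eG e
        ... | inj₂ e = symG (All.lookup eG e)
        halinEdge⇒G (inj₂ (inj₁ c)) = cycPairs-adjacent G _ cycle-adjacent c
        halinEdge⇒G (inj₂ (inj₂ c)) = symG (cycPairs-adjacent G _ cycle-adjacent c)

        H : Graph n
        H = record
          { Adj    = λ u v → does (halinEdge? u v)
          ; sym    = λ u v → does-⇔ (mk⇔ halinEdge-sym halinEdge-sym) (halinEdge? u v) (halinEdge? v u)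
          -- A loop among the pairs of the leaf cycle is excluded through G: every Halin edge is an
          -- edge of G, which has no loops.
          ; irrefl = λ v → dec-false (halinEdge? v v) λ e →
              contradiction (≡.trans (≡.sym (halinEdge⇒G e)) (irrefl G v)) λ ()
          }

        roots≤ : ∀ g → length (roots g) ≤ length (labels {A = V} g)
        roots≤ nil = z≤n
        roots≤ (node x k s) rewrite length-++ (labels k) {labels s} =
          s≤s (≤-trans (roots≤ s) (subst (length (labels s) ≤_) (+-comm (length (labels s)) _) (m≤m+n _ _)))

        4≤n : 4 ≤ n
        4≤n = subst (4 ≤_) (≡.sym n≡) (s≤s (≤-trans 3≤ (roots≤ f)))

-- Caterpillars

module _ {n : ℕ} where

  private V = Fin n

  record Block : Set where
    constructor block
    field
      spine     : V
      firstLeaf : V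
      moreLeaves : List V

    leafRow : List V
    leafRow = firstLeaf ∷ moreLeaves

    lastLeaf : V
    lastLeaf = lastOr firstLeaf moreLeaves

  open Block public

  vertices : List Block → List V
  vertices []       = []
  vertices (b ∷ bs) = spine b ∷ leafRow b ++ vertices bs

  allLeaves : List Block → List V
  allLeaves []       = []
  allLeaves (b ∷ bs) = leafRow b ++ allLeaves bs

  finalLeaf : Block → List Block → V
  finalLeaf b []        = lastLeaf b
  finalLeaf b (b′ ∷ bs) = finalLeaf b′ bs

  -- A spine vertex followed by another one has it as an additional kid, so one leaf suffices; the
  -- last spine vertex would have degree 2 with only one leaf.
  FinalFat : List Block → Set
  FinalFat []            = ⊤
  FinalFat (b ∷ [])      = 1 ≤ length (moreLeaves b)
  FinalFat (b ∷ b′ ∷ bs) = FinalFat (b′ ∷ bs)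

  -- The next spine vertex is placed after all leaves of the current one. Thus the leaves lie on one
  -- side of the spine and the leaf order is the concatenation of the rows.
  rowForest : List V → Forest V → Forest V
  rowForest []       g = g
  rowForest (l ∷ ls) g = node l nil (rowForest ls g)

  caterpillar : List Block → Forest V
  caterpillar []       = nil
  caterpillar (b ∷ bs) = node (spine b) (rowForest (leafRow b) (caterpillar bs)) nil

  labels-row : ∀ ls g → labels (rowForest ls g) ≡ ls ++ labels g
  labels-row []       g = refl
  labels-row (l ∷ ls) g = cong (l ∷_) (labels-row ls g)

  labels-caterpillar : ∀ bs → labels (caterpillar bs) ≡ vertices bs
  labels-caterpillar []       = refl
  labels-caterpillar (b ∷ bs) = cong (spine b ∷_) (≡.trans (++-identityʳ _)
    (≡.trans (labels-row (leafRow b) _) (cong (leafRow b ++_) (labels-caterpillar bs))))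

  leaves-row : ∀ ls g → leaves (rowForest ls g) ≡ ls ++ leaves g
  leaves-row []       g = refl
  leaves-row (l ∷ ls) g = cong (l ∷_) (leaves-row ls g)

  leaves-caterpillar : ∀ bs → leaves (caterpillar bs) ≡ allLeaves bs
  leaves-caterpillar []       = refl
  leaves-caterpillar (b ∷ bs) = ≡.trans (++-identityʳ _)
    (≡.trans (leaves-row (leafRow b) _) (cong (leafRow b ++_) (leaves-caterpillar bs)))

  length-roots-row : ∀ ls g → length (roots (rowForest ls g)) ≡ length ls + length (roots g)
  length-roots-row []       g = refl
  length-roots-row (l ∷ ls) g = cong suc (length-roots-row ls g)

  noUnary-row : ∀ ls {g} → NoUnaryNode g → NoUnaryNode (rowForest ls g)
  noUnary-row []       h = h
  noUnary-row (l ∷ ls) h = leaf (noUnary-row ls h)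

  noUnary-caterpillar : ∀ bs → FinalFat bs → NoUnaryNode (caterpillar bs)
  noUnary-caterpillar [] _ = nil
  noUnary-caterpillar (block s l (l′ ∷ ls) ∷ []) fat =
    node (s≤s (s≤s z≤n)) (noUnary-row (l ∷ l′ ∷ ls) nil) nil
  noUnary-caterpillar (b ∷ b′ ∷ bs) fat =
    node (subst (2 ≤_) (≡.sym (length-roots-row (leafRow b) (caterpillar (b′ ∷ bs)))) (two (length (moreLeaves b))))
         (noUnary-row (leafRow b) (noUnary-caterpillar (b′ ∷ bs) fat)) nil
    where
    two : ∀ m → 2 ≤ suc m + 1
    two m = s≤s (subst (1 ≤_) (+-comm 1 m) (s≤s z≤n))

  module _ (G : Graph n) where

    LinksTo : Block → List Block → Set
    LinksTo b []       = ⊤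
    LinksTo b (b′ ∷ _) = Adj G (spine b) (spine b′) ≡ true × Adj G (lastLeaf b) (firstLeaf b′) ≡ true

    Linked : List Block → Set
    Linked []       = ⊤
    Linked (b ∷ bs) = All (λ l → Adj G (spine b) l ≡ true) (leafRow b) × chain G (leafRow b)
                      × LinksTo b bs × Linked bs

    private
      AdjPair : V × V → Set
      AdjPair e = Adj G (proj₁ e) (proj₂ e) ≡ true

    edges-row : ∀ {p} ls {g} → All (λ l → Adj G p l ≡ true) ls → All AdjPair (edges p g) →
                All AdjPair (edges p (rowForest ls g))
    edges-row []       _        h = h
    edges-row (l ∷ ls) (a ∷ as) h = a ∷ edges-row ls as h

    edges-caterpillar : ∀ b bs → LinksTo b bs → Linked bs → All AdjPair (edges (spine b) (caterpillar bs))
    edges-caterpillar b [] _ _ = []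
    edges-caterpillar b (b′ ∷ bs) (a , _) (as , _ , lk , rest) =
      a ∷ All.++⁺ (edges-row (leafRow b′) as (edges-caterpillar b′ bs lk rest)) []

    allLeaves-chain : ∀ b bs → Linked (b ∷ bs) → chain G (leafRow b ++ allLeaves bs)
    allLeaves-chain b [] (_ , c , _) = subst (chain G) (≡.sym (++-identityʳ (leafRow b))) c
    allLeaves-chain b (b′ ∷ bs) (_ , c , (_ , a) , rest) =
      chain-++⁺ G (firstLeaf b) (moreLeaves b) (firstLeaf b′) (moreLeaves b′ ++ allLeaves bs) c (allLeaves-chain b′ bs rest) a

    lastOr-allLeaves : ∀ b bs → lastOr (firstLeaf b) (moreLeaves b ++ allLeaves bs) ≡ finalLeaf b bs
    lastOr-allLeaves b [] = cong (lastOr (firstLeaf b)) (++-identityʳ (moreLeaves b))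
    lastOr-allLeaves b (b′ ∷ bs) = ≡.trans (lastOr-++ (firstLeaf b) (moreLeaves b) (firstLeaf b′) _) (lastOr-allLeaves b′ bs)

    -- The leaf cycle consists of the rows in order, closed by the edge from the final leaf to the
    -- first. The first spine vertex is the root, hence the separate demand for three kids.
    caterpillar-halin : ∀ b bs → Linked (b ∷ bs) → Adj G (finalLeaf b bs) (firstLeaf b) ≡ true →
                        3 ≤ length (leafRow b) + length (roots (caterpillar bs)) → FinalFat bs →
                        Unique (vertices (b ∷ bs)) → (∀ v → v ∈ vertices (b ∷ bs)) → HasSpanningHalin G
    caterpillar-halin b bs lk@(as , c , lk′ , rest) cl 3≤ fat un cov =
      Plane.halin (spine b) f (subst Unique (≡.sym labels≡) un) (λ v → subst (v ∈_) (≡.sym labels≡) (cov v))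
        (subst (3 ≤_) (≡.sym (length-roots-row (leafRow b) _)) 3≤) (noUnary-row (leafRow b) (noUnary-caterpillar bs fat)) G
        (edges-row (leafRow b) as (edges-caterpillar b bs lk′ rest))
        (subst (CyclicallyAdjacent G) (≡.sym leaves≡)
          (allLeaves-chain b bs lk , subst (λ z → Adj G z _ ≡ true) (≡.sym (lastOr-allLeaves b bs)) cl))
      where
      f : Forest V
      f = rowForest (leafRow b) (caterpillar bs)
      labels≡ : spine b ∷ labels f ≡ vertices (b ∷ bs)
      labels≡ = cong (spine b ∷_) (≡.trans (labels-row (leafRow b) _) (cong (leafRow b ++_) (labels-caterpillar bs)))
      leaves≡ : leaves f ≡ leafRow b ++ allLeaves bs
      leaves≡ = ≡.trans (leaves-row (leafRow b) _) (cong (leafRow b ++_) (leaves-caterpillar bs))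

-- Linear arithmetic and counting

-- Linear arithmetic over ℕ by certificates: `lin` checks that the given nonnegative combination
-- of the hypotheses with the negated goal is absurd coefficient by coefficient.
module Linear where

  infix  9 #_
  infixl 8 _⊛_
  infixl 7 _⊕_
  infix  6 _≼_

  data Exp : Set where
    #_  : ℕ → Exp
    κ   : ℕ → Exp
    _⊕_ : Exp → Exp → Exp
    _⊛_ : ℕ → Exp → Exp

  record Ineq : Set where
    constructor _≼_
    field lhs rhs : Exp
  open Ineq

  at : List ℕ → ℕ → ℕ
  at []       _       = 0
  at (x ∷ _)  zero    = x
  at (_ ∷ xs) (suc i) = at xs i

  ⟦_⟧ : Exp → List ℕ → ℕ
  ⟦ # i ⟧   ρ = at ρ i
  ⟦ κ c ⟧   ρ = c
  ⟦ a ⊕ b ⟧ ρ = ⟦ a ⟧ ρ + ⟦ b ⟧ ρ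
  ⟦ c ⊛ a ⟧ ρ = c * ⟦ a ⟧ ρ

  Holds : List ℕ → Ineq → Set
  Holds ρ (a ≼ b) = ⟦ a ⟧ ρ ≤ ⟦ b ⟧ ρ

  All-hold : List ℕ → List Ineq → Set
  All-hold ρ []           = ⊤
  All-hold ρ (h ∷ [])     = Holds ρ h
  All-hold ρ (h ∷ h′ ∷ hs) = Holds ρ h × All-hold ρ (h′ ∷ hs)

  addᶜ : List ℕ → List ℕ → List ℕ
  addᶜ []       ys       = ys
  addᶜ (x ∷ xs) []       = x ∷ xs
  addᶜ (x ∷ xs) (y ∷ ys) = x + y ∷ addᶜ xs ys

  unitᶜ : ℕ → List ℕ
  unitᶜ zero    = 1 ∷ []
  unitᶜ (suc i) = 0 ∷ unitᶜ i

  coeffs : Exp → List ℕ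
  coeffs (# i)   = unitᶜ i
  coeffs (κ c)   = []
  coeffs (a ⊕ b) = addᶜ (coeffs a) (coeffs b)
  coeffs (c ⊛ a) = map (c *_) (coeffs a)

  const : Exp → ℕ
  const (# i)   = 0
  const (κ c)   = c
  const (a ⊕ b) = const a + const b
  const (c ⊛ a) = c * const a

  dot : List ℕ → List ℕ → ℕ
  dot []       ρ       = 0
  dot (c ∷ cs) []      = 0
  dot (c ∷ cs) (x ∷ ρ) = c * x + dot cs ρ

  dot-add : ∀ xs ys ρ → dot (addᶜ xs ys) ρ ≡ dot xs ρ + dot ys ρ
  dot-add [] ys ρ = refl
  dot-add (x ∷ xs) [] ρ = ≡.sym (+-identityʳ _)
  dot-add (x ∷ xs) (y ∷ ys) [] = refl
  dot-add (x ∷ xs) (y ∷ ys) (z ∷ ρ) rewrite *-distribʳ-+ z x y | dot-add xs ys ρ = interchange (x * z) (y * z) _ _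

  dot-scale : ∀ c xs ρ → dot (map (c *_) xs) ρ ≡ c * dot xs ρ
  dot-scale c [] ρ = ≡.sym (*-zeroʳ c)
  dot-scale c (x ∷ xs) [] = ≡.sym (*-zeroʳ c)
  dot-scale c (x ∷ xs) (z ∷ ρ) rewrite *-distribˡ-+ c (x * z) (dot xs ρ) | dot-scale c xs ρ | *-assoc c x z = refl

  dot-unit : ∀ i ρ → dot (unitᶜ i) ρ ≡ at ρ i
  dot-unit zero    []      = refl
  dot-unit zero    (x ∷ ρ) = ≡.trans (+-identityʳ _) (+-identityʳ x)
  dot-unit (suc i) []      = refl
  dot-unit (suc i) (x ∷ ρ) = dot-unit i ρ

  normal : ∀ e ρ → ⟦ e ⟧ ρ ≡ dot (coeffs e) ρ + const e
  normal (# i) ρ = ≡.sym (≡.trans (+-identityʳ _) (dot-unit i ρ))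
  normal (κ c) ρ = refl
  normal (a ⊕ b) ρ rewrite normal a ρ | normal b ρ | dot-add (coeffs a) (coeffs b) ρ =
    interchange (dot (coeffs a) ρ) (const a) (dot (coeffs b) ρ) (const b)
  normal (c ⊛ a) ρ rewrite normal a ρ | dot-scale c (coeffs a) ρ = *-distribˡ-+ c (dot (coeffs a) ρ) (const a)

  _≤ᶜ_ : List ℕ → List ℕ → Bool
  []       ≤ᶜ ys       = true
  (x ∷ xs) ≤ᶜ []       = (x ≤ᵇ 0) ∧ (xs ≤ᶜ [])
  (x ∷ xs) ≤ᶜ (y ∷ ys) = (x ≤ᵇ y) ∧ (xs ≤ᶜ ys)

  ∧-split : ∀ a {b} → T (a ∧ b) → T a × T b
  ∧-split true t = tt , t

  dot-mono : ∀ xs ys ρ → T (xs ≤ᶜ ys) → dot xs ρ ≤ dot ys ρ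
  dot-mono [] ys ρ t = z≤n
  dot-mono (x ∷ xs) ys [] t = z≤n
  dot-mono (x ∷ xs) [] (z ∷ ρ) t with ∧-split (x ≤ᵇ 0) t
  ... | t₁ , t₂ rewrite n≤0⇒n≡0 (≤ᵇ⇒≤ x 0 t₁) = dot-mono xs [] ρ t₂
  dot-mono (x ∷ xs) (y ∷ ys) (z ∷ ρ) t with ∧-split (x ≤ᵇ y) t
  ... | t₁ , t₂ = +-mono-≤ (*-monoˡ-≤ z (≤ᵇ⇒≤ x y t₁)) (dot-mono xs ys ρ t₂)

  combine : (Ineq → Exp) → List ℕ → List Ineq → Exp
  combine side (c ∷ cs) (h ∷ hs) = c ⊛ side h ⊕ combine side cs hs
  combine side _        _        = κ 0

  combine-mono : ∀ cs hs ρ → All-hold ρ hs → ⟦ combine lhs cs hs ⟧ ρ ≤ ⟦ combine rhs cs hs ⟧ ρ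
  combine-mono []       hs ρ _ = ≤-refl
  combine-mono (c ∷ cs) [] ρ _ = ≤-refl
  combine-mono (c ∷ cs) (h ∷ []) ρ p = +-mono-≤ (*-monoʳ-≤ c p) (≤-reflexive (empty cs))
    where
    empty : ∀ cs → ⟦ combine lhs cs [] ⟧ ρ ≡ ⟦ combine rhs cs [] ⟧ ρ
    empty []      = refl
    empty (_ ∷ _) = refl
  combine-mono (c ∷ cs) (h ∷ h′ ∷ hs) ρ (p , ps) = +-mono-≤ (*-monoʳ-≤ c p) (combine-mono cs (h′ ∷ hs) ρ ps)

  -- The hypotheses together with the negated goal `1 + rhs ≤ lhs` give `lower < upper`, while
  -- `check` compares coefficients and constants to give `upper ≤ lower`. With multiplier m = 0 the
  -- hypotheses alone are refuted; this is how goals `1 ≤ 0` are proved.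
  upper lower : ℕ → List ℕ → List Ineq → Ineq → Exp
  upper m cs hs g = combine rhs cs hs ⊕ m ⊛ lhs g ⊕ κ 1
  lower m cs hs g = combine lhs cs hs ⊕ m ⊛ (κ 1 ⊕ rhs g)

  check : ℕ → List ℕ → List Ineq → Ineq → Bool
  check m cs hs g = (coeffs (upper m cs hs g) ≤ᶜ coeffs (lower m cs hs g))
                    ∧ (const (upper m cs hs g) ≤ᵇ const (lower m cs hs g))

  lin : ∀ ρ hs g m cs → {T (check m cs hs g)} → All-hold ρ hs → Holds ρ g
  lin ρ hs g m cs {t} ps with ⟦ lhs g ⟧ ρ ≤? ⟦ rhs g ⟧ ρ
  ... | yes p = p
  ... | no ¬p = contradiction absurd (<-irrefl refl)
    where
    open ≤-Reasoning
    up lo : Exp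
    up = upper m cs hs g
    lo = lower m cs hs g
    dominated : ⟦ up ⟧ ρ ≤ ⟦ lo ⟧ ρ
    dominated rewrite normal up ρ | normal lo ρ with ∧-split (coeffs up ≤ᶜ coeffs lo) t
    ... | t₁ , t₂ = +-mono-≤ (dot-mono (coeffs up) (coeffs lo) ρ t₁) (≤ᵇ⇒≤ (const up) (const lo) t₂)
    absurd : ⟦ lo ⟧ ρ < ⟦ lo ⟧ ρ
    absurd = begin-strict
      ⟦ lo ⟧ ρ ≤⟨ +-mono-≤ (combine-mono cs hs ρ ps) (*-monoʳ-≤ m (≰⇒> ¬p)) ⟩
      ⟦ combine rhs cs hs ⟧ ρ + m * ⟦ lhs g ⟧ ρ <⟨ n<1+n _ ⟩
      suc (⟦ combine rhs cs hs ⟧ ρ + m * ⟦ lhs g ⟧ ρ) ≡⟨ +-comm 1 _ ⟩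
      ⟦ up ⟧ ρ ≤⟨ dominated ⟩
      ⟦ lo ⟧ ρ ∎

bit : Bool → ℕ
bit false = 0
bit true  = 1

module _ {A : Set} where

  count : (A → Bool) → List A → ℕ
  count P xs = length (filterᵇ P xs)

  count-∷ : ∀ (P : A → Bool) x xs → count P (x ∷ xs) ≡ bit (P x) + count P xs
  count-∷ P x xs with P x
  ... | true  = refl
  ... | false = refl

  count-++ : ∀ (P : A → Bool) xs ys → count P (xs ++ ys) ≡ count P xs + count P ys
  count-++ P [] ys = refl
  count-++ P (x ∷ xs) ys with P x
  ... | true  = cong suc (count-++ P xs ys)
  ... | false = count-++ P xs ys

  count-↭ : ∀ (P : A → Bool) {xs ys} → xs ↭ ys → count P xs ≡ count P ys
  count-↭ P p = ↭-length (filter-↭ (T? ∘ P) p)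

  count-mono : ∀ {P Q : A → Bool} xs → (∀ x → P x ≡ true → Q x ≡ true) → count P xs ≤ count Q xs
  count-mono [] f = z≤n
  count-mono {P} {Q} (x ∷ xs) f with P x in px | Q x in qx
  ... | false | false = count-mono xs f
  ... | false | true  = m≤n⇒m≤1+n (count-mono xs f)
  ... | true  | true  = s≤s (count-mono xs f)
  ... | true  | false = contradiction (≡.trans (≡.sym qx) (f x px)) λ ()

  count-cong : ∀ {P Q : A → Bool} xs → (∀ x → P x ≡ Q x) → count P xs ≡ count Q xs
  count-cong xs f = ≤-antisym (count-mono xs λ x px → ≡.trans (≡.sym (f x)) px)
                              (count-mono xs λ x qx → ≡.trans (f x) qx)

  count-∨ : ∀ (P Q : A → Bool) xs → count (λ x → P x ∨ Q x) xs ≤ count P xs + count Q xs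
  count-∨ P Q [] = z≤n
  count-∨ P Q (x ∷ xs) with P x | Q x
  ... | false | false = count-∨ P Q xs
  ... | false | true  = ≤-trans (s≤s (count-∨ P Q xs)) (≤-reflexive (≡.sym (+-suc _ _)))
  ... | true  | false = s≤s (count-∨ P Q xs)
  ... | true  | true  = s≤s (≤-trans (count-∨ P Q xs) (+-monoʳ-≤ _ (n≤1+n _)))

  count-∧-split : ∀ (P Q : A → Bool) xs →
                  count P xs ≡ count (λ x → P x ∧ Q x) xs + count (λ x → P x ∧ not (Q x)) xs
  count-∧-split P Q [] = refl
  count-∧-split P Q (x ∷ xs) with P x | Q x
  ... | false | _     = count-∧-split P Q xs
  ... | true  | true  = cong suc (count-∧-split P Q xs)
  ... | true  | false = ≡.trans (cong suc (count-∧-split P Q xs)) (≡.sym (+-suc _ _))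

  count-not : ∀ (P : A → Bool) xs → count P xs + count (not ∘ P) xs ≡ length xs
  count-not P [] = refl
  count-not P (x ∷ xs) with P x
  ... | true  = cong suc (count-not P xs)
  ... | false = ≡.trans (+-suc _ _) (cong suc (count-not P xs))

  count-none : ∀ xs → count (λ _ → false) xs ≡ 0
  count-none []       = refl
  count-none (_ ∷ xs) = count-none xs

  count-any : ∀ (Ps : List (A → Bool)) xs →
              count (λ x → any (λ P → P x) Ps) xs ≤ sum (map (λ P → count P xs) Ps)
  count-any [] xs = ≤-reflexive (count-none xs)
  count-any (P ∷ Ps) xs = ≤-trans (count-∨ P _ xs) (+-monoʳ-≤ (count P xs) (count-any Ps xs))

  any-false : ∀ (Ps : List (A → Bool)) x → any (λ P → P x) Ps ≡ false → All (λ P → P x ≡ false) Ps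
  any-false [] x _ = []
  any-false (P ∷ Ps) x eq with P x in px
  ... | false = px ∷ any-false Ps x eq

  count-pick : ∀ (Q B : A → Bool) xs → count B xs < count Q xs → ∃ λ x → x ∈ xs × Q x ≡ true × B x ≡ false
  count-pick Q B (x ∷ xs) lt with Q x in qx | B x in bx
  ... | true | false = x , here refl , qx , bx
  ... | false | false with count-pick Q B xs lt
  ...   | y , y∈ , p = y , there y∈ , p
  count-pick Q B (x ∷ xs) lt | false | true with count-pick Q B xs (<-trans (n<1+n _) lt)
  ...   | y , y∈ , p = y , there y∈ , p
  count-pick Q B (x ∷ xs) lt | true | true with count-pick Q B xs (≤-pred lt)
  ...   | y , y∈ , p = y , there y∈ , p

  unique-⊆-length : ∀ {xs ys : List A} → Unique xs → (∀ {x} → x ∈ xs → x ∈ ys) → length xs ≤ length ys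
  unique-⊆-length {[]} un sub = z≤n
  unique-⊆-length {x ∷ xs} un@(_ ∷ un′) sub with ∈-∃++ (sub (here refl))
  ... | hs , ts , refl = subst (suc (length xs) ≤_) (≡.sym (↭-length (shift x hs ts)))
    (s≤s (unique-⊆-length un′ λ y∈ → drop-x y∈ (∈-resp-↭ (shift x hs ts) (sub (there y∈)))))
    where
    drop-x : ∀ {y} → y ∈ xs → y ∈ x ∷ hs ++ ts → y ∈ hs ++ ts
    drop-x y∈ (here refl) = contradiction y∈ (∉-head un)
    drop-x y∈ (there p)   = p

  ↭-split : ∀ (P : A → Bool) xs → xs ↭ filterᵇ P xs ++ filterᵇ (not ∘ P) xs
  ↭-split P [] = _↭_.refl
  ↭-split P (x ∷ xs) with P x
  ... | true  = _↭_.prep x (↭-split P xs)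
  ... | false = ↭-trans (_↭_.prep x (↭-split P xs)) (↭-sym (shift x (filterᵇ P xs) _))

module _ {A B : Set} (R : A → B → Bool) where

  -- Double counting of the related pairs, by rows and by columns.
  incidences : ∀ {p q} xs ys → (∀ {x} → x ∈ xs → p ≤ count (R x) ys) →
               (∀ {y} → y ∈ ys → count (λ x → R x y) xs ≤ q) → length xs * p ≤ length ys * q
  incidences {p} {q} xs ys lo hi = begin
    length xs * p                          ≤⟨ rows xs lo ⟩
    sum (map (λ x → count (R x) ys) xs)    ≡⟨ exchange xs ys ⟩
    sum (map (λ y → count (λ x → R x y) xs) ys) ≤⟨ columns ys hi ⟩
    length ys * q ∎
    where
    open ≤-Reasoning
    rows : ∀ zs → (∀ {x} → x ∈ zs → p ≤ count (R x) ys) → length zs * p ≤ sum (map (λ x → count (R x) ys) zs)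
    rows []       f = z≤n
    rows (z ∷ zs) f = +-mono-≤ (f (here refl)) (rows zs (f ∘ there))
    columns : ∀ zs → (∀ {y} → y ∈ zs → count (λ x → R x y) xs ≤ q) →
              sum (map (λ y → count (λ x → R x y) xs) zs) ≤ length zs * q
    columns []       f = z≤n
    columns (z ∷ zs) f = +-mono-≤ (f (here refl)) (columns zs (f ∘ there))
    zeros : ∀ (zs : List B) → sum (map (λ y → count {A} (λ x → R x y) []) zs) ≡ 0
    zeros []       = refl
    zeros (_ ∷ zs) = zeros zs
    add-row : ∀ x zs ws → sum (map (λ y → count (λ x → R x y) (x ∷ zs)) ws)
                        ≡ count (R x) ws + sum (map (λ y → count (λ x → R x y) zs) ws)
    add-row x zs [] = refl
    add-row x zs (w ∷ ws) with R x w
    ... | true  = cong suc (≡.trans (cong (count (λ x → R x w) zs +_) (add-row x zs ws))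
                                    (+-left-comm (count (λ x → R x w) zs) (count (R x) ws) _))
    ... | false = ≡.trans (cong (count (λ x → R x w) zs +_) (add-row x zs ws))
                          (+-left-comm (count (λ x → R x w) zs) (count (R x) ws) _)
    exchange : ∀ zs ws → sum (map (λ x → count (R x) ws) zs) ≡ sum (map (λ y → count (λ x → R x y) zs) ws)
    exchange [] ws = ≡.sym (zeros ws)
    exchange (z ∷ zs) ws = ≡.trans (cong (count (R z) ws +_) (exchange zs ws)) (≡.sym (add-row z zs ws))

open Linear

-- Bipartitions and ladders

module _ {n : ℕ} where

  private V = Fin n

  open DecMembership (_≟_ {n}) public using (_∈?_)

  unique-↭ : ∀ {xs ys : List V} → xs ↭ ys → Unique xs → Unique ys
  unique-↭ p = ↭ₛ.Unique-resp-↭ (≡.setoid V) (↭⇒↭ₛ p)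

  adj-sym : ∀ (G : Graph n) {u v} → Adj G u v ≡ true → Adj G v u ≡ true
  adj-sym G {u} {v} a = ≡.trans (Graph.sym G v u) a

  size-∈ : ∀ U → size (λ v → does (v ∈? U)) ≤ length U
  size-∈ U = unique-⊆-length (Unique.filter⁺ (λ v → T? (does (v ∈? U))) (Unique.allFin⁺ n))
               λ {v} v∈ → does⇒ (v ∈? U) (proj₂ (∈-filterᵇ⁻ {p = λ u → does (u ∈? U)} (allFin n) v∈))

∧-true : ∀ {a b} → a ∧ b ≡ true → a ≡ true × b ≡ true
∧-true {true} {true} _ = refl , refl

∧-intro : ∀ {a b} → a ≡ true → b ≡ true → a ∧ b ≡ true
∧-intro refl refl = refl

not-true : ∀ {a} → not a ≡ true → a ≡ false
not-true {false} _ = refl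

module Sides {n : ℕ} (G : Graph n) (side : Fin n → Bool) where

  private V = Fin n

  on : Bool → V → Bool
  on true  v = side v
  on false v = not (side v)

  on⇒side : ∀ σ {v} → on σ v ≡ true → side v ≡ σ
  on⇒side true  e = e
  on⇒side false e = not-true e

  side⇒on : ∀ σ {v} → side v ≡ σ → on σ v ≡ true
  side⇒on true  e = e
  side⇒on false e rewrite e = refl

  crossNbr miss inner : V → V → Bool
  crossNbr v u = on (not (side v)) u ∧ Adj G v u
  miss v u     = on (not (side v)) u ∧ not (Adj G v u)
  inner v u    = on (side v) u ∧ Adj G v u

  Typical : ℕ → V → Set
  Typical τ v = size (miss v) ≤ τ

  atypical : ℕ → V → Bool
  atypical τ v = not (size (miss v) ≤ᵇ τ)

  ¬atypical : ∀ {τ v} → atypical τ v ≡ false → Typical τ v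
  ¬atypical {τ} {v} e with size (miss v) ≤ᵇ τ in eq
  ... | true = ≤ᵇ⇒≤ _ _ (subst T (≡.sym eq) tt)

  -- A greedy choice has to avoid at most 30τ used vertices, τ atypical ones, and τ for each of
  -- at most three typical vertices it should be adjacent to.
  record Balanced (τ : ℕ) : Set where
    field
      cross≥    : ∀ v → 40 * τ ≤ size (crossNbr v)
      atypical≤ : size (atypical τ) ≤ τ
      20≤τ      : 20 ≤ τ

  record Fresh (τ : ℕ) (σ : Bool) (g : V) (ms U : List V) : Set where
    constructor fresh-vertex
    field
      pt       : V
      pt-side  : side pt ≡ not σ
      pt-adj   : Adj G g pt ≡ true
      pt-adjs  : All (λ m → Adj G m pt ≡ true) ms
      pt-typ   : Typical τ pt
      pt-fresh : pt ∉ U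

  module _ {τ : ℕ} (bal : Balanced τ) where
    open Balanced bal

    abstract
      -- Only g may be atypical: the vertex is picked among the neighbours of g across, whereas
      -- adjacency to each m of `ms` is obtained by avoiding the at most τ vertices that m misses.
      fresh : ∀ {σ g} ms {U} → side g ≡ σ → All (λ m → side m ≡ σ × Typical τ m) ms → length ms ≤ 3 →
              length U ≤ 30 * τ → Fresh τ σ g ms U
      fresh {σ} {g} ms {U} gσ msσ ms≤ U≤ with count-pick (crossNbr g) (λ v → any (λ P → P v) bads) (allFin n) few
        where
        bads : List (V → Bool)
        bads = (λ v → does (v ∈? U)) ∷ atypical τ ∷ map miss ms
        missing : ∀ ms → All (λ m → side m ≡ σ × Typical τ m) ms → sum (map size (map miss ms)) ≤ length ms * τ
        missing []       _              = z≤n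
        missing (m ∷ ms) ((_ , t) ∷ ts) = +-mono-≤ t (missing ms ts)
        few : size (λ v → any (λ P → P v) bads) < size (crossNbr g)
        few = lin (τ ∷ length U ∷ length ms * τ ∷ size (λ v → any (λ P → P v) bads) ∷ size (crossNbr g) ∷ size (λ v → does (v ∈? U)) ∷ size (atypical τ) ∷ sum (map size (map miss ms)) ∷ []) (# 1 ≼ 30 ⊛ # 0 ∷ # 2 ≼ 3 ⊛ # 0 ∷ 40 ⊛ # 0 ≼ # 4 ∷ # 3 ≼ # 5 ⊕ (# 6 ⊕ # 7) ∷ # 5 ≼ # 1 ∷ # 6 ≼ # 0 ∷ # 7 ≼ # 2 ∷ κ 20 ≼ # 0 ∷ []) (κ 1 ⊕ # 3 ≼ # 4) 1 (1 ∷ 1 ∷ 1 ∷ 1 ∷ 1 ∷ 1 ∷ 1 ∷ 6 ∷ [])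
              (U≤ , *-monoˡ-≤ τ ms≤ , cross≥ g , count-any bads (allFin n) , size-∈ U , atypical≤ , missing ms msσ , 20≤τ)
      ... | v , _ , q , b with ∧-true q
      ... | on¬ , adj with any-false bads′ v b
        where
        bads′ : List (V → Bool)
        bads′ = (λ v → does (v ∈? U)) ∷ atypical τ ∷ map miss ms
      ... | v∉ ∷ typ ∷ near = fresh-vertex v vσ adj (adjs ms msσ near) (¬atypical typ)
              λ v∈ → contradiction (≡.trans (≡.sym (dec-true (v ∈? U) v∈)) v∉) λ ()
        where
        vσ : side v ≡ not σ
        vσ = ≡.trans (on⇒side (not (side g)) on¬) (cong not gσ)
        adjs : ∀ ms → All (λ m → side m ≡ σ × Typical τ m) ms → All (λ P → P v ≡ false) (map miss ms) →
               All (λ m → Adj G m v ≡ true) ms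
        adjs [] _ _ = []
        adjs (m ∷ ms) ((mσ , _) ∷ ts) (e ∷ es) = adj-m ∷ adjs ms ts es
          where
          adj-m : Adj G m v ≡ true
          adj-m = Bool.¬-not λ ¬adj → contradiction (≡.trans (≡.sym (∧-intro
            (side⇒on (not (side m)) (≡.trans vσ (cong not (≡.sym mσ)))) (cong not ¬adj))) e) λ ()

-- Ladders, their layout as caterpillars, and insertion of pairs

module Rungs {n : ℕ} (G : Graph n) (side : Fin n → Bool) where

  open Sides G side

  private V = Fin n

  _~_ : V → V → Set
  u ~ v = Adj G u v ≡ true

  Rung : Set
  Rung = V × V

  ends : List Rung → List V
  ends []            = []
  ends ((a , b) ∷ R) = a ∷ b ∷ ends R

  ends-zip : ∀ (as bs : List V) → length as ≡ length bs → ends (zip as bs) ↭ as ++ bs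
  ends-zip [] [] _ = ↭-refl
  ends-zip (a ∷ as) (b ∷ bs) e =
    prep a (↭-trans (prep b (ends-zip as bs (suc-injective e))) (↭-sym (shift b as bs)))

  All-zip : ∀ {P Q : V → Set} as bs → All P as → All Q bs → All (λ p → P (proj₁ p) × Q (proj₂ p)) (zip as bs)
  All-zip [] bs _ _ = []
  All-zip (a ∷ as) [] _ _ = []
  All-zip (a ∷ as) (b ∷ bs) (p ∷ ps) (q ∷ qs) = (p , q) ∷ All-zip as bs ps qs

  IsRung : Rung → Set
  IsRung (a , b) = side a ≡ false × side b ≡ true × a ~ b

  Compatible : Rung → Rung → Set
  Compatible (a , b) (a′ , b′) = a ~ b′ × b ~ a′

  headOr : Rung → List Rung → Rung
  headOr r₀ []      = r₀
  headOr r₀ (r ∷ _) = r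

  -- The rung r₀ to which the ladder is attached at its far end is not in the list.
  Ladder : Rung → List Rung → Set
  Ladder r₀ []      = ⊤
  Ladder r₀ (r ∷ R) = IsRung r × Compatible r (headOr r₀ R) × Ladder r₀ R

  orient : Bool → Rung → V × V
  orient true  (a , b) = b , a
  orient false (a , b) = a , b

  rungBlock : Bool → Rung → Block
  rungBlock o r = block (proj₁ (orient o r)) (proj₂ (orient o r)) []

  -- Consecutive rungs are joined crosswise, so spine and leaf path both alternate between the sides
  -- and the end of a rung that lies on the spine alternates too. The parity is counted from the
  -- fixed far end.
  orientation : Bool → List Rung → Bool
  orientation o []      = o
  orientation o (_ ∷ R) = not (orientation o R)

  lay : Bool → List Rung → List Block → List Block
  lay o []      P = P
  lay o (r ∷ R) P = rungBlock (not (orientation o R)) r ∷ lay o R P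

  -- The far block only has to begin with the rung; it may carry more leaves, which is how a
  -- triangle can sit there.
  Faces : Bool → Rung → List Block → Set
  Faces o r []      = ⊥
  Faces o r (b ∷ _) = spine b ≡ proj₁ (orient o r) × firstLeaf b ≡ proj₂ (orient o r)

  lay-faces : ∀ {o r₀ P} R → Faces o r₀ P → Faces (orientation o R) (headOr r₀ R) (lay o R P)
  lay-faces []      h = h
  lay-faces (r ∷ R) h = refl , refl

  orient-compatible : ∀ o {r r′} → Compatible r r′ →
    proj₁ (orient (not o) r) ~ proj₁ (orient o r′) × proj₂ (orient (not o) r) ~ proj₂ (orient o r′)
  orient-compatible true  c       = c
  orient-compatible false (c , d) = d , c

  orient-rung : ∀ o {r} → IsRung r → proj₁ (orient o r) ~ proj₂ (orient o r)
  orient-rung true  (_ , _ , a) = adj-sym G a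
  orient-rung false (_ , _ , a) = a

  lay-linked : ∀ {o r₀ P} R → Ladder r₀ R → Faces o r₀ P → Linked G P → Linked G (lay o R P)
  lay-linked [] _ _ lk = lk
  lay-linked {o} {r₀} {P} (r ∷ R) (rg , c , L) h lk =
    (orient-rung (not (orientation o R)) rg ∷ []) , tt , links (lay o R P) (lay-faces R h) , lay-linked R L h lk
    where
    links : ∀ bs → Faces (orientation o R) (headOr r₀ R) bs → LinksTo G (rungBlock (not (orientation o R)) r) bs
    links (b ∷ bs) (e , e′) rewrite e | e′ = orient-compatible (orientation o R) c

  orient-↭ : ∀ o (r : Rung) {L} → proj₁ (orient o r) ∷ proj₂ (orient o r) ∷ L ↭ proj₁ r ∷ proj₂ r ∷ L
  orient-↭ true  r = swap _ _ ↭-refl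
  orient-↭ false r = ↭-refl

  lay-↭ : ∀ o R P → vertices (lay o R P) ↭ ends R ++ vertices P
  lay-↭ o []      P = ↭-refl
  lay-↭ o (r ∷ R) P = ↭-trans (orient-↭ (not (orientation o R)) r) (prep _ (prep _ (lay-↭ o R P)))

  lay-fat : ∀ {o} R b bs → FinalFat (b ∷ bs) → FinalFat (lay o R (b ∷ bs))
  lay-fat [] b bs h = h
  lay-fat (r ∷ []) b bs h = h
  lay-fat (r ∷ r′ ∷ R) b bs h = lay-fat (r′ ∷ R) b bs h

  lay-final : ∀ {o} R b bs c → finalLeaf c (lay o R (b ∷ bs)) ≡ finalLeaf b bs
  lay-final []      b bs c = refl
  lay-final (r ∷ R) b bs c = lay-final R b bs _

  -- Inserting a into one side of a ladder and b, two places later, into the other: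
  -- between the two places the sides are shifted against each other by one.
  data Insertion (a b : V) : List Rung → List Rung → Set where
    here  : ∀ {a₀ b₀ a₁ b₁ a₂ b₂ a₃ b₃ R} → a ~ b₀ → a ~ b₁ → a ~ b₂ → b ~ a₁ → b ~ a₂ → b ~ a₃ →
            Insertion a b ((a₀ , b₀) ∷ (a₁ , b₁) ∷ (a₂ , b₂) ∷ (a₃ , b₃) ∷ R)
                          ((a₀ , b₀) ∷ (a , b₁) ∷ (a₁ , b₂) ∷ (a₂ , b) ∷ (a₃ , b₃) ∷ R)
    there : ∀ {r R R′} → Insertion a b R R′ → Insertion a b (r ∷ R) (r ∷ R′)

  insertion-head : ∀ {a b R R′} r₀ → Insertion a b R R′ → headOr r₀ R′ ≡ headOr r₀ R
  insertion-head r₀ (here _ _ _ _ _ _) = refl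
  insertion-head r₀ (there _)          = refl

  insertion-length : ∀ {a b R R′} → Insertion a b R R′ → length R′ ≡ suc (length R)
  insertion-length (here _ _ _ _ _ _) = refl
  insertion-length (there i)          = cong suc (insertion-length i)

  -- Between the two places rungs and links exchange roles: the old link from a₁ to b₂ becomes a
  -- rung, and the old rungs a₁b₁ and a₂b₂ become links. Only the six adjacencies of a and b are
  -- new.
  insertion-ladder : ∀ {r₀ a b R R′} → side a ≡ false → side b ≡ true → Insertion a b R R′ →
                     Ladder r₀ R → Ladder r₀ R′
  insertion-ladder {r₀} sa sb (here ab₀ ab₁ ab₂ ba₁ ba₂ ba₃)
    (g₀ , (c₀ , d₀) , g₁@(sa₁ , sb₁ , e₁) , (c₁ , d₁) , (sa₂ , sb₂ , e₂) , (c₂ , d₂) , L) =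
    g₀ , (c₀ , adj-sym G ab₀) , (sa , sb₁ , ab₁) , (ab₂ , adj-sym G e₁) , (sa₁ , sb₂ , c₁) ,
    (adj-sym G ba₁ , adj-sym G e₂) , (sa₂ , sb , adj-sym G ba₂) , (c₂ , ba₃) , L
  insertion-ladder {r₀} sa sb (there {r} i) (g , c , L) =
    g , subst (Compatible r) (≡.sym (insertion-head r₀ i)) c , insertion-ladder sa sb i L

  insertion-↭ : ∀ {a b R R′} → Insertion a b R R′ → ends R′ ↭ a ∷ b ∷ ends R
  insertion-↭ {a} {b} (here {a₀} {b₀} {a₁} {b₁} {a₂} {b₂} _ _ _ _ _ _) =
    ↭-trans (shift a (a₀ ∷ b₀ ∷ []) _) (prep a
      (↭-trans (prep a₀ (prep b₀ (prep b₁ (prep a₁ (↭-trans (prep b₂ (swap a₂ b ↭-refl)) (swap b₂ b ↭-refl))))))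
      (↭-trans (shift b (a₀ ∷ b₀ ∷ b₁ ∷ a₁ ∷ []) _)
      (prep b (prep a₀ (prep b₀ (↭-trans (swap b₁ a₁ ↭-refl) (prep a₁ (prep b₁ (swap b₂ a₂ ↭-refl))))))))))
  insertion-↭ {a} {b} (there {r = x , y} i) =
    ↭-trans (prep x (prep y (insertion-↭ i)))
      (↭-trans (shift a (x ∷ y ∷ []) _) (prep a (shift b (x ∷ y ∷ []) _)))

  bad₁ bad₂ : V → Rung → Bool
  bad₁ a r = not (Adj G a (proj₂ r))
  bad₂ b r = not (Adj G b (proj₁ r))

  tail₁ : List Rung → List Rung
  tail₁ []      = []
  tail₁ (_ ∷ R) = R

  -- A window of four rungs is spoilt if a misses the second end of its first, second or third rung,
  -- or b the first end of its second, third or fourth. The six shifted counts bound the number of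
  -- spoilt windows.
  badWindows : V → V → List Rung → ℕ
  badWindows a b R = (count (bad₁ a) R + count (bad₁ a) (tail₁ R) + count (bad₁ a) (tail₁ (tail₁ R))) +
    (count (bad₂ b) (tail₁ R) + count (bad₂ b) (tail₁ (tail₁ R)) + count (bad₂ b) (tail₁ (tail₁ (tail₁ R))))

  find-insertion : ∀ a b R → ∃ (Insertion a b R) ⊎ length R ≤ 3 + badWindows a b R
  find-insertion a b [] = inj₂ z≤n
  find-insertion a b (_ ∷ []) = inj₂ (s≤s z≤n)
  find-insertion a b (_ ∷ _ ∷ []) = inj₂ (s≤s (s≤s z≤n))
  find-insertion a b (_ ∷ _ ∷ _ ∷ []) = inj₂ (s≤s (s≤s (s≤s z≤n)))
  find-insertion a b (r₀ ∷ R@(r₁ ∷ r₂ ∷ r₃ ∷ S)) with find-insertion a b R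
  ... | inj₁ (_ , i) = inj₁ (_ , there i)
  ... | inj₂ le with 1 ≤? bit (bad₁ a r₀) + (bit (bad₁ a r₁) + (bit (bad₁ a r₂) +
                          (bit (bad₂ b r₁) + (bit (bad₂ b r₂) + bit (bad₂ b r₃)))))
  ...   | yes 1≤ = inj₂ (lin (bit (bad₁ a r₀) ∷ bit (bad₁ a r₁) ∷ bit (bad₁ a r₂) ∷ bit (bad₂ b r₁) ∷ bit (bad₂ b r₂) ∷ bit (bad₂ b r₃) ∷ length S ∷ count (bad₁ a) (r₀ ∷ R) ∷ count (bad₁ a) R ∷ count (bad₁ a) (r₂ ∷ r₃ ∷ S) ∷ count (bad₁ a) (r₃ ∷ S) ∷ count (bad₂ b) R ∷ count (bad₂ b) (r₂ ∷ r₃ ∷ S) ∷ count (bad₂ b) (r₃ ∷ S) ∷ count (bad₂ b) S ∷ []) (κ 1 ≼ # 0 ⊕ (# 1 ⊕ (# 2 ⊕ (# 3 ⊕ (# 4 ⊕ # 5)))) ∷ κ 3 ⊕ # 6 ≼ κ 3 ⊕ (# 8 ⊕ # 9 ⊕ # 10 ⊕ (# 12 ⊕ # 13 ⊕ # 14)) ∷ # 0 ⊕ # 8 ≼ # 7 ∷ # 1 ⊕ # 9 ≼ # 8 ∷ # 2 ⊕ # 10 ≼ # 9 ∷ # 3 ⊕ # 12 ≼ # 11 ∷ # 4 ⊕ # 13 ≼ # 12 ∷ # 5 ⊕ # 14 ≼ # 13 ∷ []) (κ 4 ⊕ # 6 ≼ κ 3 ⊕ (# 7 ⊕ # 8 ⊕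 # 9 ⊕ (# 11 ⊕ # 12 ⊕ # 13))) 1 (1 ∷ 1 ∷ 1 ∷ 1 ∷ 1 ∷ 1 ∷ 1 ∷ 1 ∷ [])
          (1≤ , le , more (bad₁ a) r₀ R , more (bad₁ a) r₁ _ , more (bad₁ a) r₂ _ ,
           more (bad₂ b) r₁ _ , more (bad₂ b) r₂ _ , more (bad₂ b) r₃ S))
    where
    more : ∀ (P : Rung → Bool) x xs → bit (P x) + count P xs ≤ count P (x ∷ xs)
    more P x xs = ≤-reflexive (≡.sym (count-∷ P x xs))
  ...   | no ¬1≤ = inj₁ (_ , here (ok z₀) (ok z₁) (ok z₂) (ok z₃) (ok z₄) (ok z₅))
    where
    ok : ∀ {x} → bit (not x) ≡ 0 → x ≡ true
    ok {true} _ = refl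
    split : ∀ x {y} → ¬ 1 ≤ x + y → x ≡ 0 × ¬ 1 ≤ y
    split zero    h = refl , h
    split (suc x) h = contradiction (s≤s z≤n) h
    z₀ = proj₁ (split (bit (bad₁ a r₀)) ¬1≤)
    n₁ = proj₂ (split (bit (bad₁ a r₀)) ¬1≤)
    z₁ = proj₁ (split (bit (bad₁ a r₁)) n₁)
    n₂ = proj₂ (split (bit (bad₁ a r₁)) n₁)
    z₂ = proj₁ (split (bit (bad₁ a r₂)) n₂)
    n₃ = proj₂ (split (bit (bad₁ a r₂)) n₂)
    z₃ = proj₁ (split (bit (bad₂ b r₁)) n₃)
    n₄ = proj₂ (split (bit (bad₂ b r₁)) n₃)
    z₄ = proj₁ (split (bit (bad₂ b r₂)) n₄)
    n₅ = proj₂ (split (bit (bad₂ b r₂)) n₄)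
    z₅ = n<1⇒n≡0 (≰⇒> n₅)

  ladder-rungs : ∀ {r₀} R → Ladder r₀ R → All IsRung R
  ladder-rungs []      _           = []
  ladder-rungs (r ∷ R) (g , _ , L) = g ∷ ladder-rungs R L

  module _ (π : Rung → V) (π∈ : ∀ a b → π (a , b) ∈ a ∷ b ∷ []) (P : Rung → Bool) where

    selected-ends : ∀ R {x} → x ∈ map π (filterᵇ P R) → x ∈ ends R
    selected-ends ((a , b) ∷ R) x∈ with P (a , b)
    selected-ends ((a , b) ∷ R) x∈ | false = there (there (selected-ends R x∈))
    selected-ends ((a , b) ∷ R) (here refl) | true = ∈-++⁺ˡ (π∈ a b)
    selected-ends ((a , b) ∷ R) (there x∈) | true = there (there (selected-ends R x∈))

    selected-unique : ∀ R → Unique (ends R) → Unique (map π (filterᵇ P R))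
    selected-unique [] _ = []
    selected-unique ((a , b) ∷ R) un with unique-++⁻ (a ∷ b ∷ []) un
    ... | _ , un′ , disj with P (a , b)
    ... | false = selected-unique R un′
    ... | true  = unique-∷ (disj (π∈ a b) ∘ selected-ends R) (selected-unique R un′)

    count-selected : ∀ (Q : V → Bool) R → Unique (ends R) → (∀ {r} → r ∈ R → P r ≡ true → Q (π r) ≡ true) →
                     count P R ≤ size Q
    count-selected Q R un f = subst (_≤ size Q) (length-map π (filterᵇ P R))
      (unique-⊆-length (selected-unique R un) λ x∈ → sub (∈-map⁻ π x∈))
      where
      sub : ∀ {x} → ∃ (λ r → r ∈ filterᵇ P R × x ≡ π r) → x ∈ filterᵇ Q (allFin n)
      sub (r , r∈ , refl) with ∈-filterᵇ⁻ R r∈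
      ... | r∈R , pr = ∈-filterᵇ⁺ (∈-allFin _) (f r∈R pr)

  -- The ends of different rungs are different vertices, so each vertex missed by a spoils only the
  -- one rung that contains it.
  count-bad₁ : ∀ {r₀ a} R → side a ≡ false → Ladder r₀ R → Unique (ends R) → count (bad₁ a) R ≤ size (miss a)
  count-bad₁ {a = a} R sa L un = count-selected proj₂ (λ _ _ → there (here refl)) (bad₁ a) (miss a) R un
    λ r∈ p → ∧-intro (subst (λ s → on (not s) _ ≡ true) (≡.sym sa) (proj₁ (proj₂ (All.lookup (ladder-rungs R L) r∈)))) p

  count-bad₂ : ∀ {r₀ b} R → side b ≡ true → Ladder r₀ R → Unique (ends R) → count (bad₂ b) R ≤ size (miss b)
  count-bad₂ {b = b} R sb L un = count-selected proj₁ (λ _ _ → here refl) (bad₂ b) (miss b) R un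
    λ r∈ p → ∧-intro (subst (λ s → on (not s) _ ≡ true) (≡.sym sb) (side⇒on false (proj₁ (All.lookup (ladder-rungs R L) r∈)))) p

  count-tail : ∀ (P : Rung → Bool) R → count P (tail₁ R) ≤ count P R
  count-tail P [] = z≤n
  count-tail P (r ∷ R) = ≤-trans (m≤n+m _ (bit (P r))) (≤-reflexive (≡.sym (count-∷ P r R)))

  -- A ladder has three windows fewer than rungs, and two typical vertices spoil at most 6τ of them;
  -- with 4 + 6τ rungs some window is left.
  insert : ∀ {τ r₀ a b} R → side a ≡ false → side b ≡ true → Typical τ a → Typical τ b →
           4 + 6 * τ ≤ length R → Ladder r₀ R → Unique (ends R) → ∃ (Insertion a b R)
  insert {τ} {r₀} {a} {b} R sa sb ta tb long L un with find-insertion a b R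
  ... | inj₁ i = i
  ... | inj₂ le = contradiction
    (lin (τ ∷ length R ∷ size (miss a) ∷ size (miss b) ∷ count (bad₁ a) R ∷ count (bad₁ a) (tail₁ R) ∷ count (bad₁ a) (tail₁ (tail₁ R)) ∷ count (bad₂ b) R ∷ count (bad₂ b) (tail₁ R) ∷ count (bad₂ b) (tail₁ (tail₁ R)) ∷ count (bad₂ b) (tail₁ (tail₁ (tail₁ R))) ∷ []) (# 2 ≼ # 0 ∷ # 3 ≼ # 0 ∷ κ 4 ⊕ 6 ⊛ # 0 ≼ # 1 ∷ # 4 ≼ # 2 ∷ # 5 ≼ # 4 ∷ # 6 ≼ # 5 ∷ # 7 ≼ # 3 ∷ # 8 ≼ # 7 ∷ # 9 ≼ # 8 ∷ # 10 ≼ # 9 ∷ # 1 ≼ κ 3 ⊕ (# 4 ⊕ # 5 ⊕ # 6 ⊕ (# 8 ⊕ # 9 ⊕ # 10)) ∷ []) (κ 1 ≼ κ 0) 0 (3 ∷ 3 ∷ 1 ∷ 3 ∷ 2 ∷ 1 ∷ 3 ∷ 3 ∷ 2 ∷ 1 ∷ 1 ∷ [])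
      (ta , tb , long , count-bad₁ R sa L un , count-tail (bad₁ a) R , count-tail (bad₁ a) (tail₁ R) ,
       count-bad₂ R sb L un , count-tail (bad₂ b) R , count-tail (bad₂ b) (tail₁ R) , count-tail (bad₂ b) (tail₁ (tail₁ R)) , le))
    λ ()

  -- Insertions lengthen the ladder, so the length condition persists. They also preserve its first
  -- rung, to which the closing block is attached later.
  insert-all : ∀ {τ r₀} ps R → All (λ p → side (proj₁ p) ≡ false × side (proj₂ p) ≡ true × Typical τ (proj₁ p) × Typical τ (proj₂ p)) ps →
               4 + 6 * τ ≤ length R → Ladder r₀ R → Unique (ends ps ++ ends R) →
               ∃ λ R′ → Ladder r₀ R′ × headOr r₀ R′ ≡ headOr r₀ R × ends R′ ↭ ends ps ++ ends R
  insert-all [] R _ _ L _ = R , L , refl , ↭-refl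
  insert-all {τ} {r₀} ((a , b) ∷ ps) R ((sa , sb , ta , tb) ∷ ok) long L un
    with insert R sa sb ta tb long L (proj₁ (proj₂ (unique-++⁻ (ends ((a , b) ∷ ps)) un)))
  ... | R₁ , i with insert-all ps R₁ ok (subst (4 + 6 * τ ≤_) (≡.sym (insertion-length i)) (m≤n⇒m≤1+n long)) (insertion-ladder sa sb i L) (unique-↭ moved un)
    where
    moved : a ∷ b ∷ ends ps ++ ends R ↭ ends ps ++ ends R₁
    moved = ↭-sym (↭-trans (↭-++⁺ˡ (ends ps) (insertion-↭ i))
              (↭-trans (shift a (ends ps) _) (prep a (shift b (ends ps) _))))
  ... | R₂ , L₂ , h , p = R₂ , L₂ , ≡.trans h (insertion-head r₀ i) ,
    ↭-trans p (↭-trans (↭-++⁺ˡ (ends ps) (insertion-↭ i)) (↭-trans (shift a (ends ps) _) (prep a (shift b (ends ps) _))))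

-- Greedy construction of a short ladder

module Build {n : ℕ} (G : Graph n) (side : Fin n → Bool) {τ : ℕ} (bal : Sides.Balanced G side τ) where

  open Sides G side
  open Rungs G side
  open Balanced bal

  private V = Fin n

  TypicalRung : Rung → Set
  TypicalRung (a , b) = side a ≡ false × side b ≡ true × Typical τ a × Typical τ b

  orient-typical : ∀ σ r → TypicalRung r →
    (side (proj₁ (orient σ r)) ≡ σ × Typical τ (proj₁ (orient σ r))) × (side (proj₂ (orient σ r)) ≡ not σ × Typical τ (proj₂ (orient σ r)))
  orient-typical true  _ (sa , sb , ta , tb) = (sb , tb) , (sa , ta)
  orient-typical false _ (sa , sb , ta , tb) = (sa , ta) , (sb , tb)

  orient-isRung : ∀ σ {u v} → side u ≡ σ → side v ≡ not σ → u ~ v → IsRung (orient σ (u , v))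
  orient-isRung true  su sv a = sv , su , adj-sym G a
  orient-isRung false su sv a = su , sv , a

  typical-orient : ∀ σ {u v} → side u ≡ σ × Typical τ u → side v ≡ not σ × Typical τ v → TypicalRung (orient σ (u , v))
  typical-orient true  (su , tu) (sv , tv) = sv , su , tv , tu
  typical-orient false (su , tu) (sv , tv) = su , sv , tu , tv

  orient-orient-compatible : ∀ σ {u v r} → u ~ proj₂ (orient σ r) → v ~ proj₁ (orient σ r) → Compatible (orient σ (u , v)) r
  orient-orient-compatible true  a b = b , a
  orient-orient-compatible false a b = a , b

  orient-compatible′ : ∀ σ {u v u′ v′} → u ~ v′ → v ~ u′ → Compatible (orient σ (u , v)) (orient σ (u′ , v′))
  orient-compatible′ true  a b = b , a
  orient-compatible′ false a b = a , b

  length-ends : ∀ R → length (ends R) ≡ 2 * length R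
  length-ends []      = refl
  length-ends (_ ∷ R) rewrite length-ends R | +-suc (length R) (length R + 0) = refl

  module _ (r₀ : Rung) (W : List V) where

    used : List Rung → List V
    used R = ends R ++ W

    length-used : ∀ R → length (used R) ≡ 2 * length R + length W
    length-used R = ≡.trans (length-++ (ends R)) (cong (_+ length W) (length-ends R))

    -- The ladder grows at its head, whose ends must be typical to share new neighbours with given
    -- vertices. `lo` serves the later insertions; `hi` keeps the used vertices few enough for
    -- `fresh`.
    record State (lo hi : ℕ) : Set where
      constructor state
      field
        rungs     : List Rung
        ladder    : Ladder r₀ rungs
        head-typ  : TypicalRung (headOr r₀ rungs)
        unique    : Unique (used rungs)
        lo≤       : lo ≤ length rungs
        ≤hi       : length rungs ≤ hi
    open State

    Extends : ∀ {lo hi lo′ hi′} → State lo hi → State lo′ hi′ → Set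
    Extends S S′ = ∀ {v} → v ∈ used (rungs S) → v ∈ used (rungs S′)

    -- x may be atypical, so its three neighbours v₁, v₂, v₃ in the ladder are chosen from its own
    -- neighbours across. x forms a rung with v₂ between the rungs u₁v₁ and u₃v₃; the first joins it
    -- to the old head, the second is again a typical head. u₁ and u₃ are chosen last, as each of
    -- them has to fit vertices chosen before.
    absorb : ∀ {lo hi} x (S : State lo hi) → 2 * (3 + hi) + length W ≤ 30 * τ →
             ∃ λ (S′ : State lo (3 + hi)) → x ∈ used (rungs S′) × Extends S S′
    absorb {lo} {hi} x S@(state R L ht un lo≤ ≤hi) fits with x ∈? used R
    ... | yes x∈ = state R L ht un lo≤ (≤-trans ≤hi (m≤n+m hi 3)) , x∈ , id
    ... | no  x∉ = state R′ L′ (typical-orient s (u₃s , u₃.pt-typ) (v₃.pt-side , v₃.pt-typ)) (unique-↭ (↭-sym used′) new)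
                     (≤-trans lo≤ (m≤n+m _ 3)) (s≤s (s≤s (s≤s ≤hi))) ,
                   ∈-resp-↭ (↭-sym used′) (there (there (there (there (there (here refl)))))) ,
                   λ v∈ → ∈-resp-↭ (↭-sym used′) (there (there (there (there (there (there v∈))))))
      where
      s = side x
      h = headOr r₀ R
      p = proj₁ (orient s h)
      q = proj₂ (orient s h)
      pq = orient-typical s h ht
      room : ∀ j → j ≤ 5 → j + length (used R) ≤ 30 * τ
      room j j≤ = lin (j ∷ length (used R) ∷ length R ∷ length W ∷ hi ∷ τ ∷ []) (# 0 ≼ κ 5 ∷ # 1 ≼ 2 ⊛ # 2 ⊕ # 3 ∷ # 2 ≼ # 4 ∷ 2 ⊛ (κ 3 ⊕ # 4) ⊕ # 3 ≼ 30 ⊛ # 5 ∷ []) (# 0 ⊕ # 1 ≼ 30 ⊛ # 5) 1 (1 ∷ 1 ∷ 2 ∷ 1 ∷ [])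
                     (j≤ , ≤-reflexive (length-used R) , ≤hi , fits)
      f₁ = fresh bal {g = x} (p ∷ []) {x ∷ used R} refl (proj₁ pq ∷ []) (s≤s z≤n) (room 1 (s≤s z≤n))
      module v₁ = Fresh f₁
      f₂ = fresh bal {g = x} [] {v₁.pt ∷ x ∷ used R} refl [] z≤n (room 2 (s≤s (s≤s z≤n)))
      module v₂ = Fresh f₂
      f₃ = fresh bal {g = x} [] {v₂.pt ∷ v₁.pt ∷ x ∷ used R} refl [] z≤n (room 3 (s≤s (s≤s (s≤s z≤n))))
      module v₃ = Fresh f₃
      f₄ = fresh bal {g = q} (v₁.pt ∷ v₂.pt ∷ []) {v₃.pt ∷ v₂.pt ∷ v₁.pt ∷ x ∷ used R} (proj₁ (proj₂ pq))
             ((v₁.pt-side , v₁.pt-typ) ∷ (v₂.pt-side , v₂.pt-typ) ∷ []) (s≤s (s≤s z≤n)) (room 4 (s≤s (s≤s (s≤s (s≤s z≤n)))))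
      module u₁ = Fresh f₄
      f₅ = fresh bal {g = v₂.pt} (v₃.pt ∷ []) {u₁.pt ∷ v₃.pt ∷ v₂.pt ∷ v₁.pt ∷ x ∷ used R} v₂.pt-side
             ((v₃.pt-side , v₃.pt-typ) ∷ []) (s≤s z≤n) (room 5 ≤-refl)
      module u₃ = Fresh f₅
      u₁s : side u₁.pt ≡ s
      u₁s = ≡.trans u₁.pt-side (Bool.not-involutive s)
      u₃s : side u₃.pt ≡ s
      u₃s = ≡.trans u₃.pt-side (Bool.not-involutive s)
      R′ : List Rung
      R′ = orient s (u₃.pt , v₃.pt) ∷ orient s (x , v₂.pt) ∷ orient s (u₁.pt , v₁.pt) ∷ R
      new : Unique (u₃.pt ∷ u₁.pt ∷ v₃.pt ∷ v₂.pt ∷ v₁.pt ∷ x ∷ used R)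
      new = unique-∷ u₃.pt-fresh (unique-∷ u₁.pt-fresh (unique-∷ v₃.pt-fresh (unique-∷ v₂.pt-fresh
              (unique-∷ v₁.pt-fresh (unique-∷ x∉ un)))))
      used′ : used R′ ↭ u₃.pt ∷ u₁.pt ∷ v₃.pt ∷ v₂.pt ∷ v₁.pt ∷ x ∷ used R
      used′ = ↭-trans (orient-↭ s (u₃.pt , v₃.pt)) (prep u₃.pt (↭-trans
        (prep v₃.pt (↭-trans (orient-↭ s (x , v₂.pt)) (prep x (prep v₂.pt (orient-↭ s (u₁.pt , v₁.pt))))))
        (↭-trans (prep v₃.pt (↭-sym (shift x (v₂.pt ∷ u₁.pt ∷ v₁.pt ∷ []) (used R))))
        (↭-trans (prep v₃.pt (swap v₂.pt u₁.pt ↭-refl)) (swap v₃.pt u₁.pt ↭-refl)))))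
      adj₁ : All (λ m → m ~ u₁.pt) (v₁.pt ∷ v₂.pt ∷ [])
      adj₁ = u₁.pt-adjs
      L′ : Ladder r₀ R′
      L′ = orient-isRung s u₃s v₃.pt-side (adj-sym G (All.head u₃.pt-adjs)) ,
           orient-compatible′ s (adj-sym G u₃.pt-adj) (adj-sym G v₃.pt-adj) ,
           orient-isRung s refl v₂.pt-side v₂.pt-adj ,
           orient-compatible′ s v₁.pt-adj (All.head (All.tail adj₁)) ,
           orient-isRung s u₁s v₁.pt-side (adj-sym G (All.head adj₁)) ,
           orient-orient-compatible s (adj-sym G u₁.pt-adj) (adj-sym G (All.head v₁.pt-adjs)) ,
           L

    abstract
      absorb-all : ∀ {lo hi} xs (S : State lo hi) → 2 * (3 * length xs + hi) + length W ≤ 30 * τ →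
                   ∃ λ (S′ : State lo (3 * length xs + hi)) → (∀ {x} → x ∈ xs → x ∈ used (rungs S′)) × Extends S S′
      absorb-all [] S fits = S , (λ ()) , id
      absorb-all {lo} {hi} (x ∷ xs) S fits with absorb x S
        (lin (length xs ∷ hi ∷ length W ∷ τ ∷ []) (2 ⊛ (3 ⊛ (κ 1 ⊕ # 0) ⊕ # 1) ⊕ # 2 ≼ 30 ⊛ # 3 ∷ []) (2 ⊛ (κ 3 ⊕ # 1) ⊕ # 2 ≼ 30 ⊛ # 3) 1 (1 ∷ []) fits)
      ... | S₁ , x∈ , e₁ with absorb-all xs S₁
        (lin (length xs ∷ hi ∷ length W ∷ τ ∷ []) (2 ⊛ (3 ⊛ (κ 1 ⊕ # 0) ⊕ # 1) ⊕ # 2 ≼ 30 ⊛ # 3 ∷ []) (2 ⊛ (3 ⊛ # 0 ⊕ (κ 3 ⊕ # 1)) ⊕ # 2 ≼ 30 ⊛ # 3) 1 (1 ∷ []) fits)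
      ... | S₂ , xs⊆ , e₂ = subst (State lo) hi≡ S₂ , (λ { (here refl) → there′ (e₂ x∈) ; (there y∈) → there′ (xs⊆ y∈) }) , λ v∈ → there′ (e₂ (e₁ v∈))
        where
        hi≡ : 3 * length xs + (3 + hi) ≡ 3 * length (x ∷ xs) + hi
        hi≡ = ≡.trans (≡.sym (+-assoc (3 * length xs) 3 hi)) (cong (_+ hi) (≡.trans (+-comm _ 3) (≡.sym (*-suc 3 (length xs)))))
        there′ : ∀ {v m} {e : 3 * length xs + (3 + hi) ≡ m} → v ∈ used (rungs S₂) → v ∈ used (rungs (subst (State lo) e S₂))
        there′ {e = refl} v∈ = v∈

    pad : ∀ {lo hi} (S : State lo hi) → 2 * (1 + hi) + length W ≤ 30 * τ →
          ∃ λ (S′ : State (suc lo) (suc hi)) → Extends S S′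
    pad {lo} {hi} (state R L ht@(sa , sb , ta , tb) un lo≤ ≤hi) fits =
      state ((a.pt , b.pt) ∷ R) ((aF , b.pt-side , adj-sym G (All.head a.pt-adjs)) , (adj-sym G a.pt-adj , adj-sym G b.pt-adj) , L)
        (aF , b.pt-side , a.pt-typ , b.pt-typ) (unique-∷ a.pt-fresh (unique-∷ b.pt-fresh un)) (s≤s lo≤) (s≤s ≤hi) ,
      λ v∈ → there (there v∈)
      where
      h = headOr r₀ R
      room : ∀ j → j ≤ 1 → j + length (used R) ≤ 30 * τ
      room j j≤ = lin (j ∷ length (used R) ∷ length R ∷ length W ∷ hi ∷ τ ∷ []) (# 0 ≼ κ 1 ∷ # 1 ≼ 2 ⊛ # 2 ⊕ # 3 ∷ # 2 ≼ # 4 ∷ 2 ⊛ (κ 1 ⊕ # 4) ⊕ # 3 ≼ 30 ⊛ # 5 ∷ []) (# 0 ⊕ # 1 ≼ 30 ⊛ # 5) 1 (1 ∷ 1 ∷ 2 ∷ 1 ∷ [])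
                     (j≤ , ≤-reflexive (length-used R) , ≤hi , fits)
      f₁ = fresh bal {g = proj₁ h} [] {used R} sa [] z≤n (room 0 z≤n)
      module b = Fresh f₁
      f₂ = fresh bal {g = proj₂ h} (b.pt ∷ []) {b.pt ∷ used R} sb ((b.pt-side , b.pt-typ) ∷ []) (s≤s z≤n) (room 1 ≤-refl)
      module a = Fresh f₂
      aF : side a.pt ≡ false
      aF = a.pt-side

    abstract
      pad-by : ∀ {lo hi} m (S : State lo hi) → 2 * (m + hi) + length W ≤ 30 * τ →
               ∃ λ (S′ : State (m + lo) (m + hi)) → Extends S S′
      pad-by zero S fits = S , id
      pad-by {lo} {hi} (suc m) S fits with pad-by m S
        (lin (m ∷ hi ∷ length W ∷ τ ∷ []) (2 ⊛ (κ 1 ⊕ # 0 ⊕ # 1) ⊕ # 2 ≼ 30 ⊛ # 3 ∷ []) (2 ⊛ (# 0 ⊕ # 1) ⊕ # 2 ≼ 30 ⊛ # 3) 1 (1 ∷ []) fits)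
      ... | S₁ , e₁ with pad S₁ fits
      ... | S₂ , e₂ = S₂ , e₂ ∘ e₁

-- Closing the ladder and absorbing the remaining vertices

module Core {n : ℕ} (G : Graph n) (side : Fin n → Bool) {τ : ℕ} (bal : Sides.Balanced G side τ) where

  open Sides G side
  open Rungs G side
  open Balanced bal
  open Build G side bal
  open State

  private V = Fin n

  filterᵇ-unique : ∀ (P : V → Bool) {xs} → Unique xs → Unique (filterᵇ P xs)
  filterᵇ-unique P = Unique.filter⁺ (λ v → T? (P v))

  count-ends : ∀ σ {r₀} R → Ladder r₀ R → count (on σ) (ends R) ≡ length R
  count-ends σ [] _ = refl
  count-ends true ((a , b) ∷ R) ((sa , sb , _) , _ , L) rewrite sa | sb = cong suc (count-ends true R L)
  count-ends false ((a , b) ∷ R) ((sa , sb , _) , _ , L) rewrite sa | sb = cong suc (count-ends false R L)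

  roots-lay : ∀ o R b bs → length (roots (caterpillar (lay o R (b ∷ bs)))) ≡ 1
  roots-lay o []      b bs = refl
  roots-lay o (_ ∷ _) b bs = refl

  -- y is adjacent to both ends of the rung ez, so the triangle closes the ladder whichever of e and
  -- z lies on the spine. The parity of the length of the ladder, which is not under control, thus
  -- does not matter.
  lay-ladder-closes : ∀ o r₀ b₀ bs R e y z → Ladder r₀ R → Faces o r₀ (b₀ ∷ bs) → Linked G (b₀ ∷ bs) → FinalFat (b₀ ∷ bs) →
    IsRung (e , z) → Compatible (e , z) (headOr r₀ R) → y ~ z → y ~ e → finalLeaf b₀ bs ~ y →
    Unique (e ∷ y ∷ z ∷ ends R ++ vertices (b₀ ∷ bs)) → (∀ v → v ∈ e ∷ y ∷ z ∷ ends R ++ vertices (b₀ ∷ bs)) → HasSpanningHalin G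
  lay-ladder-closes o r₀ b₀ bs R e y z L h lk fat ez c yz ye fy un cov =
    caterpillar-halin G endBlock (lay o R (b₀ ∷ bs))
      ((proj₁ adj ∷ orient-rung ω ez ∷ []) , (proj₂ adj , tt) , links (lay o R (b₀ ∷ bs)) (lay-faces R h) , lay-linked R L h lk)
      (subst (_~ y) (≡.sym (lay-final R b₀ bs endBlock)) fy)
      (≤-reflexive (cong (2 +_) (≡.sym (roots-lay o R b₀ bs))))
      (lay-fat R b₀ bs fat) (unique-↭ (↭-sym verts) un) (λ v → ∈-resp-↭ (↭-sym verts) (cov v))
    where
    ω : Bool
    ω = not (orientation o R)
    endBlock : Block
    endBlock = block (proj₁ (orient ω (e , z))) y (proj₂ (orient ω (e , z)) ∷ [])
    adj : proj₁ (orient ω (e , z)) ~ y × y ~ proj₂ (orient ω (e , z))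
    adj with ω
    ... | true  = adj-sym G yz , ye
    ... | false = adj-sym G ye , yz
    links : ∀ cs → Faces (orientation o R) (headOr r₀ R) cs → LinksTo G endBlock cs
    links (c₁ ∷ cs) (eq , eq′) rewrite eq | eq′ = orient-compatible (orientation o R) c
    verts : vertices (endBlock ∷ lay o R (b₀ ∷ bs)) ↭ e ∷ y ∷ z ∷ ends R ++ vertices (b₀ ∷ bs)
    verts = ↭-trans (swap _ y ↭-refl) (↭-trans (prep y (orient-↭ ω (e , z)))
              (↭-trans (swap y e ↭-refl) (prep e (prep y (prep z (lay-↭ o R (b₀ ∷ bs)))))))

  complement : (U : List V) → Unique U → ∃ λ rest → allFin n ↭ U ++ rest × (∀ {v} → v ∈ rest → v ∉ U)
  complement U un = filterᵇ isRest (allFin n) , same-members⇒↭ (Unique.allFin⁺ n)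
      (Unique.++⁺ un (filterᵇ-unique isRest (Unique.allFin⁺ n)) λ (v∈u , v∈r) → rest∉ v∈r v∈u)
      (λ {v} _ → where-is v) (λ _ → ∈-allFin _) , rest∉
    where
    isRest : V → Bool
    isRest v = not (does (v ∈? U))
    rest∉ : ∀ {v} → v ∈ filterᵇ isRest (allFin n) → v ∉ U
    rest∉ {v} v∈ v∈u = contradiction (≡.trans (≡.sym (cong not (dec-true (v ∈? U) v∈u))) (proj₂ (∈-filterᵇ⁻ {p = isRest} (allFin n) v∈))) λ ()
    where-is : ∀ v → v ∈ U ++ filterᵇ isRest (allFin n)
    where-is v with v ∈? U
    ... | yes v∈ = ∈-++⁺ˡ v∈
    ... | no  v∉ = ∈-++⁺ʳ U (∈-filterᵇ⁺ (∈-allFin v) (cong not (dec-false (v ∈? U) v∉)))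

  PairOK : Rung → Set
  PairOK p = side (proj₁ p) ≡ false × side (proj₂ p) ≡ true × Typical τ (proj₁ p) × Typical τ (proj₂ p)

  pair-up : ∀ rest → All (Typical τ) rest → count (on false) rest ≡ count (on true) rest →
            ∃ λ ps → ends ps ↭ rest × All PairOK ps
  pair-up rest typ eq = zip As Bs ,
    ↭-trans (ends-zip As Bs eq) (↭-trans (↭-++-comm As Bs) (↭-sym (↭-split (on true) rest))) ,
    All.map (λ ((sa , ta) , (sb , tb)) → sa , sb , ta , tb) (All-zip As Bs
      (All.tabulate λ v∈ → let v∈′ = ∈-filterᵇ⁻ {p = not ∘ on true} rest v∈ in on⇒side false (proj₂ v∈′) , All.lookup typ (proj₁ v∈′))
      (All.tabulate λ v∈ → let v∈′ = ∈-filterᵇ⁻ {p = on true} rest v∈ in on⇒side true (proj₂ v∈′) , All.lookup typ (proj₁ v∈′)))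
    where
    As Bs : List V
    As = filterᵇ (not ∘ on true) rest
    Bs = filterᵇ (on true) rest

  -- A ladder takes equally many vertices from both sides, so the balance of what remains depends
  -- only on W. The equation `sizes` says that W leaves equally many on both sides, and these can be
  -- inserted in pairs.
  absorb-rest : ∀ r₀ W R rest → Ladder r₀ R → 4 + 6 * τ ≤ length R → allFin n ↭ (ends R ++ W) ++ rest → All (Typical τ) rest →
    size (on true) + count (on false) W ≡ size (on false) + count (on true) W →
    ∃ λ R′ → Ladder r₀ R′ × headOr r₀ R′ ≡ headOr r₀ R × ends R′ ++ W ↭ allFin n
  absorb-rest r₀ W R rest L long partition typ sizes = go (pair-up rest typ equal-rest)
    where
    count-all : ∀ σ → size (on σ) ≡ (length R + count (on σ) W) + count (on σ) rest
    count-all σ = ≡.trans (count-↭ (on σ) partition) (≡.trans (count-++ (on σ) (ends R ++ W) rest)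
      (cong (_+ count (on σ) rest) (≡.trans (count-++ (on σ) (ends R) W) (cong (_+ count (on σ) W) (count-ends σ R L)))))
    equal-rest : count (on false) rest ≡ count (on true) rest
    equal-rest = ≤-antisym
      (lin (size (on true) ∷ size (on false) ∷ length R ∷ count (on true) W ∷ count (on false) W ∷ count (on false) rest ∷ count (on true) rest ∷ []) (# 0 ≼ # 2 ⊕ # 3 ⊕ # 6 ∷ # 2 ⊕ # 4 ⊕ # 5 ≼ # 1 ∷ # 1 ⊕ # 3 ≼ # 0 ⊕ # 4 ∷ []) (# 5 ≼ # 6) 1 (1 ∷ 1 ∷ 1 ∷ [])
        (≤-reflexive (count-all true) , ≤-reflexive (≡.sym (count-all false)) , ≤-reflexive (≡.sym sizes)))
      (lin (size (on true) ∷ size (on false) ∷ length R ∷ count (on true) W ∷ count (on false) W ∷ count (on false) rest ∷ count (on true) rest ∷ []) (# 2 ⊕ # 3 ⊕ # 6 ≼ # 0 ∷ # 1 ≼ # 2 ⊕ # 4 ⊕ # 5 ∷ # 0 ⊕ # 4 ≼ # 1 ⊕ # 3 ∷ []) (# 6 ≼ # 5) 1 (1 ∷ 1 ∷ 1 ∷ [])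
        (≤-reflexive (≡.sym (count-all true)) , ≤-reflexive (count-all false) , ≤-reflexive sizes))
    go : (∃ λ ps → ends ps ↭ rest × All PairOK ps) → ∃ λ R′ → Ladder r₀ R′ × headOr r₀ R′ ≡ headOr r₀ R × ends R′ ++ W ↭ allFin n
    go (ps , ps-↭ , ok) with insert-all ps R ok long L ps-unique
      where
      ps-unique : Unique (ends ps ++ ends R)
      ps-unique = proj₁ (unique-++⁻ (ends ps ++ ends R) (unique-↭ (↭-sym
        (↭-trans (↭-reflexive (++-assoc (ends ps) (ends R) W))
        (↭-trans (↭-++⁺ʳ (ends R ++ W) ps-↭) (↭-trans (↭-++-comm rest (ends R ++ W)) (↭-sym partition))))) (Unique.allFin⁺ n)))
    ... | R′ , L′ , h , p = R′ , L′ , h , ↭-trans (↭-++⁺ʳ W (↭-trans p (↭-++⁺ʳ (ends R) ps-↭)))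
      (↭-trans (↭-reflexive (++-assoc rest (ends R) W)) (↭-trans (↭-++-comm rest (ends R ++ W)) (↭-sym partition)))

  -- At most τ atypical vertices cost three rungs each, and 4 + 6τ rungs are added for the
  -- insertions; with W this makes at most 23τ + 11 vertices, within the 30τ that `fresh` can avoid.
  -- A last rung leads to e and z. Its end next to z is picked among the neighbours of z, which may
  -- be atypical.
  connected-ladder : ∀ r₀ W e z → TypicalRung r₀ → Unique W → length W ≤ 3 + 5 * τ →
    side e ≡ false → Typical τ e → side z ≡ true →
    ∃ λ R → Ladder r₀ R × 4 + 6 * τ ≤ length R × Compatible (e , z) (headOr r₀ R) × Unique (ends R ++ W) ×
            (∀ {v} → atypical τ v ≡ true → v ∈ ends R ++ W)
  connected-ladder r₀ W e z tr un W≤ se te sz with absorb-all r₀ W xs (state [] tt tr un z≤n z≤n)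
      (lin (length W ∷ τ ∷ length xs ∷ []) (# 0 ≼ κ 3 ⊕ 5 ⊛ # 1 ∷ κ 20 ≼ # 1 ∷ # 2 ≼ # 1 ∷ []) (2 ⊛ (3 ⊛ # 2 ⊕ κ 0) ⊕ # 0 ≼ 30 ⊛ # 1) 1 (1 ∷ 19 ∷ 6 ∷ []) (W≤ , 20≤τ , atypical≤))
    where
    xs : List V
    xs = filterᵇ (atypical τ) (allFin n)
  ... | S₁ , xs⊆ , _ with pad-by r₀ W (4 + 6 * τ) S₁
      (lin (length W ∷ τ ∷ size (atypical τ) ∷ []) (# 0 ≼ κ 3 ⊕ 5 ⊛ # 1 ∷ κ 20 ≼ # 1 ∷ # 2 ≼ # 1 ∷ []) (2 ⊛ (κ 4 ⊕ 6 ⊛ # 1 ⊕ (3 ⊛ # 2 ⊕ κ 0)) ⊕ # 0 ≼ 30 ⊛ # 1) 1 (1 ∷ 7 ∷ 6 ∷ []) (W≤ , 20≤τ , atypical≤))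
  ... | S₂@(state R L ht un₂ lo hi) , ext = connect
    where
    h : Rung
    h = headOr r₀ R
    room : ∀ j → j ≤ 1 → j + length (ends R ++ W) ≤ 30 * τ
    room j j≤ = lin (length W ∷ τ ∷ size (atypical τ) ∷ j ∷ length (ends R ++ W) ∷ length R ∷ []) (# 0 ≼ κ 3 ⊕ 5 ⊛ # 1 ∷ κ 20 ≼ # 1 ∷ # 2 ≼ # 1 ∷ # 3 ≼ κ 1 ∷ # 4 ≼ 2 ⊛ # 5 ⊕ # 0 ∷ # 5 ≼ κ 4 ⊕ 6 ⊛ # 1 ⊕ (3 ⊛ # 2 ⊕ κ 0) ∷ []) (# 3 ⊕ # 4 ≼ 30 ⊛ # 1) 1 (1 ∷ 7 ∷ 6 ∷ 1 ∷ 1 ∷ 2 ∷ [])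
                  (W≤ , 20≤τ , atypical≤ , j≤ , ≤-reflexive (length-used r₀ W R) , hi)
    connect : ∃ λ R → Ladder r₀ R × 4 + 6 * τ ≤ length R × Compatible (e , z) (headOr r₀ R) × Unique (ends R ++ W) ×
                      (∀ {v} → atypical τ v ≡ true → v ∈ ends R ++ W)
    connect with fresh bal (proj₁ h ∷ []) {ends R ++ W} se ((proj₁ ht , proj₁ (proj₂ (proj₂ ht))) ∷ []) (s≤s z≤n) (room 0 z≤n)
    ... | fresh-vertex b sb eb (hb ∷ []) tb b∉
      with fresh bal (proj₂ h ∷ b ∷ []) {b ∷ ends R ++ W} sz ((proj₁ (proj₂ ht) , proj₂ (proj₂ (proj₂ ht))) ∷ (sb , tb) ∷ [])
             (s≤s (s≤s z≤n)) (room 1 ≤-refl)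
    ... | fresh-vertex a sa za (ha ∷ ba ∷ []) ta a∉ =
      ((a , b) ∷ R) , ((sa , sb , adj-sym G ba) , (adj-sym G ha , adj-sym G hb) , L) ,
      m≤n⇒m≤1+n (subst (_≤ length R) (+-identityʳ (4 + 6 * τ)) lo) , (eb , za) ,
      unique-∷ a∉ (unique-∷ b∉ un₂) , λ {v} at → there (there (ext (xs⊆ (∈-filterᵇ⁺ {p = atypical τ} (∈-allFin v) at))))

  -- The triangle is completed by a common neighbour e of y and z, found because only z may be
  -- atypical. In the size equation `suc` accounts for the triangle, which takes y and z from one
  -- side and e from the other.
  close-ladder : ∀ o r₀ b₀ bs y z → TypicalRung r₀ → Faces o r₀ (b₀ ∷ bs) → Linked G (b₀ ∷ bs) → FinalFat (b₀ ∷ bs) →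
    side y ≡ true → side z ≡ true → y ~ z → Typical τ y → finalLeaf b₀ bs ~ y →
    Unique (y ∷ z ∷ vertices (b₀ ∷ bs)) → length (vertices (b₀ ∷ bs)) ≤ 5 * τ →
    size (on true) + count (on false) (vertices (b₀ ∷ bs)) ≡ suc (size (on false) + count (on true) (vertices (b₀ ∷ bs))) →
    HasSpanningHalin G
  close-ladder o r₀ b₀ bs y z tr h lk fat sy sz yz ty fy un P≤ sizes
    with fresh bal (y ∷ []) {y ∷ z ∷ vertices (b₀ ∷ bs)} sz ((sy , ty) ∷ []) (s≤s z≤n)
           (lin (length (vertices (b₀ ∷ bs)) ∷ τ ∷ []) (# 0 ≼ 5 ⊛ # 1 ∷ κ 20 ≼ # 1 ∷ []) (κ 2 ⊕ # 0 ≼ 30 ⊛ # 1) 1 (1 ∷ 25 ∷ []) (P≤ , 20≤τ))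
  ... | fresh-vertex e se ze (ye ∷ []) te e∉
    with connected-ladder r₀ (e ∷ y ∷ z ∷ vertices (b₀ ∷ bs)) e z tr (unique-∷ e∉ un) (s≤s (s≤s (s≤s P≤))) se te sz
  ... | R , L , long , c , unR , at∈ with complement (ends R ++ e ∷ y ∷ z ∷ vertices (b₀ ∷ bs)) unR
  ... | rest , partition , rest∉
    with absorb-rest r₀ (e ∷ y ∷ z ∷ vertices (b₀ ∷ bs)) R rest L long partition
           (All.tabulate λ v∈ → ¬atypical (Bool.¬-not λ at → rest∉ v∈ (at∈ at))) sizes′
    where
    P : List V
    P = vertices (b₀ ∷ bs)
    countW-true : count (on true) (e ∷ y ∷ z ∷ P) ≡ 2 + count (on true) P
    countW-true rewrite count-∷ (on true) e (y ∷ z ∷ P) | count-∷ (on true) y (z ∷ P) | count-∷ (on true) z P | se | sy | sz = refl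
    countW-false : count (on false) (e ∷ y ∷ z ∷ P) ≡ 1 + count (on false) P
    countW-false rewrite count-∷ (on false) e (y ∷ z ∷ P) | count-∷ (on false) y (z ∷ P) | count-∷ (on false) z P | se | sy | sz = refl
    sizes′ : size (on true) + count (on false) (e ∷ y ∷ z ∷ P) ≡ size (on false) + count (on true) (e ∷ y ∷ z ∷ P)
    sizes′ rewrite countW-true | countW-false | +-suc (size (on true)) (count (on false) P)
      | +-suc (size (on false)) (suc (count (on true) P)) | +-suc (size (on false)) (count (on true) P) = cong suc sizes
  ... | R₄ , L₄ , head₄ , all-↭ =
    lay-ladder-closes o r₀ b₀ bs R₄ e y z L₄ h lk fat (se , sz , adj-sym G ze)
      (subst (Compatible (e , z)) (≡.sym head₄) c) yz ye fy
      (unique-↭ (↭-sym all-vertices) (Unique.allFin⁺ n)) (λ v → ∈-resp-↭ (↭-sym all-vertices) (∈-allFin v))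
    where
    all-vertices : e ∷ y ∷ z ∷ ends R₄ ++ vertices (b₀ ∷ bs) ↭ allFin n
    all-vertices = ↭-trans (shifts (e ∷ y ∷ z ∷ []) (ends R₄)) all-↭

-- End triangles and surplus vertices

module Embedding {n : ℕ} (G : Graph n) (side : Fin n → Bool) {τ : ℕ} (bal : Sides.Balanced G side τ) where

  open Sides G side
  open Rungs G side
  open Balanced bal
  open Build G side bal using (TypicalRung)
  open Core G side bal

  private V = Fin n

  ≢-sides : ∀ {u v} → side u ≡ false → side v ≡ true → u ≢ v
  ≢-sides su sv refl = contradiction (≡.trans (≡.sym su) sv) λ ()

  ≢-adjacent : ∀ {u v} → u ~ v → u ≢ v
  ≢-adjacent {u} a refl = contradiction (≡.trans (≡.sym a) (irrefl G u)) λ ()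

  -- One end is the triangle on yz, the other the triangle b, a, a′, and the edge a′y closes the
  -- leaf cycle. As a may be atypical, the typical rung a₁b₁ is put between that triangle and the
  -- ladder.
  equal-sides⇒halin : ∀ a′ a y z → side a′ ≡ false → side a ≡ false → side y ≡ true → side z ≡ true →
    a′ ~ a → y ~ z → a′ ~ y → Typical τ a′ → Typical τ y → size (on true) ≡ size (on false) → HasSpanningHalin G
  equal-sides⇒halin a′ a y z sa′ sa sy sz aa yz ay ta ty sizes
    with fresh bal (a′ ∷ []) {y ∷ z ∷ a ∷ a′ ∷ []} sa ((sa′ , ta) ∷ []) (s≤s z≤n) (lin (τ ∷ []) (κ 20 ≼ # 0 ∷ []) (κ 4 ≼ 30 ⊛ # 0) 1 (30 ∷ []) 20≤τ)
  ... | fresh-vertex b sb ab (a′b ∷ []) tb b∉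
    with fresh bal [] {b ∷ y ∷ z ∷ a ∷ a′ ∷ []} sa [] z≤n (lin (τ ∷ []) (κ 20 ≼ # 0 ∷ []) (κ 5 ≼ 30 ⊛ # 0) 1 (30 ∷ []) 20≤τ)
  ... | fresh-vertex b₁ sb₁ ab₁ [] tb₁ b₁∉
    with fresh bal (b₁ ∷ []) {b₁ ∷ b ∷ y ∷ z ∷ a ∷ a′ ∷ []} sb ((sb₁ , tb₁) ∷ []) (s≤s z≤n) (lin (τ ∷ []) (κ 20 ≼ # 0 ∷ []) (κ 6 ≼ 30 ⊛ # 0) 1 (30 ∷ []) 20≤τ)
  ... | fresh-vertex a₁ sa₁ ba₁ (b₁a₁ ∷ []) ta₁ a₁∉ =
    close-ladder false (a₁ , b₁) (block a₁ b₁ []) (block b a (a′ ∷ []) ∷ []) y z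
      (sa₁ , sb₁ , ta₁ , tb₁) (refl , refl)
      ((adj-sym G b₁a₁ ∷ []) , tt , (adj-sym G ba₁ , adj-sym G ab₁) ,
       (adj-sym G ab ∷ adj-sym G a′b ∷ []) , (adj-sym G aa , tt) , tt , tt)
      (s≤s z≤n) sy sz yz ty ay
      (unique-↭ order distinct)
      (lin (τ ∷ []) (κ 20 ≼ # 0 ∷ []) (κ 5 ≼ 5 ⊛ # 0) 1 (5 ∷ []) 20≤τ) sizes′
    where
    P = a₁ ∷ b₁ ∷ b ∷ a ∷ a′ ∷ []
    distinct : Unique (a₁ ∷ b₁ ∷ b ∷ y ∷ z ∷ a ∷ a′ ∷ [])
    distinct = unique-∷ a₁∉ (unique-∷ b₁∉ (unique-∷ b∉
      ((≢-adjacent yz ∷ ≢-sides sa sy ∘ ≡.sym ∷ ≢-sides sa′ sy ∘ ≡.sym ∷ []) ∷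
       (≢-sides sa sz ∘ ≡.sym ∷ ≢-sides sa′ sz ∘ ≡.sym ∷ []) ∷ (≢-adjacent (adj-sym G aa) ∷ []) ∷ [] ∷ [])))
    order : a₁ ∷ b₁ ∷ b ∷ y ∷ z ∷ a ∷ a′ ∷ [] ↭ y ∷ z ∷ P
    order = ↭-trans (shift y (a₁ ∷ b₁ ∷ b ∷ []) _) (prep y (shift z (a₁ ∷ b₁ ∷ b ∷ []) _))
    sizes′ : size (on true) + count (on false) P ≡ suc (size (on false) + count (on true) P)
    sizes′ rewrite sa₁ | sb₁ | sb | sa | sa′ | sizes | +-suc (size (on false)) 2 = refl

  GoodEdge : V × V → Set
  GoodEdge (y , z) = side y ≡ true × side z ≡ true × y ~ z × Typical τ y

  -- The vertex a facing the ladder is chosen in advance to be adjacent to the typical end of the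
  -- edge absorbed next; y is the default when no edge is left.
  target : V → List (V × V) → V
  target y []            = y
  target y ((t , _) ∷ _) = t

  target-good : ∀ {y z} gs → GoodEdge (y , z) → All GoodEdge gs → side (target y gs) ≡ true × Typical τ (target y gs)
  target-good []       (sy , _ , _ , ty) _                      = sy , ty
  target-good (g ∷ gs) _                 ((sy , _ , _ , ty) ∷ _) = sy , ty

  gadget-room : ∀ {g} gs y z P → length P + 5 * suc (length gs) ≤ 5 * τ → ∀ j → j ≤ 2 →
                j + length (ends (g ∷ gs) ++ y ∷ z ∷ P) ≤ 30 * τ
  gadget-room {g} gs y z P len j j≤ rewrite length-++ (ends (g ∷ gs)) {y ∷ z ∷ P} | Build.length-ends G side bal gs =
    lin (j ∷ length gs ∷ length P ∷ τ ∷ []) (# 0 ≼ κ 2 ∷ # 2 ⊕ 5 ⊛ (κ 1 ⊕ # 1) ≼ 5 ⊛ # 3 ∷ κ 20 ≼ # 3 ∷ []) (# 0 ⊕ (κ 2 ⊕ 2 ⊛ # 1 ⊕ (κ 2 ⊕ # 2)) ≼ 30 ⊛ # 3) 1 (1 ∷ 1 ∷ 25 ∷ []) (j≤ , len , 20≤τ)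

  -- Each edge g = (yᵍ, zᵍ) inside the larger side yields a spine vertex a₁ with the two leaves zᵍ, yᵍ; the
  -- block b₂ - a₂ after it restores the orientation.
  gadgets⇒halin : ∀ gs y z a b b₀ bs → GoodEdge (y , z) → All GoodEdge gs → TypicalRung (a , b) → a ~ target y gs →
    Faces true (a , b) (b₀ ∷ bs) → Linked G (b₀ ∷ bs) → FinalFat (b₀ ∷ bs) → finalLeaf b₀ bs ~ y →
    Unique (ends gs ++ y ∷ z ∷ vertices (b₀ ∷ bs)) → length (vertices (b₀ ∷ bs)) + 5 * length gs ≤ 5 * τ →
    size (on true) + count (on false) (vertices (b₀ ∷ bs)) ≡ suc (size (on false) + count (on true) (vertices (b₀ ∷ bs))) + length gs →
    HasSpanningHalin G
  gadgets⇒halin [] y z a b b₀ bs (sy , sz , yz , ty) _ tr _ h lk fat fy un len sizes =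
    close-ladder true (a , b) b₀ bs y z tr h lk fat sy sz yz ty fy un
      (subst (_≤ 5 * τ) (+-identityʳ _) len) (≡.trans sizes (+-identityʳ _))
  gadgets⇒halin ((yᵍ , zᵍ) ∷ gs) y z a b b₀ bs ge ((syᵍ , szᵍ , yzᵍ , tyᵍ) ∷ good) tr@(sa , sb , ta , tb) ay h@(eb , ea) lk fat fy un len sizes
    with fresh bal (b ∷ yᵍ ∷ []) {ends ((yᵍ , zᵍ) ∷ gs) ++ y ∷ z ∷ vertices (b₀ ∷ bs)} szᵍ ((sb , tb) ∷ (syᵍ , tyᵍ) ∷ []) (s≤s (s≤s z≤n)) (gadget-room {yᵍ , zᵍ} gs y z (vertices (b₀ ∷ bs)) len 0 z≤n)
  ... | fresh-vertex a₁ sa₁ za₁ (ba₁ ∷ ya₁ ∷ []) ta₁ a₁∉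
    with fresh bal [] {a₁ ∷ ends ((yᵍ , zᵍ) ∷ gs) ++ y ∷ z ∷ vertices (b₀ ∷ bs)} sa₁ [] z≤n (gadget-room {yᵍ , zᵍ} gs y z (vertices (b₀ ∷ bs)) len 1 (s≤s z≤n))
  ... | fresh-vertex b₂ sb₂ ab₂ [] tb₂ b₂∉
    with fresh bal (b₂ ∷ target y gs ∷ []) {b₂ ∷ a₁ ∷ ends ((yᵍ , zᵍ) ∷ gs) ++ y ∷ z ∷ vertices (b₀ ∷ bs)} szᵍ
           ((sb₂ , tb₂) ∷ target-good gs ge good ∷ []) (s≤s (s≤s z≤n)) (gadget-room {yᵍ , zᵍ} gs y z (vertices (b₀ ∷ bs)) len 2 ≤-refl)
  ... | fresh-vertex a₂ sa₂ za₂ (b₂a₂ ∷ ta₂′ ∷ []) ta₂ a₂∉ =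
    gadgets⇒halin gs y z a₂ b₂ (block b₂ a₂ []) (block a₁ zᵍ (yᵍ ∷ []) ∷ b₀ ∷ bs) ge good (sa₂ , sb₂ , ta₂ , tb₂) (adj-sym G ta₂′)
      (refl , refl)
      ((b₂a₂ ∷ []) , tt , (adj-sym G ab₂ , adj-sym G za₂) ,
       (adj-sym G za₁ ∷ adj-sym G ya₁ ∷ []) , (adj-sym G yzᵍ , tt) , (subst (a₁ ~_) (≡.sym eb) (adj-sym G ba₁) , subst (yᵍ ~_) (≡.sym ea) (adj-sym G ay)) , lk)
      fat fy (unique-↭ order (unique-∷ a₂∉ (unique-∷ b₂∉ (unique-∷ a₁∉ un))))
      (lin (length (vertices (b₀ ∷ bs)) ∷ length gs ∷ τ ∷ []) (# 0 ⊕ 5 ⊛ (κ 1 ⊕ # 1) ≼ 5 ⊛ # 2 ∷ []) (κ 5 ⊕ # 0 ⊕ 5 ⊛ # 1 ≼ 5 ⊛ # 2) 1 (1 ∷ []) len)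
      sizes′
    where
    P = vertices (b₀ ∷ bs)
    P′ = b₂ ∷ a₂ ∷ a₁ ∷ zᵍ ∷ yᵍ ∷ P
    order : a₂ ∷ b₂ ∷ a₁ ∷ yᵍ ∷ zᵍ ∷ ends gs ++ y ∷ z ∷ P ↭ ends gs ++ y ∷ z ∷ P′
    order = ↭-trans (swap a₂ b₂ (prep a₁ (swap yᵍ zᵍ ↭-refl)))
      (↭-trans (shifts (b₂ ∷ a₂ ∷ a₁ ∷ zᵍ ∷ yᵍ ∷ []) (ends gs))
        (↭-++⁺ˡ (ends gs) (shifts (b₂ ∷ a₂ ∷ a₁ ∷ zᵍ ∷ yᵍ ∷ []) (y ∷ z ∷ []))))
    cF : count (on false) P′ ≡ 2 + count (on false) P
    cF rewrite count-∷ (on false) b₂ (a₂ ∷ a₁ ∷ zᵍ ∷ yᵍ ∷ P) | count-∷ (on false) a₂ (a₁ ∷ zᵍ ∷ yᵍ ∷ P) | count-∷ (on false) a₁ (zᵍ ∷ yᵍ ∷ P)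
      | count-∷ (on false) zᵍ (yᵍ ∷ P) | count-∷ (on false) yᵍ P | sb₂ | sa₂ | sa₁ | szᵍ | syᵍ = refl
    cT : count (on true) P′ ≡ 3 + count (on true) P
    cT rewrite count-∷ (on true) b₂ (a₂ ∷ a₁ ∷ zᵍ ∷ yᵍ ∷ P) | count-∷ (on true) a₂ (a₁ ∷ zᵍ ∷ yᵍ ∷ P) | count-∷ (on true) a₁ (zᵍ ∷ yᵍ ∷ P)
      | count-∷ (on true) zᵍ (yᵍ ∷ P) | count-∷ (on true) yᵍ P | sb₂ | sa₂ | sa₁ | szᵍ | syᵍ = refl
    sizes′ : size (on true) + count (on false) P′ ≡ suc (size (on false) + count (on true) P′) + length gs
    sizes′ = ≡.trans (cong (size (on true) +_) cF) (≡.trans both (cong (λ c → suc (size (on false) + c) + length gs) (≡.sym cT)))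
      where
      both : size (on true) + (2 + count (on false) P) ≡ suc (size (on false) + (3 + count (on true) P)) + length gs
      both = ≤-antisym
        (lin (size (on true) ∷ size (on false) ∷ count (on true) P ∷ count (on false) P ∷ length gs ∷ []) (# 0 ⊕ # 3 ≼ κ 1 ⊕ (# 1 ⊕ # 2) ⊕ (κ 1 ⊕ # 4) ∷ []) (# 0 ⊕ (κ 2 ⊕ # 3) ≼ κ 1 ⊕ (# 1 ⊕ (κ 3 ⊕ # 2)) ⊕ # 4) 1 (1 ∷ []) (≤-reflexive sizes))
        (lin (size (on true) ∷ size (on false) ∷ count (on true) P ∷ count (on false) P ∷ length gs ∷ []) (κ 1 ⊕ (# 1 ⊕ # 2) ⊕ (κ 1 ⊕ # 4) ≼ # 0 ⊕ # 3 ∷ []) (κ 1 ⊕ (# 1 ⊕ (κ 3 ⊕ # 2)) ⊕ # 4 ≼ # 0 ⊕ (κ 2 ⊕ # 3)) 1 (1 ∷ []) (≤-reflexive (≡.sym sizes)))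

  edges-room : ∀ {e₁ e₂} gs → suc (length gs) ≤ τ → ∀ j → j ≤ 1 → j + length (ends (e₁ ∷ e₂ ∷ gs)) ≤ 30 * τ
  edges-room gs len j j≤ rewrite Build.length-ends G side bal gs =
    lin (j ∷ length gs ∷ τ ∷ []) (# 0 ≼ κ 1 ∷ κ 1 ⊕ # 1 ≼ # 2 ∷ κ 20 ≼ # 2 ∷ []) (# 0 ⊕ (κ 4 ⊕ 2 ⊛ # 1) ≼ 30 ⊛ # 2) 1 (1 ∷ 2 ∷ 28 ∷ []) (j≤ , len , 20≤τ)

  -- The edge yz closes the ladder and y₁z₁ forms the far end: y₁ is a spine vertex with leaves a,
  -- z₁, x, where x closes the leaf cycle with y. The far end takes two vertices from each side, the
  -- closing triangle absorbs one surplus vertex, and each edge of `gs` absorbs one more.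
  unequal-sides⇒halin : ∀ e₁ e₂ gs → All GoodEdge (e₁ ∷ e₂ ∷ gs) → Unique (ends (e₁ ∷ e₂ ∷ gs)) →
    suc (length gs) ≤ τ → size (on true) ≡ size (on false) + suc (length gs) → HasSpanningHalin G
  unequal-sides⇒halin (y , z) (y₁ , z₁) gs (ge@(sy , sz , yz , ty) ∷ (sy₁ , sz₁ , yz₁ , ty₁) ∷ good) un len sizes
    with fresh bal (y₁ ∷ y ∷ []) {ends ((y , z) ∷ (y₁ , z₁) ∷ gs)} sz₁ ((sy₁ , ty₁) ∷ (sy , ty) ∷ []) (s≤s (s≤s z≤n)) (edges-room {y , z} {y₁ , z₁} gs len 0 z≤n)
  ... | fresh-vertex x sx zx (yx₁ ∷ yx ∷ []) tx x∉
    with fresh bal (y₁ ∷ target y gs ∷ []) {x ∷ ends ((y , z) ∷ (y₁ , z₁) ∷ gs)} sz₁ ((sy₁ , ty₁) ∷ target-good gs ge good ∷ []) (s≤s (s≤s z≤n)) (edges-room {y , z} {y₁ , z₁} gs len 1 ≤-refl)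
  ... | fresh-vertex a sa za (ya ∷ at ∷ []) ta a∉ =
    gadgets⇒halin gs y z a y₁ (block y₁ a (z₁ ∷ x ∷ [])) [] ge good (sa , sy₁ , ta , ty₁) (adj-sym G at) (refl , refl)
      ((ya ∷ yz₁ ∷ yx₁ ∷ []) , (adj-sym G za , zx , tt) , tt , tt) (s≤s z≤n) (adj-sym G yx)
      (unique-↭ order (unique-∷ a∉ (unique-∷ x∉ un)))
      (lin (length gs ∷ τ ∷ []) (κ 1 ⊕ # 0 ≼ # 1 ∷ []) (κ 4 ⊕ 5 ⊛ # 0 ≼ 5 ⊛ # 1) 1 (5 ∷ []) len) sizes′
    where
    P = y₁ ∷ a ∷ z₁ ∷ x ∷ []
    order : a ∷ x ∷ y ∷ z ∷ y₁ ∷ z₁ ∷ ends gs ↭ ends gs ++ y ∷ z ∷ P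
    order = ↭-trans (↭-trans (↭-trans (shift y (a ∷ x ∷ []) _) (prep y (shift z (a ∷ x ∷ []) _)))
              (prep y (prep z (↭-trans (shift y₁ (a ∷ x ∷ []) (z₁ ∷ ends gs)) (prep y₁ (prep a (swap x z₁ ↭-refl)))))))
            (↭-++-comm (y ∷ z ∷ P) (ends gs))
    sizes′ : size (on true) + count (on false) P ≡ suc (size (on false) + count (on true) P) + length gs
    sizes′ rewrite sy₁ | sa | sz₁ | sx | sizes = ≤-antisym
      (lin (size (on false) ∷ length gs ∷ []) (κ 0 ≼ κ 0 ∷ []) (# 0 ⊕ (κ 1 ⊕ # 1) ⊕ κ 2 ≼ κ 1 ⊕ (# 0 ⊕ κ 2) ⊕ # 1) 1 (0 ∷ []) z≤n)
      (lin (size (on false) ∷ length gs ∷ []) (κ 0 ≼ κ 0 ∷ []) (κ 1 ⊕ (# 0 ⊕ κ 2) ⊕ # 1 ≼ # 0 ⊕ (κ 1 ⊕ # 1) ⊕ κ 2) 1 (0 ∷ []) z≤n)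

-- Edges inside the larger side

module Partition {n : ℕ} (G : Graph n) (side : Fin n → Bool) where

  open Sides G side
  open Rungs G side using (_~_; ends; ends-zip; All-zip)

  private V = Fin n

  on-not : ∀ σ u → on (not σ) u ≡ not (on σ u)
  on-not true  u = refl
  on-not false u = ≡.sym (Bool.not-involutive (side u))

  size-cong : {P Q : V → Bool} → (∀ u → P u ≡ Q u) → size P ≡ size Q
  size-cong = count-cong (allFin n)

  size-mono : {P Q : V → Bool} → (∀ u → P u ≡ true → Q u ≡ true) → size P ≤ size Q
  size-mono = count-mono (allFin n)

  degree-split : ∀ v → degree G v ≡ size (inner v) + size (crossNbr v)
  degree-split v = ≡.trans (count-∧-split (Adj G v) (on (side v)) (allFin n))
    (cong₂ _+_ (size-cong λ u → Bool.∧-comm (Adj G v u) (on (side v) u))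
               (size-cong λ u → ≡.trans (Bool.∧-comm (Adj G v u) _) (cong (_∧ Adj G v u) (≡.sym (on-not (side v) u)))))

  cross-split : ∀ v → size (on (not (side v))) ≡ size (crossNbr v) + size (miss v)
  cross-split v = count-∧-split (on (not (side v))) (Adj G v) (allFin n)

  sides-total : size (on true) + size (on false) ≡ n
  sides-total = ≡.trans (count-not side (allFin n)) (length-tabulate id)

  abstract
    size-pick : ∀ {P : V → Bool} → 1 ≤ size P → ∃ λ v → P v ≡ true
    size-pick {P} 1≤ with count-pick P (λ _ → false) (allFin n) (subst (_< size P) (≡.sym (count-none (allFin n))) 1≤)
    ... | v , _ , p , _ = v , p

  inner-adj : ∀ {v u} → inner v u ≡ true → side u ≡ side v × v ~ u
  inner-adj {v} e with ∧-true e
  ... | o , a = on⇒side (side v) o , a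

  adj-inner : ∀ {v u} → side u ≡ side v → v ~ u → inner v u ≡ true
  adj-inner {v} s a = ∧-intro (side⇒on (side v) s) a

  abstract
    pick-typical : ∀ {τ} σ (U : List V) → size (atypical τ) + length U < size (on σ) →
                   ∃ λ v → side v ≡ σ × Typical τ v × v ∉ U
    pick-typical {τ} σ U lt with count-pick (on σ) (λ v → atypical τ v ∨ does (v ∈? U)) (allFin n)
      (≤-<-trans (≤-trans (count-∨ (atypical τ) _ (allFin n)) (+-monoʳ-≤ _ (size-∈ U))) lt)
    ... | v , _ , o , b with atypical τ v in at | v ∈? U
    ... | false | no v∉ = v , on⇒side σ o , ¬atypical at , v∉

  -- The rim of the wheel alternates between the two sides.
  wheel⇒halin : ∀ w → side w ≡ true → size (on true) ≡ suc (size (on false)) → 2 ≤ size (on false) →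
    (∀ u v → side u ≡ true → side v ≡ false → u ~ v) → (∀ u → side u ≡ true → u ≢ w → w ~ u) → HasSpanningHalin G
  wheel⇒halin w sw sizes 2≤ complete hub = build (zip As Bs) zipped refl
    where
    isB : V → Bool
    isB u = side u ∧ not (does (u ≟ w))
    As Bs : List V
    As = filterᵇ (on false) (allFin n)
    Bs = filterᵇ isB (allFin n)
    point : filterᵇ (λ u → side u ∧ does (u ≟ w)) (allFin n) ↭ w ∷ []
    point = same-members⇒↭ (Unique.filter⁺ (λ u → T? (side u ∧ does (u ≟ w))) (Unique.allFin⁺ n)) ([] ∷ [])
      (λ {u} u∈ → here (does⇒ (u ≟ w) (proj₂ (∧-true {side u} (proj₂ (∈-filterᵇ⁻ {p = λ u → side u ∧ does (u ≟ w)} (allFin n) u∈))))))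
      (λ { (here refl) → ∈-filterᵇ⁺ {p = λ u → side u ∧ does (u ≟ w)} (∈-allFin w) (∧-intro sw (dec-true (w ≟ w) refl)) })
    equal : length As ≡ length Bs
    equal = suc-injective (≡.trans (≡.sym sizes) (≡.trans (count-∧-split side (λ u → does (u ≟ w)) (allFin n))
              (cong (_+ length Bs) (↭-length point))))
    zipped : ends (zip As Bs) ↭ As ++ Bs
    zipped = ends-zip As Bs equal
    pairs-sides : All (λ p → side (proj₁ p) ≡ false × (side (proj₂ p) ≡ true × proj₂ p ≢ w)) (zip As Bs)
    pairs-sides = All-zip As Bs
      (All.tabulate λ v∈ → on⇒side false (proj₂ (∈-filterᵇ⁻ {p = on false} (allFin n) v∈)))
      (All.tabulate λ {v} v∈ → let e = ∧-true {side v} (proj₂ (∈-filterᵇ⁻ {p = isB} (allFin n) v∈)) in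
         proj₁ e , λ v≡w → contradiction (≡.trans (≡.sym (dec-true (v ≟ w) v≡w)) (not-true (proj₂ e))) λ ())
    all-∈ : ∀ v → v ∈ w ∷ As ++ Bs
    all-∈ v with v ≟ w | side v in sv
    ... | yes refl | _ = here refl
    ... | no v≢w | false = there (∈-++⁺ˡ (∈-filterᵇ⁺ (∈-allFin v) (cong not sv)))
    ... | no v≢w | true  = there (∈-++⁺ʳ As (∈-filterᵇ⁺ (∈-allFin v) (∧-intro sv (cong not (dec-false (v ≟ w) v≢w)))))
    distinct : Unique (w ∷ As ++ Bs)
    distinct = unique-∷ w∉ (Unique.++⁺ (Unique.filter⁺ (λ u → T? (on false u)) (Unique.allFin⁺ n))
      (Unique.filter⁺ (λ u → T? (isB u)) (Unique.allFin⁺ n)) disj)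
      where
      disj : ∀ {v} → ¬ (v ∈ As × v ∈ Bs)
      disj {v} (a , b) = contradiction (≡.trans (≡.sym (not-true (proj₂ (∈-filterᵇ⁻ {p = on false} (allFin n) a))))
        (proj₁ (∧-true {side v} (proj₂ (∈-filterᵇ⁻ {p = isB} (allFin n) b))))) λ ()
      w∉ : w ∉ As ++ Bs
      w∉ w∈ with ∈-++⁻ As w∈
      ... | inj₁ a = contradiction (≡.trans (≡.sym (not-true (proj₂ (∈-filterᵇ⁻ {p = on false} (allFin n) a)))) sw) λ ()
      ... | inj₂ b = contradiction (≡.trans (≡.sym (dec-true (w ≟ w) refl))
                       (not-true (proj₂ (∧-true {side w} (proj₂ (∈-filterᵇ⁻ {p = isB} (allFin n) b)))))) λ ()
    rim : ∀ a b ps → side b ≡ true →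
          All (λ p → side (proj₁ p) ≡ false × (side (proj₂ p) ≡ true × proj₂ p ≢ w)) ((a , b) ∷ ps) →
          chain G (a ∷ b ∷ ends ps) × side (lastOr b (ends ps)) ≡ true × All (λ l → w ~ l) (a ∷ b ∷ ends ps)
    rim a b [] sb ((sa , _ , b≢) ∷ []) =
      (adj-sym G (complete b a sb sa) , tt) , sb , (complete w a sw sa ∷ hub b sb b≢ ∷ [])
    rim a b ((a′ , b′) ∷ ps) sb ((sa , _ , b≢) ∷ oks@((sa′ , sb′ , _) ∷ _)) with rim a′ b′ ps sb′ oks
    ... | c , last , all = (adj-sym G (complete b a sb sa) , (complete b a′ sb sa′) , c) , last ,
                           (complete w a sw sa ∷ hub b sb b≢ ∷ all)
    build : ∀ ps → ends ps ↭ As ++ Bs → ps ≡ zip As Bs → HasSpanningHalin G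
    build [] p _ = contradiction (subst (2 ≤_) (zeroAs As (↭-length p)) 2≤) λ ()
      where
      zeroAs : ∀ as → 0 ≡ length (as ++ Bs) → length as ≡ 0
      zeroAs [] _ = refl
    build ((a , b) ∷ []) p _ = contradiction (lin (length As ∷ length Bs ∷ []) (κ 2 ≼ # 0 ∷ # 0 ⊕ # 1 ≼ κ 2 ∷ # 0 ≼ # 1 ∷ []) (κ 1 ≼ κ 0) 0 (2 ∷ 1 ∷ 1 ∷ [])
      (2≤ , ≤-reflexive (≡.trans (≡.sym (length-++ As)) (≡.sym (↭-length p))) , ≤-reflexive equal)) λ ()
    build ((a , b) ∷ (a′ , b′) ∷ ps) p eq with subst (All _) (≡.sym eq) pairs-sides
    ... | oks@((sa , sb , _) ∷ _) with rim a b ((a′ , b′) ∷ ps) sb oks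
    ... | c , last , all = caterpillar-halin G (block w a (b ∷ a′ ∷ b′ ∷ ends ps)) []
      (all , c , tt , tt) (complete _ a last sa) (s≤s (s≤s (s≤s z≤n))) tt
      (unique-↭ (↭-sym verts) distinct) (λ v → ∈-resp-↭ (↭-sym verts) (all-∈ v))
      where
      verts : w ∷ (a ∷ b ∷ a′ ∷ b′ ∷ ends ps) ++ [] ↭ w ∷ As ++ Bs
      verts = prep w (↭-trans (↭-reflexive (++-identityʳ _)) p)

half : ∀ d → ∃ λ h → 2 * h ≤ d × d ≤ 1 + 2 * h
half zero          = 0 , z≤n , z≤n
half (suc zero)    = 0 , z≤n , s≤s z≤n
half (suc (suc d)) with half d
... | h , lo , hi = suc h , lin (h ∷ d ∷ []) (2 ⊛ # 0 ≼ # 1 ∷ []) (2 ⊛ (κ 1 ⊕ # 0) ≼ κ 2 ⊕ # 1) 1 (1 ∷ []) lo , lin (h ∷ d ∷ []) (# 1 ≼ κ 1 ⊕ 2 ⊛ # 0 ∷ []) (κ 2 ⊕ # 1 ≼ κ 1 ⊕ 2 ⊛ (κ 1 ⊕ # 0)) 1 (1 ∷ []) hi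

module Unbalanced {n : ℕ} (G : Graph n) (side : Fin n → Bool) {τ : ℕ} (bal : Sides.Balanced G side τ)
                  (δ≥ : ∀ v → n + 1 ≤ 2 * degree G v) where

  open Sides G side
  open Rungs G side using (_~_; ends)
  open Balanced bal
  open Partition G side
  open Embedding G side bal

  private V = Fin n

  goodEdge? : ∀ e → Dec (GoodEdge e)
  goodEdge? (y , z) = (side y Bool.≟ true) ×-dec ((side z Bool.≟ true) ×-dec ((Adj G y z Bool.≟ true) ×-dec (size (miss y) ≤? τ)))

  cross+miss : ∀ {v} → side v ≡ true → size (on false) ≡ size (crossNbr v) + size (miss v)
  cross+miss {v} sv = subst (λ s → size (on (not s)) ≡ size (crossNbr v) + size (miss v)) sv (cross-split v)

  -- A vertex v of the larger side has `size (on false)` minus its misses as neighbours across, and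
  -- n is twice that size plus d; what the degree bound demands beyond this lies inside the side. So
  -- every missed vertex is paid for by an inner neighbour.
  inner≥ : ∀ {d v} → size (on true) ≡ size (on false) + d → side v ≡ true → d + 1 + 2 * size (miss v) ≤ 2 * size (inner v)
  inner≥ {d} {v} sizes sv =
    lin (n ∷ degree G v ∷ size (inner v) ∷ size (crossNbr v) ∷ size (miss v) ∷ size (on true) ∷ size (on false) ∷ d ∷ []) (# 0 ⊕ κ 1 ≼ 2 ⊛ # 1 ∷ # 1 ≼ # 2 ⊕ # 3 ∷ # 3 ⊕ # 4 ≼ # 6 ∷ # 5 ⊕ # 6 ≼ # 0 ∷ # 6 ⊕ # 7 ≼ # 5 ∷ # 5 ⊕ # 6 ≼ # 0 ∷ []) (# 7 ⊕ κ 1 ⊕ 2 ⊛ # 4 ≼ 2 ⊛ # 2) 1 (1 ∷ 2 ∷ 2 ∷ 1 ∷ 1 ∷ 0 ∷ [])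
      (δ≥ v , ≤-reflexive (degree-split v) , ≤-reflexive (≡.sym (cross+miss sv)) , ≤-reflexive sides-total , ≤-reflexive (≡.sym sizes) ,
       ≤-reflexive sides-total)

  abstract
    inner-neighbour : ∀ {v} → 1 ≤ size (inner v) → ∃ λ u → side u ≡ side v × v ~ u
    inner-neighbour 1≤ with size-pick 1≤
    ... | u , e = u , inner-adj e

  Disjoint₂ : V × V → V × V → Set
  Disjoint₂ (y₁ , z₁) (y₂ , z₂) = (y₁ ≢ y₂ × y₁ ≢ z₂) × (z₁ ≢ y₂ × z₁ ≢ z₂)

  disjoint₂? : ∀ e f → Dec (Disjoint₂ e f)
  disjoint₂? (y₁ , z₁) (y₂ , z₂) = (¬? (y₁ ≟ y₂) ×-dec ¬? (y₁ ≟ z₂)) ×-dec (¬? (z₁ ≟ y₂) ×-dec ¬? (z₁ ≟ z₂))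

  TwoEdges : Set
  TwoEdges = ∃ λ y₁ → ∃ λ z₁ → ∃ λ y₂ → ∃ λ z₂ → GoodEdge (y₁ , z₁) × GoodEdge (y₂ , z₂) × Disjoint₂ (y₁ , z₁) (y₂ , z₂)

  abstract
    twoEdges? : Dec TwoEdges
    twoEdges? = Fin.any? λ y₁ → Fin.any? λ z₁ → Fin.any? λ y₂ → Fin.any? λ z₂ →
      goodEdge? (y₁ , z₁) ×-dec (goodEdge? (y₂ , z₂) ×-dec disjoint₂? (y₁ , z₁) (y₂ , z₂))

  -- What the lack of two disjoint good edges forces when the sides differ by one: a vertex with a
  -- single inner neighbour can miss nothing across, whence `complete`.
  record Star : Set where
    field
      centre   : V
      side-c   : side centre ≡ true
      spokes   : ∀ u → side u ≡ true → u ≢ centre → centre ~ u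
      complete : ∀ u v → side u ≡ true → u ≢ centre → side v ≡ false → u ~ v

  twoEdges⇒halin : size (on true) ≡ suc (size (on false)) → TwoEdges → HasSpanningHalin G
  twoEdges⇒halin sizes (y₁ , z₁ , y₂ , z₂ , g₁ , g₂ , (a , b) , (c , d)) =
    unequal-sides⇒halin (y₁ , z₁) (y₂ , z₂) [] (g₁ ∷ g₂ ∷ [])
      ((≢-adjacent (proj₁ (proj₂ (proj₂ g₁))) ∷ a ∷ b ∷ []) ∷ (c ∷ d ∷ []) ∷ (≢-adjacent (proj₁ (proj₂ (proj₂ g₂))) ∷ []) ∷ [] ∷ [])
      (≤-trans (s≤s z≤n) 20≤τ) (≡.trans sizes (+-comm 1 _))

  module NoTwoEdges (sizes : size (on true) ≡ suc (size (on false))) (¬two : ¬ TwoEdges) where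

    deg≥ : ∀ {v} → side v ≡ true → 1 + size (miss v) ≤ size (inner v)
    deg≥ {v} sv = lin (size (miss v) ∷ size (inner v) ∷ []) (κ 1 ⊕ κ 1 ⊕ 2 ⊛ # 0 ≼ 2 ⊛ # 1 ∷ []) (κ 1 ⊕ # 0 ≼ # 1) 2 (1 ∷ [])
      (inner≥ {1} {v} (≡.trans sizes (+-comm 1 _)) sv)

    nbr : ∀ {v} → side v ≡ true → ∃ λ u → side u ≡ true × v ~ u
    nbr sv with inner-neighbour (≤-trans (s≤s z≤n) (deg≥ sv))
    ... | u , su , a = u , ≡.trans su sv , a

    many : ∀ (U : List V) → length U ≤ 3 → size (atypical τ) + length U < size (on true)
    many U U≤ with size-pick {on true} (subst (1 ≤_) (≡.sym sizes) (s≤s z≤n))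
    ... | v , sv = lin (size (atypical τ) ∷ length U ∷ size (on true) ∷ τ ∷ size (on false) ∷ size (crossNbr v) ∷ size (miss v) ∷ []) (# 0 ≼ # 3 ∷ # 1 ≼ κ 3 ∷ 40 ⊛ # 3 ≼ # 5 ∷ κ 20 ≼ # 3 ∷ # 5 ⊕ # 6 ≼ # 4 ∷ κ 1 ⊕ # 4 ≼ # 2 ∷ []) (κ 1 ⊕ (# 0 ⊕ # 1) ≼ # 2) 1 (1 ∷ 1 ∷ 1 ∷ 39 ∷ 1 ∷ 1 ∷ [])
                      (atypical≤ , U≤ , cross≥ v , 20≤τ , ≤-reflexive (≡.sym (cross+miss sv)) , ≤-reflexive (≡.sym sizes))

    Meets : V × V → V × V → Set
    Meets (y₁ , z₁) (y₂ , z₂) = (y₁ ≡ y₂ ⊎ y₁ ≡ z₂) ⊎ (z₁ ≡ y₂ ⊎ z₁ ≡ z₂)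

    meets : ∀ {e f} → GoodEdge e → GoodEdge f → Meets e f
    meets {y₁ , z₁} {y₂ , z₂} g h with y₁ ≟ y₂ | y₁ ≟ z₂ | z₁ ≟ y₂ | z₁ ≟ z₂
    ... | yes p | _ | _ | _ = inj₁ (inj₁ p)
    ... | no _ | yes p | _ | _ = inj₁ (inj₂ p)
    ... | no _ | no _ | yes p | _ = inj₂ (inj₁ p)
    ... | no _ | no _ | no _ | yes p = inj₂ (inj₂ p)
    ... | no a | no b | no c | no d = contradiction (y₁ , z₁ , y₂ , z₂ , g , h , (a , b) , (c , d)) ¬two

    -- Every good edge meets the good edge wz and, since z is the only inner neighbour of w, passes
    -- through z. The star is read off from this.
    module Centre (w z : V) (sw : side w ≡ true) (tw : Typical τ w) (sz : side z ≡ true)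
                  (w-nbr : ∀ {x} → side x ≡ true → w ~ x → x ≡ z) (wz : w ~ z) where

      through-z : ∀ {s t} → GoodEdge (s , t) → s ≡ z ⊎ t ≡ z
      through-z {s} {t} g@(ss , st , a , _) with meets {s , t} {w , z} g (sw , sz , wz , tw)
      ... | inj₁ (inj₁ refl) = inj₂ (w-nbr st a)
      ... | inj₁ (inj₂ e)    = inj₁ e
      ... | inj₂ (inj₁ refl) = inj₁ (w-nbr ss (adj-sym G a))
      ... | inj₂ (inj₂ e)    = inj₂ e

      abstract
        -- A vertex v missing more than τ vertices has at least τ + 2 inner neighbours by `deg≥`,
        -- one of which is typical and different from z. Together with v it is a good edge that
        -- avoids z.
        typical : ∀ {v} → side v ≡ true → v ≢ z → Typical τ v
        typical {v} sv v≢z with size (miss v) ≤? τ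
        ... | yes t = t
        ... | no ¬t with count-pick (inner v) (λ x → atypical τ x ∨ does (x ∈? (z ∷ []))) (allFin n)
              (≤-<-trans (≤-trans (count-∨ (atypical τ) _ (allFin n)) (+-monoʳ-≤ _ (size-∈ (z ∷ []))))
                (lin (size (atypical τ) ∷ τ ∷ size (miss v) ∷ size (inner v) ∷ []) (# 0 ≼ # 1 ∷ κ 1 ⊕ # 1 ≼ # 2 ∷ κ 1 ⊕ # 2 ≼ # 3 ∷ []) (κ 1 ⊕ (# 0 ⊕ κ 1) ≼ # 3) 1 (1 ∷ 1 ∷ 1 ∷ [])
                  (atypical≤ , ≰⇒> ¬t , deg≥ sv)))
        ...   | x , _ , ix , bx with atypical τ x in ax | x ≟ z | inner-adj ix
        ...   | false | no x≢z | sx , a with through-z {x} {v} (≡.trans sx sv , sv , adj-sym G a , ¬atypical ax)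
        ...     | inj₁ e = contradiction e x≢z
        ...     | inj₂ e = contradiction e v≢z

      module _ {v : V} (sv : side v ≡ true) (v≢z : v ≢ z) where

        only-z : ∀ {x} → side x ≡ true → v ~ x → x ≡ z
        only-z {x} sx a with through-z {v} {x} (sv , sx , a , typical sv v≢z)
        ... | inj₁ e = contradiction e v≢z
        ... | inj₂ e = e

        to-z : v ~ z
        to-z with nbr sv
        ... | x , sx , a = subst (v ~_) (only-z sx a) a

        -- z is the only inner neighbour of v, and `deg≥` asks for one more inner neighbour than
        -- there are missed vertices.
        no-miss : size (miss v) ≡ 0
        no-miss = n≤0⇒n≡0 (≤-pred (≤-trans (deg≥ sv) inner≤))
          where
          inner≤ : size (inner v) ≤ 1
          inner≤ = ≤-trans (size-mono {inner v} {λ x → does (x ∈? (z ∷ []))} λ x ix → dec-true (x ∈? (z ∷ []))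
                     (here (only-z (≡.trans (proj₁ (inner-adj ix)) sv) (proj₂ (inner-adj ix))))) (size-∈ (z ∷ []))

        to-cross : ∀ x → side x ≡ false → v ~ x
        to-cross x sx = Bool.¬-not λ ¬a → contradiction (subst (1 ≤_) no-miss
          (unique-⊆-length {xs = x ∷ []} ([] ∷ []) λ { (here refl) → ∈-filterᵇ⁺ {p = miss v} (∈-allFin x)
            (∧-intro (subst (λ s → on (not s) x ≡ true) (≡.sym sv) (side⇒on false sx)) (cong not ¬a)) })) λ ()

      star : Star
      star = record { centre = z ; side-c = sz ; spokes = λ u su u≢ → adj-sym G (to-z su u≢)
                    ; complete = λ u v su u≢ → to-cross su u≢ v }

    abstract
      -- Pairwise intersecting edges form a star or a triangle; there are too many vertices for a triangle.
      star : Star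
      star with pick-typical true [] (many [] z≤n)
      ... | p , sp , tp , _ with nbr sp
      ... | q , sq , pq with pick-typical true (p ∷ q ∷ []) (many (p ∷ q ∷ []) (s≤s (s≤s z≤n)))
      ... | u , su , tu , u∉ with nbr su
      ... | z , sz , uz with pick-typical true (p ∷ q ∷ u ∷ []) (many (p ∷ q ∷ u ∷ []) ≤-refl)
      ... | w , sw , tw , w∉ = Centre.star w z sw tw sz w-nbr wz
        where
        z∈ : z ≡ p ⊎ z ≡ q
        z∈ with meets {u , z} {p , q} (su , sz , uz , tu) (sp , sq , pq , tp)
        ... | inj₁ (inj₁ e) = contradiction (here e) u∉
        ... | inj₁ (inj₂ e) = contradiction (there (here e)) u∉
        ... | inj₂ e = e
        pq∌w : ¬ (w ≡ p ⊎ w ≡ q)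
        pq∌w (inj₁ e) = w∉ (here e)
        pq∌w (inj₂ e) = w∉ (there (here e))
        pq∌u : ¬ (u ≡ p ⊎ u ≡ q)
        pq∌u (inj₁ e) = u∉ (here e)
        pq∌u (inj₂ e) = u∉ (there (here e))
        x∈pq : ∀ {x} → side x ≡ true → w ~ x → x ≡ p ⊎ x ≡ q
        x∈pq {x} sx a with meets {w , x} {p , q} (sw , sx , a , tw) (sp , sq , pq , tp)
        ... | inj₁ e = contradiction e pq∌w
        ... | inj₂ e = e
        w-nbr : ∀ {x} → side x ≡ true → w ~ x → x ≡ z
        w-nbr {x} sx a with meets {w , x} {u , z} (sw , sx , a , tw) (su , sz , uz , tu)
        ... | inj₁ (inj₁ e) = contradiction (there (there (here e))) w∉
        ... | inj₁ (inj₂ refl) = contradiction z∈ pq∌w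
        ... | inj₂ (inj₁ refl) = contradiction (x∈pq sx a) pq∌u
        ... | inj₂ (inj₂ e) = e
        wz : w ~ z
        wz with nbr sw
        ... | x , sx , a = subst (w ~_) (w-nbr sx a) a

  module Matching {d Δ : ℕ} (sizes : size (on true) ≡ size (on false) + d)
                  (Δ≥ : ∀ v → side v ≡ true → size (inner v) ≤ Δ) (big : 4 * Δ + 2 * d + τ + 1 ≤ size (on true)) where

    -- If a matching of k ≤ d good edges cannot be extended, then all inner neighbours of the free
    -- typical vertices X are among its 2k ends. Each vertex of X has more than d/2 of them and each
    -- end at most Δ, so X has at most 4Δ vertices. But at most τ + 2d vertices of the larger side
    -- are outside X, which contradicts `big`.
    matching : ∀ k → k ≤ suc d → ∃ λ es → length es ≡ k × All GoodEdge es × Unique (ends es)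
    matching zero _ = [] , refl , [] , []
    matching (suc k) (s≤s k≤d) with matching k (m≤n⇒m≤1+n k≤d)
    ... | es , len , good , un with Fin.any? (λ y → Fin.any? (λ z → goodEdge? (y , z) ×-dec (¬? (y ∈? ends es) ×-dec ¬? (z ∈? ends es))))
    ...   | yes (y , z , g , y∉ , z∉) = ((y , z) ∷ es) , cong suc len , g ∷ good ,
              unique-∷ (λ { (here e) → ≢-adjacent (proj₁ (proj₂ (proj₂ g))) e ; (there m) → y∉ m }) (unique-∷ z∉ un)
    ...   | no ¬more = contradiction few λ ()
      where
      free : V → Bool
      free v = on true v ∧ not (atypical τ v ∨ does (v ∈? ends es))
      X : List V
      X = filterᵇ free (allFin n)
      ends-true : ∀ es → All GoodEdge es → ∀ {v} → v ∈ ends es → side v ≡ true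
      ends-true ((y , z) ∷ es) ((sy , _) ∷ _) (here refl) = sy
      ends-true ((y , z) ∷ es) ((_ , sz , _) ∷ _) (there (here refl)) = sz
      ends-true ((y , z) ∷ es) (_ ∷ gs) (there (there m)) = ends-true es gs m
      free⇒ : ∀ {v} → v ∈ X → side v ≡ true × Typical τ v × v ∉ ends es
      free⇒ {v} v∈ with ∧-true {on true v} (proj₂ (∈-filterᵇ⁻ {p = free} (allFin n) v∈))
      ... | o , b with atypical τ v in at | v ∈? ends es
      ... | false | no v∉ = o , ¬atypical at , v∉
      -- h is d/2 rounded down. For either parity X has at least h + 1 inner neighbours per vertex
      -- and there are at most 2d ≤ 4(h + 1) ends, so the factor h + 1 cancels.
      h = proj₁ (half d)
      h≤ = proj₁ (proj₂ (half d))
      d≤ = proj₂ (proj₂ (half d))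
      rows : ∀ {x} → x ∈ X → suc h ≤ count (Adj G x) (ends es)
      rows {x} x∈ with free⇒ x∈
      ... | sx , tx , x∉ = ≤-trans
        (lin (d ∷ h ∷ size (miss x) ∷ size (inner x) ∷ []) (# 0 ⊕ κ 1 ⊕ 2 ⊛ # 2 ≼ 2 ⊛ # 3 ∷ 2 ⊛ # 1 ≼ # 0 ∷ []) (κ 1 ⊕ # 1 ≼ # 3) 2 (1 ∷ 1 ∷ []) (inner≥ {v = x} sizes sx , h≤))
        (unique-⊆-length (Unique.filter⁺ (λ u → T? (inner x u)) (Unique.allFin⁺ n)) λ {u} u∈ → into (inner-adj (proj₂ (∈-filterᵇ⁻ {p = inner x} (allFin n) u∈))))
        where
        into : ∀ {u} → side u ≡ side x × x ~ u → u ∈ filterᵇ (Adj G x) (ends es)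
        into {u} (su , a) with u ∈? ends es
        ... | yes u∈ = ∈-filterᵇ⁺ u∈ a
        ... | no  u∉ = contradiction (x , u , (sx , ≡.trans su sx , a , tx) , x∉ , u∉) ¬more
      columns : ∀ {y} → y ∈ ends es → count (λ x → Adj G x y) X ≤ Δ
      columns {y} y∈ = ≤-trans (unique-⊆-length (Unique.filter⁺ (λ u → T? (Adj G u y)) (Unique.filter⁺ (λ u → T? (free u)) (Unique.allFin⁺ n)))
          λ {u} u∈ → let m = ∈-filterᵇ⁻ {p = λ x → Adj G x y} X u∈ in
            ∈-filterᵇ⁺ {p = inner y} (∈-allFin u) (adj-inner (≡.trans (proj₁ (free⇒ (proj₁ m))) (≡.sym sy)) (adj-sym G (proj₂ m))))
        (Δ≥ y sy)
        where
        sy = ends-true es good y∈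
      X≤ : length X ≤ 4 * Δ
      X≤ = *-cancelʳ-≤ (length X) (4 * Δ) (suc h) (≤-trans (incidences (Adj G) X (ends es) rows columns) (begin
        length (ends es) * Δ ≤⟨ *-monoˡ-≤ Δ ends≤ ⟩
        (4 * suc h) * Δ      ≡⟨ *-assoc 4 (suc h) Δ ⟩
        4 * (suc h * Δ)      ≡⟨ cong (4 *_) (*-comm (suc h) Δ) ⟩
        4 * (Δ * suc h)      ≡⟨ *-assoc 4 Δ (suc h) ⟨
        (4 * Δ) * suc h      ∎))
        where
        open ≤-Reasoning
        ends≤ : length (ends es) ≤ 4 * suc h
        ends≤ = lin (length (ends es) ∷ length es ∷ k ∷ d ∷ h ∷ []) (# 0 ≼ 2 ⊛ # 1 ∷ # 1 ≼ # 2 ∷ # 2 ≼ # 3 ∷ # 3 ≼ κ 1 ⊕ 2 ⊛ # 4 ∷ []) (# 0 ≼ 4 ⊛ (κ 1 ⊕ # 4)) 1 (1 ∷ 2 ∷ 2 ∷ 2 ∷ [])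
          (≤-reflexive (Build.length-ends G side bal es) , ≤-reflexive len , k≤d , d≤)
      X≥ : size (on true) ≤ length X + (size (atypical τ) + length (ends es))
      X≥ = ≤-trans (≤-reflexive (count-∧-split (on true) (λ v → atypical τ v ∨ does (v ∈? ends es)) (allFin n)))
        (lin (length X ∷ size (λ v → on true v ∧ (atypical τ v ∨ does (v ∈? ends es))) ∷ size (λ v → atypical τ v ∨ does (v ∈? ends es)) ∷ size (atypical τ) ∷ length (ends es) ∷ size (λ v → does (v ∈? ends es)) ∷ []) (# 1 ≼ # 2 ∷ # 2 ≼ # 3 ⊕ # 5 ∷ # 5 ≼ # 4 ∷ []) (# 1 ⊕ # 0 ≼ # 0 ⊕ (# 3 ⊕ # 4)) 1 (1 ∷ 1 ∷ 1 ∷ [])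
          (size-mono (λ v → proj₂ ∘ ∧-true {on true v}) , count-∨ (atypical τ) _ (allFin n) , size-∈ (ends es)))
      few : 1 ≤ 0
      few = lin (size (on true) ∷ length X ∷ size (atypical τ) ∷ length (ends es) ∷ length es ∷ k ∷ d ∷ Δ ∷ τ ∷ []) (# 0 ≼ # 1 ⊕ (# 2 ⊕ # 3) ∷ # 2 ≼ # 8 ∷ # 3 ≼ 2 ⊛ # 4 ∷ # 4 ≼ # 5 ∷ # 5 ≼ # 6 ∷ # 1 ≼ 4 ⊛ # 7 ∷ 4 ⊛ # 7 ⊕ 2 ⊛ # 6 ⊕ # 8 ⊕ κ 1 ≼ # 0 ∷ []) (κ 1 ≼ κ 0) 0 (1 ∷ 1 ∷ 1 ∷ 2 ∷ 2 ∷ 1 ∷ 1 ∷ [])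
        (X≥ , atypical≤ , ≤-reflexive (Build.length-ends G side bal es) , ≤-reflexive len , k≤d , X≤ , big)

    matching⇒halin : 1 ≤ d → d ≤ τ → HasSpanningHalin G
    matching⇒halin 1≤d d≤τ with matching (suc d) ≤-refl
    ... | [] , () , _
    ... | e₁ ∷ [] , len , _ = contradiction (subst (1 ≤_) (≡.sym (suc-injective len)) 1≤d) λ ()
    ... | e₁ ∷ e₂ ∷ gs , len , good , un = unequal-sides⇒halin e₁ e₂ gs good un
            (subst (_≤ τ) (≡.sym (suc-injective len)) d≤τ) (≡.trans sizes (cong (size (on false) +_) (≡.sym (suc-injective len))))

  inner≥1 : size (on true) ≡ size (on false) → ∀ v → 1 ≤ size (inner v)
  inner≥1 sizes v = lin (n ∷ degree G v ∷ size (inner v) ∷ size (crossNbr v) ∷ size (on (not (side v))) ∷ size (miss v) ∷ size (on true) ∷ size (on false) ∷ []) (# 0 ⊕ κ 1 ≼ 2 ⊛ # 1 ∷ # 1 ≼ # 2 ⊕ # 3 ∷ # 3 ⊕ # 5 ≼ # 4 ∷ # 4 ≼ # 6 ∷ # 6 ⊕ # 7 ≼ # 0 ∷ # 6 ≼ # 7 ∷ []) (κ 1 ≼ # 2) 2 (1 ∷ 2 ∷ 2 ∷ 2 ∷ 1 ∷ 1 ∷ [])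
      (δ≥ v , ≤-reflexive (degree-split v) , ≤-reflexive (≡.sym (cross-split v)) , other (not (side v)) , ≤-reflexive sides-total , ≤-reflexive sizes)
    where
    other : ∀ σ → size (on σ) ≤ size (on true)
    other true  = ≤-refl
    other false = ≤-reflexive (≡.sym sizes)

  -- For equal sides a degree above n/2 forces a neighbour inside the own side. A typical a′ and a
  -- typical neighbour y of it across thus start one inner edge on each side, already joined by a′y.
  equal⇒halin : size (on true) ≡ size (on false) → τ < size (on false) → HasSpanningHalin G
  equal⇒halin sizes τ< with pick-typical {τ} false [] (≤-<-trans (≤-trans (≤-reflexive (+-identityʳ _)) atypical≤) τ<)
  ... | a′ , sa′ , ta′ , _ with inner-neighbour (inner≥1 sizes a′)
  ... | a , sa , aa with fresh bal [] {[]} sa′ [] z≤n z≤n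
  ... | fresh-vertex y sy ay [] ty _ with inner-neighbour (inner≥1 sizes y)
  ... | z , sz , yz = equal-sides⇒halin a′ a y z sa′ (≡.trans sa sa′) sy (≡.trans sz sy) aa yz ay ta′ ty sizes

-- Balancing the sides

∨-false : ∀ {a b} → a ∨ b ≡ false → a ≡ false × b ≡ false
∨-false {false} {false} _ = refl , refl

module _ {n : ℕ} (G : Graph n) where

  private V = Fin n

  size-except : ∀ {P Q : V → Bool} w → (∀ u → u ≢ w → P u ≡ true → Q u ≡ true) → size P ≤ suc (size Q)
  size-except {P} {Q} w f = ≤-trans (count-mono (allFin n) imp)
    (≤-trans (count-∨ (λ u → does (u ∈? (w ∷ []))) Q (allFin n)) (+-monoˡ-≤ (size Q) (size-∈ (w ∷ []))))
    where
    imp : ∀ u → P u ≡ true → does (u ∈? (w ∷ [])) ∨ Q u ≡ true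
    imp u pu with u ≟ w
    ... | yes _   = refl
    ... | no  u≢w = f u u≢w pu

  module Negation (side : V → Bool) where

    private
      module S = Sides G side
      module N = Sides G (not ∘ side)

    on-negate : ∀ σ u → N.on σ u ≡ S.on (not σ) u
    on-negate true  u = refl
    on-negate false u = Bool.not-involutive (side u)

    on-across : ∀ v u → N.on (not (not (side v))) u ≡ S.on (not (side v)) u
    on-across v u = ≡.trans (on-negate (not (not (side v))) u) (cong (λ s → S.on s u) (Bool.not-involutive (not (side v))))

    cross-negate : ∀ v → size (N.crossNbr v) ≡ size (S.crossNbr v)
    cross-negate v = count-cong (allFin n) λ u → cong (_∧ Adj G v u) (on-across v u)

    miss-negate : ∀ v → size (N.miss v) ≡ size (S.miss v)
    miss-negate v = count-cong (allFin n) λ u → cong (_∧ not (Adj G v u)) (on-across v u)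

    inner-negate : ∀ v → size (N.inner v) ≡ size (S.inner v)
    inner-negate v = count-cong (allFin n) λ u → cong (_∧ Adj G v u)
      (≡.trans (on-negate (not (side v)) u) (cong (λ s → S.on s u) (Bool.not-involutive (side v))))

    size-on-negate : ∀ σ → size (N.on σ) ≡ size (S.on (not σ))
    size-on-negate σ = count-cong (allFin n) (on-negate σ)

    balanced-negate : ∀ {τ} → S.Balanced τ → N.Balanced τ
    balanced-negate {τ} bal = record
      { cross≥    = λ v → subst (40 * τ ≤_) (≡.sym (cross-negate v)) (cross≥ v)
      ; atypical≤ = subst (_≤ τ) (count-cong (allFin n) λ v → cong (λ m → not (m ≤ᵇ τ)) (≡.sym (miss-negate v))) atypical≤
      ; 20≤τ      = 20≤τ }
      where open S.Balanced bal

  module Flip (side : V → Bool) (w : V) where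

    flipped : V → Bool
    flipped v = if does (v ≟ w) then not (side v) else side v

    flipped-other : ∀ {v} → v ≢ w → flipped v ≡ side v
    flipped-other {v} v≢w rewrite dec-false (v ≟ w) v≢w = refl

    flipped-self : flipped w ≡ not (side w)
    flipped-self rewrite dec-true (w ≟ w) refl = refl

    private
      module S = Sides G side
      module F = Sides G flipped

    on-other : ∀ σ {u} → u ≢ w → F.on σ u ≡ S.on σ u
    on-other true  u≢ = flipped-other u≢
    on-other false u≢ = cong not (flipped-other u≢)

    across-other : ∀ {v u} → v ≢ w → u ≢ w → F.on (not (flipped v)) u ≡ S.on (not (side v)) u
    across-other {v} {u} v≢ u≢ = ≡.trans (on-other (not (flipped v)) u≢) (cong (λ s → S.on (not s) u) (flipped-other v≢))

    cross-other : ∀ {v} → v ≢ w → size (S.crossNbr v) ≤ suc (size (F.crossNbr v))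
    cross-other {v} v≢ = size-except w λ u u≢ e → ≡.trans (cong (_∧ Adj G v u) (across-other v≢ u≢)) e

    miss-other : ∀ {v} → v ≢ w → size (F.miss v) ≤ suc (size (S.miss v))
    miss-other {v} v≢ = size-except w λ u u≢ e → ≡.trans (cong (_∧ not (Adj G v u)) (≡.sym (across-other v≢ u≢))) e

    cross-self : size (S.inner w) ≤ size (F.crossNbr w)
    cross-self = count-mono (allFin n) λ u e → go u e (u ≟ w)
      where
      go : ∀ u → S.inner w u ≡ true → Dec (u ≡ w) → F.crossNbr w u ≡ true
      go u e (yes refl) = contradiction (≡.trans (≡.sym (irrefl G u)) (proj₂ (∧-true {S.on (side u) u} e))) λ ()
      go u e (no u≢w) = ≡.trans (cong (_∧ Adj G w u) (≡.trans (on-other (not (flipped w)) u≢w)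
        (cong (λ s → S.on s u) (≡.trans (cong not flipped-self) (Bool.not-involutive (side w)))))) e

    size-leave : size (S.on (side w)) ≡ suc (size (F.on (side w)))
    size-leave = ≤-antisym (size-except w λ u u≢ e → ≡.trans (on-other (side w) u≢) e)
      (unique-⊆-length (unique-∷ w∉ (Unique.filter⁺ (λ u → T? (F.on (side w) u)) (Unique.allFin⁺ n))) sub)
      where
      w∉F : F.on (side w) w ≢ true
      w∉F e = contradiction (≡.trans (≡.sym (F.on⇒side (side w) e)) flipped-self) (Bool.not-¬ refl)
      w∉ : w ∉ filterᵇ (F.on (side w)) (allFin n)
      w∉ w∈ = w∉F (proj₂ (∈-filterᵇ⁻ {p = F.on (side w)} (allFin n) w∈))
      sub : ∀ {u} → u ∈ w ∷ filterᵇ (F.on (side w)) (allFin n) → u ∈ filterᵇ (S.on (side w)) (allFin n)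
      sub (here refl) = ∈-filterᵇ⁺ {p = S.on (side w)} (∈-allFin w) (S.side⇒on (side w) refl)
      sub {u} (there u∈) = ∈-filterᵇ⁺ {p = S.on (side w)} (∈-allFin u) (≡.trans (≡.sym (on-other (side w) u≢)) e)
        where
        e = proj₂ (∈-filterᵇ⁻ {p = F.on (side w)} (allFin n) u∈)
        u≢ : u ≢ w
        u≢ refl = w∉F e

    size-enter : size (F.on (not (side w))) ≡ suc (size (S.on (not (side w))))
    size-enter = +-cancelˡ-≡ (size (F.on (side w))) _ _ (≡.trans (total F.on (Partition.sides-total G flipped) (side w))
      (≡.trans (≡.sym (total S.on (Partition.sides-total G side) (side w)))
        (≡.trans (cong (_+ size (S.on (not (side w)))) size-leave) (≡.sym (+-suc (size (F.on (side w))) _)))))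
      where
      total : ∀ (on : Bool → V → Bool) → size (on true) + size (on false) ≡ n → ∀ σ → size (on σ) + size (on (not σ)) ≡ n
      total on e true  = e
      total on e false = ≡.trans (+-comm (size (on false)) _) e

  module _ {τ : ℕ} (δ≥ : ∀ v → n + 1 ≤ 2 * degree G v) where

    -- If the inner edges give only a star, its centre z is moved across. Then all pairs across are
    -- adjacent and the other side is the larger one, again by one vertex. Either two disjoint edges
    -- lie inside it, or it is spanned by a star whose centre is adjacent to all other vertices and
    -- so is the hub of a wheel.
    one-more⇒halin : ∀ side → Sides.Balanced G side τ → 40 * τ ≤ size (Sides.on G side false) →
                     size (Sides.on G side true) ≡ suc (size (Sides.on G side false)) → HasSpanningHalin G
    one-more⇒halin side bal big sizes with Unbalanced.twoEdges? G side bal δ≥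
    ... | yes two = Unbalanced.twoEdges⇒halin G side bal δ≥ sizes two
    ... | no ¬two = second (Unbalanced.NoTwoEdges.star G side bal δ≥ sizes ¬two)
      where
      20≤τ : 20 ≤ τ
      20≤τ = Sides.Balanced.20≤τ bal
      second : Unbalanced.Star G side bal δ≥ → HasSpanningHalin G
      second record { centre = z ; side-c = sz ; spokes = spokes ; complete = complete } = finish
        where
        open Flip side z
        side′ : V → Bool
        side′ = not ∘ flipped
        module S = Sides G side
        module F = Sides G flipped
        module S′ = Sides G side′
        complete′ : ∀ u v → side′ u ≡ true → side′ v ≡ false → Adj G u v ≡ true
        complete′ u v su sv with u ≟ z | v ≟ z
        ... | yes refl | yes refl = contradiction (≡.trans (≡.sym su) sv) λ ()
        ... | yes refl | no v≢ = spokes v (≡.trans (≡.sym (Bool.not-involutive (side v))) (cong not sv)) v≢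
        ... | no u≢ | yes refl rewrite sz = contradiction sv λ ()
        ... | no u≢ | no v≢ = adj-sym G (complete v u (≡.trans (≡.sym (Bool.not-involutive (side v))) (cong not sv)) v≢ (not-true su))
        no-miss : ∀ v → size (S′.miss v) ≡ 0
        no-miss v = n≤0⇒n≡0 (≤-trans (count-mono {Q = λ _ → false} (allFin n) λ u e → contradiction (adj v u e) λ a≡ →
            contradiction (≡.trans (≡.sym a≡) (not-true (proj₂ (∧-true {S′.on (not (side′ v)) u} e)))) λ ())
          (≤-reflexive (count-none (allFin n))))
          where
          adj : ∀ v u → S′.miss v u ≡ true → Adj G v u ≡ true
          adj v u e with side′ v in sv
          ... | true  = complete′ v u sv (S′.on⇒side false (proj₁ (∧-true {not (side′ u)} e)))
          ... | false = adj-sym G (complete′ u v (S′.on⇒side true (proj₁ (∧-true {side′ u} e))) sv)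
        sizeT : size (S′.on true) ≡ suc (size (S.on false))
        sizeT = subst (λ s → size (F.on (not s)) ≡ suc (size (S.on (not s)))) sz size-enter
        sizeF : size (S′.on false) ≡ size (S.on false)
        sizeF = ≡.trans (Negation.size-on-negate flipped false)
          (suc-injective (≡.trans (≡.sym (subst (λ s → size (S.on s) ≡ suc (size (F.on s))) sz size-leave)) sizes))
        size′≥ : ∀ σ → 40 * τ ≤ size (S′.on σ)
        size′≥ true  = subst (40 * τ ≤_) (≡.sym sizeT) (m≤n⇒m≤1+n big)
        size′≥ false = subst (40 * τ ≤_) (≡.sym sizeF) big
        bal′ : S′.Balanced τ
        bal′ = record
          { cross≥    = λ v → subst (40 * τ ≤_) (≡.trans (Partition.cross-split G side′ v) (≡.trans (cong (size (S′.crossNbr v) +_) (no-miss v)) (+-identityʳ _))) (size′≥ (not (side′ v)))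
          ; atypical≤ = ≤-trans (≤-trans (count-mono {Q = λ _ → false} (allFin n) λ v e → subst (λ m → not (m ≤ᵇ τ) ≡ true) (no-miss v) e) (≤-reflexive (count-none (allFin n)))) z≤n
          ; 20≤τ      = 20≤τ }
        sizes′ : size (S′.on true) ≡ suc (size (S′.on false))
        sizes′ = ≡.trans sizeT (cong suc (≡.sym sizeF))
        finish : HasSpanningHalin G
        finish with Unbalanced.twoEdges? G side′ bal′ δ≥
        ... | yes two = Unbalanced.twoEdges⇒halin G side′ bal′ δ≥ sizes′ two
        ... | no ¬two with Unbalanced.NoTwoEdges.star G side′ bal′ δ≥ sizes′ ¬two
        ... | record { centre = w ; side-c = sw ; spokes = spokes′ } =
          Partition.wheel⇒halin G side′ w sw sizes′
            (lin (τ ∷ size (S′.on false) ∷ []) (κ 20 ≼ # 0 ∷ 40 ⊛ # 0 ≼ # 1 ∷ []) (κ 2 ≼ # 1) 1 (40 ∷ 1 ∷ []) (20≤τ , size′≥ false)) complete′ spokes′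

    -- A balanced partition with a reserve for m moves: moving one vertex changes each of these
    -- quantities by at most one for every other vertex.
    record Slack (side : V → Bool) (m : ℕ) : Set where
      open Sides G side
      field
        exceptional : V → Bool
        cross≥ : ∀ v → 40 * τ + m ≤ size (crossNbr v)
        miss≤  : ∀ v → exceptional v ≡ false → size (miss v) + m ≤ τ
        exc≤   : size exceptional + m ≤ τ
        size≥  : ∀ σ → 200 * τ + m ≤ size (on σ)

    module _ (20≤τ : 20 ≤ τ) where

      slack⇒balanced : ∀ {side m} → Slack side m → Sides.Balanced G side τ
      slack⇒balanced {side} {m} sl = record
        { cross≥    = λ v → ≤-trans (m≤m+n _ m) (cross≥ v)
        ; atypical≤ = ≤-trans (count-mono (allFin n) imp) (≤-trans (m≤m+n _ m) exc≤)
        ; 20≤τ      = 20≤τ }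
        where
        open Slack sl
        open Sides G side
        imp : ∀ v → atypical τ v ≡ true → exceptional v ≡ true
        imp v at = Bool.¬-not λ e → contradiction (≡.trans (≡.sym (Bool.T-≡ .Equivalence.to (≤⇒≤ᵇ (≤-trans (m≤m+n _ m) (miss≤ v e))))) (not-true at)) λ ()

      -- The inner neighbours of w become its neighbours across, so a vertex rich in them keeps the
      -- lower bound. What w misses after the move is not controlled, hence it is added to the
      -- exceptional vertices.
      flip-slack : ∀ {side m} w → Slack side (suc m) → 40 * τ + m ≤ size (Sides.inner G side w) → Slack (Flip.flipped side w) m
      flip-slack {side} {m} w sl inner≥ = record
        { exceptional = λ v → exceptional v ∨ does (v ∈? (w ∷ []))
        ; cross≥ = λ v → cross v (v ≟ w)
        ; miss≤ = λ v e → missing v e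
        ; exc≤ = lin (size exceptional ∷ m ∷ τ ∷ size (λ v → exceptional v ∨ does (v ∈? (w ∷ []))) ∷ size (λ v → does (v ∈? (w ∷ []))) ∷ []) (# 0 ⊕ (κ 1 ⊕ # 1) ≼ # 2 ∷ # 3 ≼ # 0 ⊕ # 4 ∷ # 4 ≼ κ 1 ∷ []) (# 3 ⊕ # 1 ≼ # 2) 1 (1 ∷ 1 ∷ 1 ∷ [])
                  (exc≤ , count-∨ exceptional _ (allFin n) , size-∈ (w ∷ []))
        ; size≥ = λ σ → lin (τ ∷ m ∷ size (S.on σ) ∷ size (F.on σ) ∷ []) (200 ⊛ # 0 ⊕ (κ 1 ⊕ # 1) ≼ # 2 ∷ # 2 ≼ κ 1 ⊕ # 3 ∷ []) (200 ⊛ # 0 ⊕ # 1 ≼ # 3) 1 (1 ∷ 1 ∷ []) (size≥ σ , size-to σ) }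
        where
        open Slack sl
        open Flip side w
        module S = Sides G side
        module F = Sides G flipped
        cross : ∀ v → Dec (v ≡ w) → 40 * τ + m ≤ size (F.crossNbr v)
        cross v (yes refl) = ≤-trans inner≥ cross-self
        cross v (no v≢)  = lin (τ ∷ m ∷ size (S.crossNbr v) ∷ size (F.crossNbr v) ∷ []) (40 ⊛ # 0 ⊕ (κ 1 ⊕ # 1) ≼ # 2 ∷ # 2 ≼ κ 1 ⊕ # 3 ∷ []) (40 ⊛ # 0 ⊕ # 1 ≼ # 3) 1 (1 ∷ 1 ∷ []) (cross≥ v , cross-other v≢)
        missing : ∀ v → exceptional v ∨ does (v ∈? (w ∷ [])) ≡ false → size (F.miss v) + m ≤ τ
        missing v e = lin (τ ∷ m ∷ size (S.miss v) ∷ size (F.miss v) ∷ []) (# 2 ⊕ (κ 1 ⊕ # 1) ≼ # 0 ∷ # 3 ≼ κ 1 ⊕ # 2 ∷ []) (# 3 ⊕ # 1 ≼ # 0) 1 (1 ∷ 1 ∷ [])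
          (miss≤ v (proj₁ (∨-false e)) , miss-other λ v≡w → contradiction (≡.trans (≡.sym (dec-true (v ∈? (w ∷ [])) (here v≡w))) (proj₂ (∨-false {exceptional v} e))) λ ())
        size-to : ∀ σ → size (S.on σ) ≤ suc (size (F.on σ))
        size-to σ = size-except w λ u u≢ e → ≡.trans (on-other σ u≢) e

      -- For d ≥ 2 the matching needs 4Δ + 2d + τ + 1 vertices in the larger side. With Δ = 40τ + m
      -- and m, d ≤ τ this is at most 167τ + 1, hence the bound 200τ.
      bigger-true⇒halin : ∀ {m d} side → Sides.Balanced G side τ → (∀ σ → 200 * τ ≤ size (Sides.on G side σ)) →
        size (Sides.on G side true) ≡ size (Sides.on G side false) + d → 1 ≤ d → d ≤ τ → m ≤ τ →
        (2 ≤ d → ∀ v → side v ≡ true → size (Sides.inner G side v) ≤ 40 * τ + m) → HasSpanningHalin G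
      bigger-true⇒halin {d = suc zero} side bal big sizes _ _ _ _ =
        one-more⇒halin side bal (lin (τ ∷ size (Sides.on G side false) ∷ []) (200 ⊛ # 0 ≼ # 1 ∷ []) (40 ⊛ # 0 ≼ # 1) 5 (1 ∷ []) (big false)) (≡.trans sizes (+-comm _ 1))
      bigger-true⇒halin {m} {suc (suc d)} side bal big sizes 1≤d d≤ m≤ Δ≥ =
        Unbalanced.Matching.matching⇒halin G side bal δ≥ {d = suc (suc d)} {Δ = 40 * τ + m} sizes (Δ≥ (s≤s (s≤s z≤n)))
          (lin (τ ∷ m ∷ d ∷ size (Sides.on G side true) ∷ []) (# 1 ≼ # 0 ∷ κ 2 ⊕ # 2 ≼ # 0 ∷ 200 ⊛ # 0 ≼ # 3 ∷ κ 20 ≼ # 0 ∷ []) (4 ⊛ (40 ⊛ # 0 ⊕ # 1) ⊕ 2 ⊛ (κ 2 ⊕ # 2) ⊕ # 0 ⊕ κ 1 ≼ # 3) 1 (4 ∷ 2 ∷ 1 ∷ 33 ∷ [])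
            (m≤ , d≤ , big true , 20≤τ)) 1≤d d≤

      bigger⇒halin : ∀ {m d} side σ → Slack side m → size (Sides.on G side σ) ≡ size (Sides.on G side (not σ)) + d → 1 ≤ d → d ≤ τ →
        (2 ≤ d → ∀ v → side v ≡ σ → size (Sides.inner G side v) ≤ 40 * τ + m) → HasSpanningHalin G
      bigger⇒halin {m} side true sl sizes 1≤ d≤ Δ≥ =
        bigger-true⇒halin side (slack⇒balanced sl) (λ σ → ≤-trans (m≤m+n _ m) (Slack.size≥ sl σ)) sizes 1≤ d≤
          (≤-trans (m≤n+m m _) (Slack.exc≤ sl)) Δ≥
      bigger⇒halin {m} side false sl sizes 1≤ d≤ Δ≥ =
        bigger-true⇒halin (not ∘ side) (balanced-negate (slack⇒balanced sl))
          (λ σ → subst (200 * τ ≤_) (≡.sym (size-on-negate σ)) (≤-trans (m≤m+n _ m) (Slack.size≥ sl (not σ))))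
          (≡.trans sizes (cong (_+ _) (≡.sym (size-on-negate false)))) 1≤ d≤
          (≤-trans (m≤n+m m _) (Slack.exc≤ sl))
          (λ 2≤ v sv → subst (_≤ 40 * τ + m) (≡.sym (inner-negate v)) (Δ≥ 2≤ v (not-true sv)))
        where open Negation side

      -- Vertices of the larger side with many neighbours in it change sides until the sizes differ by at most one
      -- or no such vertex is left.
      slack⇒halin : ∀ m side σ d → Slack side m → size (Sides.on G side σ) ≡ size (Sides.on G side (not σ)) + d →
                    d ≤ 1 + 2 * m → d ≤ τ → HasSpanningHalin G
      slack⇒halin m side σ zero sl sizes _ _ = Unbalanced.equal⇒halin G side (slack⇒balanced sl) δ≥ (equal σ sizes)
        (lin (τ ∷ m ∷ size (Sides.on G side false) ∷ []) (200 ⊛ # 0 ⊕ # 1 ≼ # 2 ∷ κ 20 ≼ # 0 ∷ []) (κ 1 ⊕ # 0 ≼ # 2) 1 (1 ∷ 199 ∷ []) (Slack.size≥ sl false , 20≤τ))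
        where
        equal : ∀ σ → size (Sides.on G side σ) ≡ size (Sides.on G side (not σ)) + 0 → size (Sides.on G side true) ≡ size (Sides.on G side false)
        equal true  e = ≡.trans e (+-identityʳ _)
        equal false e = ≡.sym (≡.trans e (+-identityʳ _))
      slack⇒halin m side σ (suc zero) sl sizes _ d≤ = bigger⇒halin side σ sl sizes ≤-refl d≤ λ { (s≤s ()) }
      slack⇒halin zero side σ (suc (suc d)) sl sizes (s≤s ()) d≤
      slack⇒halin (suc m) side σ (suc (suc d)) sl sizes d≤m d≤
        with Fin.any? (λ w → (side w Bool.≟ σ) ×-dec (40 * τ + m ≤? size (Sides.inner G side w)))
      ... | yes (w , refl , rich) = slack⇒halin m (Flip.flipped side w) (side w) d (flip-slack w sl rich) sizes′
              (lin (m ∷ d ∷ []) (κ 2 ⊕ # 1 ≼ κ 1 ⊕ 2 ⊛ (κ 1 ⊕ # 0) ∷ []) (# 1 ≼ κ 1 ⊕ 2 ⊛ # 0) 1 (1 ∷ []) d≤m) (≤-trans (m≤n+m d 2) d≤)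
        where
        open Flip side w
        module S = Sides G side
        module F = Sides G flipped
        sizes′ : size (F.on (side w)) ≡ size (F.on (not (side w))) + d
        sizes′ = suc-injective (≡.trans (≡.sym size-leave) (≡.trans sizes
          (≡.trans (+-suc _ (suc d)) (cong suc (≡.trans (+-suc _ d) (cong (_+ d) (≡.sym size-enter)))))))
      ... | no ¬rich = bigger⇒halin side σ sl sizes (s≤s z≤n) d≤ λ _ v sv →
              ≤-trans (≮⇒≥ λ lt → ¬rich (v , sv , <⇒≤ lt)) (+-monoʳ-≤ (40 * τ) (n≤1+n m))

-- The initial partition obtained from V₁

does-false⇒¬ : ∀ {P : Set} (d : Dec P) → does d ≡ false → ¬ P
does-false⇒¬ (no ¬p) _ = ¬p

count-filterᵇ : ∀ {A : Set} (P Q : A → Bool) xs → count P (filterᵇ Q xs) ≡ count (λ x → Q x ∧ P x) xs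
count-filterᵇ P Q [] = refl
count-filterᵇ P Q (x ∷ xs) with Q x
... | false = count-filterᵇ P Q xs
... | true with P x
...   | true  = cong suc (count-filterᵇ P Q xs)
...   | false = count-filterᵇ P Q xs

module Initial {n : ℕ} (G : Graph n) (V₁ : Fin n → Bool) (q μ : ℕ)
               (half≤ : n ≤ 2 * size V₁ + q) (sparse : ∀ v → V₁ v ≡ true → degreeIn G V₁ v ≤ q)
               (δ≥ : ∀ v → n + 1 ≤ 2 * degree G v) (nq≤ : n * q ≤ μ * μ) (q≤μ : q ≤ μ) (4≤μ : 4 ≤ μ) (big : 500 * (5 * μ) ≤ n) where

  private V = Fin n

  -- true marks the side of V₁.
  side : V → Bool
  side v = does (4 * degreeIn G V₁ v <? n)

  open Sides G side
  open Partition G side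

  miss₁ miss₂ : V → V → Bool
  miss₁ v u = V₁ u ∧ not (Adj G v u)
  miss₂ v u = not (V₁ u) ∧ not (Adj G v u)

  exceptional : V → Bool
  exceptional v = not (V₁ v) ∧ does (2 * μ <? size (miss₁ v))

  extra : V → Bool
  extra u = side u ∧ not (V₁ u)

  size-V₁ : ∀ v → size V₁ ≡ degreeIn G V₁ v + size (miss₁ v)
  size-V₁ v = count-∧-split V₁ (Adj G v) (allFin n)

  size-V₂ : size V₁ + size (not ∘ V₁) ≡ n
  size-V₂ = ≡.trans (count-not V₁ (allFin n)) (length-tabulate id)

  size-V₂-at : ∀ v → size (not ∘ V₁) ≡ size (λ u → not (V₁ u) ∧ Adj G v u) + size (miss₂ v)
  size-V₂-at v = count-∧-split (not ∘ V₁) (Adj G v) (allFin n)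

  degree-V₁ : ∀ v → degree G v ≡ degreeIn G V₁ v + size (λ u → not (V₁ u) ∧ Adj G v u)
  degree-V₁ v = ≡.trans (count-∧-split (Adj G v) V₁ (allFin n))
    (cong₂ _+_ (size-cong λ u → Bool.∧-comm (Adj G v u) (V₁ u)) (size-cong λ u → Bool.∧-comm (Adj G v u) (not (V₁ u))))

  -- At most q of the more than n/2 neighbours of v lie in V₁, so at least n/2 - q lie outside,
  -- where there are at most (n + q)/2 vertices.
  miss₂≤ : ∀ {v} → V₁ v ≡ true → size (miss₂ v) ≤ 2 * q
  miss₂≤ {v} v₁ = lin (n ∷ size V₁ ∷ size (not ∘ V₁) ∷ degree G v ∷ degreeIn G V₁ v ∷ size (λ u → not (V₁ u) ∧ Adj G v u) ∷ size (miss₂ v) ∷ q ∷ []) (# 0 ≼ 2 ⊛ # 1 ⊕ # 7 ∷ # 4 ≼ # 7 ∷ # 0 ⊕ κ 1 ≼ 2 ⊛ # 3 ∷ # 1 ⊕ # 2 ≼ # 0 ∷ # 5 ⊕ # 6 ≼ # 2 ∷ # 3 ≼ # 4 ⊕ # 5 ∷ []) (# 6 ≼ 2 ⊛ # 7) 2 (1 ∷ 2 ∷ 1 ∷ 2 ∷ 2 ∷ 2 ∷ [])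
    (half≤ , sparse v v₁ , δ≥ v , ≤-reflexive size-V₂ , ≤-reflexive (≡.sym (size-V₂-at v)) , ≤-reflexive (degree-V₁ v))

  size-V₁≥1 : 1 ≤ size V₁
  size-V₁≥1 = lin (n ∷ size V₁ ∷ q ∷ μ ∷ []) (# 0 ≼ 2 ⊛ # 1 ⊕ # 2 ∷ # 2 ≼ # 3 ∷ κ 4 ≼ # 3 ∷ 500 ⊛ (5 ⊛ # 3) ≼ # 0 ∷ []) (κ 1 ≼ # 1) 2 (1 ∷ 1 ∷ 2499 ∷ 1 ∷ []) (half≤ , q≤μ , 4≤μ , big)

  -- The upper bound comes from the neighbourhood of one vertex of V₁: it has at least n/2 - q
  -- vertices outside V₁.
  size-V₁≤ : 2 * size V₁ ≤ n + 2 * q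
  size-V₁≤ with size-pick size-V₁≥1
  ... | v , v₁ = lin (n ∷ size V₁ ∷ size (not ∘ V₁) ∷ degree G v ∷ degreeIn G V₁ v ∷ size (λ u → not (V₁ u) ∧ Adj G v u) ∷ size (miss₂ v) ∷ q ∷ []) (# 4 ≼ # 7 ∷ # 0 ⊕ κ 1 ≼ 2 ⊛ # 3 ∷ # 1 ⊕ # 2 ≼ # 0 ∷ # 5 ⊕ # 6 ≼ # 2 ∷ # 3 ≼ # 4 ⊕ # 5 ∷ []) (2 ⊛ # 1 ≼ # 0 ⊕ 2 ⊛ # 7) 1 (2 ∷ 1 ∷ 2 ∷ 2 ∷ 2 ∷ [])
    (sparse v v₁ , δ≥ v , ≤-reflexive size-V₂ , ≤-reflexive (≡.sym (size-V₂-at v)) , ≤-reflexive (degree-V₁ v))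

  V₁⊆side : ∀ v → V₁ v ≡ true → side v ≡ true
  V₁⊆side v v₁ = dec-true (4 * degreeIn G V₁ v <? n)
    (lin (n ∷ degreeIn G V₁ v ∷ q ∷ μ ∷ []) (# 1 ≼ # 2 ∷ # 2 ≼ # 3 ∷ κ 4 ≼ # 3 ∷ 500 ⊛ (5 ⊛ # 3) ≼ # 0 ∷ []) (κ 1 ⊕ 4 ⊛ # 1 ≼ # 0) 1 (4 ∷ 4 ∷ 2496 ∷ 1 ∷ []) (sparse v v₁ , q≤μ , 4≤μ , big))

  abstract
    -- Count non-adjacent pairs between exceptional vertices and V₁: each exceptional vertex is in
    -- at least 2μ of them, each vertex of V₁ in at most 2q. Then `nq≤` bounds the number.
    exceptional≤ : size exceptional ≤ μ
    exceptional≤ = *-cancelʳ-≤ (size exceptional) μ (2 * μ) ⦃ >-nonZero (lin (μ ∷ []) (κ 4 ≼ # 0 ∷ []) (κ 1 ≼ 2 ⊛ # 0) 1 (2 ∷ []) 4≤μ) ⦄ (begin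
      size exceptional * (2 * μ) ≤⟨ incidences (λ x u → not (Adj G x u)) (filterᵇ exceptional (allFin n)) (filterᵇ V₁ (allFin n)) rows columns ⟩
      size V₁ * (2 * q)          ≤⟨ *-monoˡ-≤ (2 * q) {size V₁} {n} (≤-trans (m≤m+n (size V₁) (size (not ∘ V₁))) (≤-reflexive size-V₂)) ⟩
      n * (2 * q)                ≡⟨ x∙yz n q ⟩
      2 * (n * q)                ≤⟨ *-monoʳ-≤ 2 nq≤ ⟩
      2 * (μ * μ)                ≡⟨ x∙yz μ μ ⟨
      μ * (2 * μ) ∎)
      where
      open ≤-Reasoning
      x∙yz : ∀ a b → a * (2 * b) ≡ 2 * (a * b)
      x∙yz a b = ≡.trans (≡.sym (*-assoc a 2 b)) (≡.trans (cong (_* b) (*-comm a 2)) (*-assoc 2 a b))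
      rows : ∀ {x} → x ∈ filterᵇ exceptional (allFin n) → 2 * μ ≤ count (λ u → not (Adj G x u)) (filterᵇ V₁ (allFin n))
      rows {x} x∈ = subst (2 * μ ≤_) (≡.sym (count-filterᵇ (λ u → not (Adj G x u)) V₁ (allFin n)))
        (<⇒≤ (does⇒ (2 * μ <? size (miss₁ x)) (proj₂ (∧-true {not (V₁ x)} (proj₂ (∈-filterᵇ⁻ {p = exceptional} (allFin n) x∈))))))
      columns : ∀ {u} → u ∈ filterᵇ V₁ (allFin n) → count (λ x → not (Adj G x u)) (filterᵇ exceptional (allFin n)) ≤ 2 * q
      columns {u} u∈ = ≤-trans (≤-reflexive (count-filterᵇ (λ x → not (Adj G x u)) exceptional (allFin n)))
        (≤-trans (size-mono imp) (miss₂≤ (proj₂ (∈-filterᵇ⁻ {p = V₁} (allFin n) u∈))))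
        where
        imp : ∀ x → exceptional x ∧ not (Adj G x u) ≡ true → miss₂ u x ≡ true
        imp x e with ∧-true {exceptional x} e
        ... | ex , ¬a = ∧-intro (proj₁ (∧-true {not (V₁ x)} ex)) (≡.trans (cong not (Graph.sym G u x)) ¬a)

  -- Fewer than n/4 neighbours in V₁, which has nearly n/2 vertices, means missing almost n/4 of
  -- them, far more than 2μ. So `side` differs from V₁ in at most μ vertices.
  extra⇒exceptional : ∀ v → extra v ≡ true → exceptional v ≡ true
  extra⇒exceptional v e with ∧-true {side v} e
  ... | s , ¬v₁ = ∧-intro ¬v₁ (dec-true (2 * μ <? size (miss₁ v))
    (lin (n ∷ size V₁ ∷ q ∷ μ ∷ degreeIn G V₁ v ∷ size (miss₁ v) ∷ []) (# 0 ≼ 2 ⊛ # 1 ⊕ # 2 ∷ # 2 ≼ # 3 ∷ κ 4 ≼ # 3 ∷ 500 ⊛ (5 ⊛ # 3) ≼ # 0 ∷ # 1 ≼ # 4 ⊕ # 5 ∷ κ 1 ⊕ 4 ⊛ # 4 ≼ # 0 ∷ []) (κ 1 ⊕ 2 ⊛ # 3 ≼ # 5) 1249 (2 ∷ 2 ∷ 0 ∷ 1 ∷ 4 ∷ 1 ∷ [])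
      (half≤ , q≤μ , 4≤μ , big , ≤-reflexive (size-V₁ v) , does⇒ (4 * degreeIn G V₁ v <? n) s)))

  extra≤ : size extra ≤ μ
  extra≤ = ≤-trans (size-mono extra⇒exceptional) exceptional≤

  side-or : ∀ {P : V → Bool} → size (λ u → side u ∧ P u) ≤ size (λ u → V₁ u ∧ P u) + μ
  side-or {P} = ≤-trans (size-mono imp) (≤-trans (count-∨ (λ u → V₁ u ∧ P u) extra (allFin n)) (+-monoʳ-≤ _ extra≤))
    where
    imp : ∀ u → side u ∧ P u ≡ true → (V₁ u ∧ P u) ∨ extra u ≡ true
    imp u e with ∧-true {side u} e | V₁ u in v₁
    ... | s , p | true  rewrite p = refl
    ... | s , p | false rewrite s = refl

  size-true≥ : size V₁ ≤ size (on true)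
  size-true≥ = size-mono V₁⊆side

  size-true≤ : size (on true) ≤ size V₁ + μ
  size-true≤ = ≤-trans (≤-reflexive (size-cong λ u → ≡.sym (Bool.∧-identityʳ (side u))))
    (≤-trans (side-or {λ _ → true}) (≤-reflexive (cong (_+ μ) (size-cong λ u → Bool.∧-identityʳ (V₁ u)))))

  -- The threshold n/4 in `side` serves both sides: a vertex on the side of V₁ has at most n/4 + μ
  -- inner neighbours, any other at least n/4 neighbours in V₁.
  cross≥ : ∀ v → 40 * (5 * μ) + 2 * μ ≤ size (crossNbr v)
  cross≥ v = go (side v) refl
    where
    go : ∀ s → side v ≡ s → 40 * (5 * μ) + 2 * μ ≤ size (crossNbr v)
    go true sv = lin (n ∷ μ ∷ degree G v ∷ degreeIn G V₁ v ∷ size (inner v) ∷ size (crossNbr v) ∷ []) (# 0 ⊕ κ 1 ≼ 2 ⊛ # 2 ∷ # 2 ≼ # 4 ⊕ # 5 ∷ # 4 ≼ # 3 ⊕ # 1 ∷ κ 1 ⊕ 4 ⊛ # 3 ≼ # 0 ∷ 500 ⊛ (5 ⊛ # 1) ≼ # 0 ∷ []) (40 ⊛ (5 ⊛ # 1) ⊕ 2 ⊛ # 1 ≼ # 5) 1248 (202 ∷ 404 ∷ 404 ∷ 101 ∷ 101 ∷ [])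
      (δ≥ v , ≤-reflexive (degree-split v) , subst (λ s → size (λ u → on s u ∧ Adj G v u) ≤ degreeIn G V₁ v + μ) (≡.sym sv) (side-or {Adj G v}) ,
       does⇒ (4 * degreeIn G V₁ v <? n) sv , big)
    go false sv = lin (n ∷ μ ∷ degreeIn G V₁ v ∷ size (crossNbr v) ∷ []) (# 0 ≼ 4 ⊛ # 2 ∷ # 2 ≼ # 3 ∷ 500 ⊛ (5 ⊛ # 1) ≼ # 0 ∷ []) (40 ⊛ (5 ⊛ # 1) ⊕ 2 ⊛ # 1 ≼ # 3) 1250 (101 ∷ 404 ∷ 101 ∷ [])
      (≮⇒≥ (does-false⇒¬ (4 * degreeIn G V₁ v <? n) sv) , size-mono imp , big)
      where
      imp : ∀ u → V₁ u ∧ Adj G v u ≡ true → crossNbr v u ≡ true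
      imp u e with ∧-true {V₁ u} e
      ... | v₁ , a = ∧-intro (subst (λ s → on (not s) u ≡ true) (≡.sym sv) (V₁⊆side u v₁)) a

  -- A vertex of V₁ misses at most 2q ≤ 2μ vertices; a non-exceptional one on the other side misses
  -- at most 2μ in V₁ and μ among `extra`. With the reserve 2μ this gives 5μ, the value of τ.
  miss≤ : ∀ v → exceptional v ≡ false → size (miss v) + 2 * μ ≤ 5 * μ
  miss≤ v ¬ex = go (V₁ v) (side v) refl refl
    where
    go : ∀ b s → V₁ v ≡ b → side v ≡ s → size (miss v) + 2 * μ ≤ 5 * μ
    go true false v₁ sv = contradiction (≡.trans (≡.sym (V₁⊆side v v₁)) sv) λ ()
    go true true v₁ sv = lin (μ ∷ q ∷ size (miss₂ v) ∷ size (miss v) ∷ []) (# 1 ≼ # 0 ∷ # 2 ≼ 2 ⊛ # 1 ∷ # 3 ≼ # 2 ∷ []) (# 3 ⊕ 2 ⊛ # 0 ≼ 5 ⊛ # 0) 2 (6 ∷ 3 ∷ 3 ∷ [])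
      (q≤μ , miss₂≤ v₁ , size-mono imp)
      where
      imp : ∀ u → miss v u ≡ true → miss₂ v u ≡ true
      imp u e with ∧-true {on (not (side v)) u} e
      ... | o , ¬a = ∧-intro (cong not (Bool.¬-not λ u₁ → contradiction (≡.trans (≡.sym (V₁⊆side u u₁))
                       (on⇒side false (subst (λ s → on (not s) u ≡ true) sv o))) λ ())) ¬a
    go false true v₁ sv = contradiction (≡.trans (≡.sym (extra⇒exceptional v (∧-intro sv (cong not v₁)))) ¬ex) λ ()
    go false false v₁ sv = lin (μ ∷ size (miss₁ v) ∷ size (miss v) ∷ []) (# 1 ≼ 2 ⊛ # 0 ∷ # 2 ≼ # 1 ⊕ # 0 ∷ []) (# 2 ⊕ 2 ⊛ # 0 ≼ 5 ⊛ # 0) 1 (1 ∷ 1 ∷ [])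
      (≮⇒≥ (does-false⇒¬ (2 * μ <? size (miss₁ v)) (subst (λ b → not b ∧ does (2 * μ <? size (miss₁ v)) ≡ false) v₁ ¬ex)) ,
       subst (λ s → size (λ u → on (not s) u ∧ not (Adj G v u)) ≤ size (miss₁ v) + μ) (≡.sym sv) (side-or {λ u → not (Adj G v u)}))

  size≥ : ∀ σ → 200 * (5 * μ) + 2 * μ ≤ size (on σ)
  size≥ true = lin (n ∷ size V₁ ∷ q ∷ μ ∷ size (on true) ∷ []) (# 0 ≼ 2 ⊛ # 1 ⊕ # 2 ∷ # 2 ≼ # 3 ∷ 500 ⊛ (5 ⊛ # 3) ≼ # 0 ∷ # 1 ≼ # 4 ∷ []) (200 ⊛ (5 ⊛ # 3) ⊕ 2 ⊛ # 3 ≼ # 4) 833 (334 ∷ 334 ∷ 334 ∷ 668 ∷ [])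
    (half≤ , q≤μ , big , size-true≥)
  size≥ false = lin (n ∷ size V₁ ∷ q ∷ μ ∷ size (on true) ∷ size (on false) ∷ []) (2 ⊛ # 1 ≼ # 0 ⊕ 2 ⊛ # 2 ∷ # 2 ≼ # 3 ∷ 500 ⊛ (5 ⊛ # 3) ≼ # 0 ∷ # 4 ≼ # 1 ⊕ # 3 ∷ # 0 ≼ # 4 ⊕ # 5 ∷ []) (200 ⊛ (5 ⊛ # 3) ⊕ 2 ⊛ # 3 ≼ # 5) 416 (167 ∷ 334 ∷ 167 ∷ 334 ∷ 334 ∷ [])
    (size-V₁≤ , q≤μ , big , size-true≤ , ≤-reflexive (≡.sym sides-total))

  halin : HasSpanningHalin G
  halin = go (≤-total (size (on true)) (size (on false)))
    where
    20≤τ : 20 ≤ 5 * μ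
    20≤τ = *-monoʳ-≤ 5 4≤μ
    slack : Slack G {5 * μ} δ≥ side (2 * μ)
    slack = record { exceptional = exceptional ; cross≥ = cross≥ ; miss≤ = miss≤
                   ; exc≤ = lin (size exceptional ∷ μ ∷ []) (# 0 ≼ # 1 ∷ []) (# 0 ⊕ 2 ⊛ # 1 ≼ 5 ⊛ # 1) 1 (1 ∷ []) exceptional≤ ; size≥ = size≥ }
    -- The sizes differ by at most 4μ and each move lowers the difference by two, so the reserve of
    -- 2μ moves suffices.
    run : ∀ σ → size (on (not σ)) ≤ size (on σ) → size (on σ) ≤ size (on (not σ)) + 4 * μ → HasSpanningHalin G
    run σ le gap = slack⇒halin G δ≥ 20≤τ (2 * μ) side σ (size (on σ) ∸ size (on (not σ))) slack (≡.sym (m+[n∸m]≡n le))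
      (lin (size (on σ) ∸ size (on (not σ)) ∷ μ ∷ []) (# 0 ≼ 4 ⊛ # 1 ∷ []) (# 0 ≼ κ 1 ⊕ 2 ⊛ (2 ⊛ # 1)) 1 (1 ∷ []) d≤)
      (lin (size (on σ) ∸ size (on (not σ)) ∷ μ ∷ []) (# 0 ≼ 4 ⊛ # 1 ∷ []) (# 0 ≼ 5 ⊛ # 1) 1 (1 ∷ []) d≤)
      where
      d≤ : size (on σ) ∸ size (on (not σ)) ≤ 4 * μ
      d≤ = m≤n+o⇒m∸n≤o (size (on σ)) (size (on (not σ))) gap
    go : size (on true) ≤ size (on false) ⊎ size (on false) ≤ size (on true) → HasSpanningHalin G
    go (inj₁ le) = run false le (lin (n ∷ size V₁ ∷ q ∷ μ ∷ size (on true) ∷ size (on false) ∷ []) (# 0 ≼ 2 ⊛ # 1 ⊕ # 2 ∷ # 2 ≼ # 3 ∷ # 1 ≼ # 4 ∷ # 4 ⊕ # 5 ≼ # 0 ∷ []) (# 5 ≼ # 4 ⊕ 4 ⊛ # 3) 1 (1 ∷ 1 ∷ 2 ∷ 1 ∷ []) (half≤ , q≤μ , size-true≥ , ≤-reflexive sides-total))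
    go (inj₂ le) = run true le (lin (n ∷ size V₁ ∷ q ∷ μ ∷ size (on true) ∷ size (on false) ∷ []) (2 ⊛ # 1 ≼ # 0 ⊕ 2 ⊛ # 2 ∷ # 2 ≼ # 3 ∷ # 4 ≼ # 1 ⊕ # 3 ∷ # 0 ≼ # 4 ⊕ # 5 ∷ []) (# 4 ≼ # 5 ⊕ 4 ⊛ # 3) 1 (1 ∷ 2 ∷ 2 ∷ 1 ∷ []) (size-V₁≤ , q≤μ , size-true≤ , ≤-reflexive (≡.sym sides-total)))

open import Data.Integer using (+_)

-- From rational to natural bounds

ι : ℕ → ℚ
ι n = + n / 1

toℚᵘ-ι : ∀ n → Q.toℚᵘ (ι n) ℚᵘ.≃ ℚᵘ.mkℚᵘ (+ n) 0
toℚᵘ-ι n = Q.toℚᵘ-fromℚᵘ (ℚᵘ.mkℚᵘ (+ n) 0)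

ι-cancel-≤ : ∀ {a b} → ι a Q.≤ ι b → a ≤ b
ι-cancel-≤ {a} {b} h with ℚᵘ.≤-respˡ-≃ (toℚᵘ-ι a) (ℚᵘ.≤-respʳ-≃ (toℚᵘ-ι b) (Q.toℚᵘ-mono-≤ h))
... | ℚᵘ.*≤* le = ℤ.drop‿+≤+ (≡.subst₂ ℤ._≤_ (ℤ.*-identityʳ (+ a)) (ℤ.*-identityʳ (+ b)) le)

ι-+ : ∀ a b → ι (a + b) ≡ ι a Q.+ ι b
ι-+ a b = Q.toℚᵘ-injective (ℚᵘ.≃-trans (toℚᵘ-ι (a + b)) (ℚᵘ.≃-trans
  (ℚᵘ.*≡* (cong (ℤ._* + 1) (≡.sym (cong₂ ℤ._+_ (ℤ.*-identityʳ (+ a)) (ℤ.*-identityʳ (+ b))))))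
  (ℚᵘ.≃-sym (ℚᵘ.≃-trans (Q.toℚᵘ-homo-+ (ι a) (ι b)) (ℚᵘ.+-cong (toℚᵘ-ι a) (toℚᵘ-ι b))))))

ι-* : ∀ a b → ι (a * b) ≡ ι a Q.* ι b
ι-* a b = Q.toℚᵘ-injective (ℚᵘ.≃-trans (toℚᵘ-ι (a * b)) (ℚᵘ.≃-trans
  (ℚᵘ.*≡* (cong (ℤ._* + 1) (ℤ.pos-* a b)))
  (ℚᵘ.≃-sym (ℚᵘ.≃-trans (Q.toℚᵘ-homo-* (ι a) (ι b)) (ℚᵘ.*-cong (toℚᵘ-ι a) (toℚᵘ-ι b))))))

ι-inverse : ∀ m → ι (suc m) Q.* (+ 1 / suc m) ≡ 1ℚ
ι-inverse m = Q.toℚᵘ-injective (ℚᵘ.≃-trans (Q.toℚᵘ-homo-* (ι (suc m)) (+ 1 / suc m)) (ℚᵘ.≃-trans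
  (ℚᵘ.*-cong (toℚᵘ-ι (suc m)) (Q.toℚᵘ-fromℚᵘ (ℚᵘ.mkℚᵘ (+ 1) m)))
  (ℚᵘ.*≡* (≡.trans (cong (ℤ._* + 1) (ℤ.*-identityʳ (+ suc m))) (≡.trans (ℤ.*-identityʳ (+ suc m))
    (≡.trans (cong +_ (≡.sym (+-identityʳ (suc m)))) (≡.sym (ℤ.*-identityˡ _))))))))

nonNeg-ι : ∀ n → Q.NonNegative (ι n)
nonNeg-ι n = Q.normalize-nonNeg n 1

module _ (m : ℕ) {β : ℚ} (β≤ : β Q.≤ + 1 / suc m) where

  private
    M = suc m

  scaled≤1 : ι M Q.* β Q.≤ 1ℚ
  scaled≤1 = Q.≤-trans (Q.*-monoˡ-≤-nonNeg (ι M) ⦃ nonNeg-ι M ⦄ β≤) (Q.≤-reflexive (ι-inverse m))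

  scaled≤ : ∀ n → (ι M Q.* β) Q.* ι n Q.≤ ι n
  scaled≤ n = Q.≤-trans (Q.*-monoʳ-≤-nonNeg (ι n) ⦃ nonNeg-ι n ⦄ scaled≤1) (Q.≤-reflexive (Q.*-identityˡ (ι n)))

  degree-bound : ∀ n {k} → ι k Q.≤ β Q.* ι n → M * k ≤ n
  degree-bound n {k} h = ι-cancel-≤ (begin
    ι (M * k)            ≡⟨ ι-* M k ⟩
    ι M Q.* ι k          ≤⟨ Q.*-monoˡ-≤-nonNeg (ι M) ⦃ nonNeg-ι M ⦄ h ⟩
    ι M Q.* (β Q.* ι n)  ≡⟨ Q.*-assoc (ι M) β (ι n) ⟨
    (ι M Q.* β) Q.* ι n  ≤⟨ scaled≤ n ⟩
    ι n ∎)
    where open Q.≤-Reasoning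

  -- The bound on |V₁| is multiplied by 2M; the term 14 M β n that arises is at most 14 n because M
  -- β ≤ 1.
  size-bound : ∀ n {s} → (½ Q.- (+ 7 / 1) Q.* β) Q.* ι n Q.≤ ι s → M * n ≤ 2 * (M * s) + 14 * n
  size-bound n {s} h = ι-cancel-≤ (begin
    ι (M * n)                  ≡⟨ ι-* M n ⟩
    ι M Q.* ι n                ≡⟨ expand (ι M) β (ι n) ⟩
    (ι 2 Q.* ι M) Q.* ((½ Q.- ι 7 Q.* β) Q.* ι n) Q.+ ι 14 Q.* ((ι M Q.* β) Q.* ι n)
      ≤⟨ Q.+-mono-≤ (Q.*-monoˡ-≤-nonNeg (ι 2 Q.* ι M) ⦃ subst Q.NonNegative (ι-* 2 M) (nonNeg-ι (2 * M)) ⦄ h)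
                    (Q.*-monoˡ-≤-nonNeg (ι 14) ⦃ nonNeg-ι 14 ⦄ (scaled≤ n)) ⟩
    (ι 2 Q.* ι M) Q.* ι s Q.+ ι 14 Q.* ι n ≡⟨ cong₂ Q._+_ (≡.trans (Q.*-assoc (ι 2) (ι M) (ι s))
        (≡.trans (cong (ι 2 Q.*_) (≡.sym (ι-* M s))) (≡.sym (ι-* 2 (M * s))))) (≡.sym (ι-* 14 n)) ⟩
    ι (2 * (M * s)) Q.+ ι (14 * n)         ≡⟨ ι-+ (2 * (M * s)) (14 * n) ⟨
    ι (2 * (M * s) + 14 * n) ∎)
    where
    open Q.≤-Reasoning
    open ℚ-Solver
    expand : ∀ x y z → x Q.* z ≡ (ι 2 Q.* x) Q.* ((½ Q.- ι 7 Q.* y) Q.* z) Q.+ ι 14 Q.* ((x Q.* y) Q.* z)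
    expand = solve 3 (λ x y z → x :* z := (con (ι 2) :* x) :* ((con ½ :- con (ι 7) :* y) :* z) :+ con (ι 14) :* ((x :* y) :* z)) refl

module _ (L M : ℕ) .⦃ _ : NonZero L ⦄ .⦃ _ : NonZero M ⦄ (2500≤L : 2500 ≤ L) (M≥ : 56 * (L * L) ≤ M)
         {n : ℕ} (G : Graph n) (V₁ : Fin n → Bool) (n≥ : 4 * L ≤ n)
         (half≤ : M * n ≤ 2 * (M * size V₁) + 14 * n) (sparse : ∀ v → V₁ v ≡ true → M * degreeIn G V₁ v ≤ n) where

  private
    q μ : ℕ
    q = (14 * n) DM./ M
    μ = n DM./ L

  ≤q : ∀ {x} → M * x ≤ 14 * n → x ≤ q
  ≤q {x} h = ≤-trans (≤-reflexive (≡.sym (≡.trans (cong (DM._/ M) (*-comm M x)) (DM.m*n/n≡m x M)))) (DM./-monoˡ-≤ M h)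

  Mq≤ : M * q ≤ 14 * n
  Mq≤ = ≤-trans (≤-reflexive (*-comm M q)) (DM.m/n*n≤m (14 * n) M)

  μL≤ : μ * L ≤ n
  μL≤ = DM.m/n*n≤m n L

  4≤μ : 4 ≤ μ
  4≤μ = ≤-trans (≤-reflexive (≡.sym (DM.m*n/n≡m 4 L))) (DM./-monoˡ-≤ L n≥)

  -- Rounding n/L down loses less than L, and L ≤ μ L since μ ≥ 1.
  n≤ : n ≤ 2 * (μ * L)
  n≤ = ≤-trans (≤-reflexive (DM.m≡m%n+[m/n]*n n L))
    (lin (n DM.% L ∷ L ∷ μ * L ∷ []) (κ 1 ⊕ # 0 ≼ # 1 ∷ 4 ⊛ # 1 ≼ 4 ⊛ # 2 ∷ []) (# 0 ⊕ # 2 ≼ 2 ⊛ # 2) 4 (4 ∷ 1 ∷ [])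
      (DM.m%n<n n L , *-monoʳ-≤ 4 (≤-trans (≤-reflexive (≡.sym (+-identityʳ L))) (*-monoˡ-≤ L (≤-trans (s≤s z≤n) 4≤μ)))))

  -- M n q ≤ 14 n² ≤ 14 (2 μ L)² = 56 L² μ²; this is where the condition on M comes from.
  nq≤ : n * q ≤ μ * μ
  nq≤ = *-cancelˡ-≤ M (begin
    M * (n * q)                          ≡⟨ *-left-comm M n q ⟩
    n * (M * q)                          ≤⟨ *-monoʳ-≤ n Mq≤ ⟩
    n * (14 * n)                         ≤⟨ *-mono-≤ n≤ (*-monoʳ-≤ 14 n≤) ⟩
    2 * (μ * L) * (14 * (2 * (μ * L)))   ≡⟨ regroup μ L ⟩
    56 * (L * L) * (μ * μ)               ≤⟨ *-monoˡ-≤ (μ * μ) M≥ ⟩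
    M * (μ * μ) ∎)
    where
    open ≤-Reasoning
    open ℕ-Solver
    regroup : ∀ μ L → 2 * (μ * L) * (14 * (2 * (μ * L))) ≡ 56 * (L * L) * (μ * μ)
    regroup = solve 2 (λ μ L → con 2 :* (μ :* L) :* (con 14 :* (con 2 :* (μ :* L))) := con 56 :* (L :* L) :* (μ :* μ)) refl

  1≤n : 1 ≤ n
  1≤n = ≤-trans (≤-trans (s≤s z≤n) 4≤μ) (≤-trans (≤-reflexive (≡.sym (*-identityʳ μ))) (≤-trans (*-monoʳ-≤ μ (≤-trans (s≤s z≤n) 2500≤L)) μL≤))

  μ≤n : μ ≤ n
  μ≤n = DM.m/n≤m n L

  q≤μ : q ≤ μ
  q≤μ = *-cancelˡ-≤ n ⦃ >-nonZero 1≤n ⦄ (≤-trans nq≤ (*-monoˡ-≤ μ μ≤n))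

  big : 500 * (5 * μ) ≤ n
  big = ≤-trans (≤-reflexive (≡.sym (*-assoc 500 5 μ))) (≤-trans (*-monoˡ-≤ μ 2500≤L) (≤-trans (≤-reflexive (*-comm L μ)) μL≤))

  near-bipartite⇒halin : (∀ v → n + 1 ≤ 2 * degree G v) → HasSpanningHalin G
  near-bipartite⇒halin δ≥ = Initial.halin G V₁ q μ half≤′
    (λ v v₁ → ≤q (≤-trans (sparse v v₁) (m≤n*m n 14))) δ≥ nq≤ q≤μ 4≤μ big
    where
    half≤′ : n ≤ 2 * size V₁ + q
    half≤′ = m∸n≤o⇒m≤n+o n (2 * size V₁) (≤q (≤-trans (≤-reflexive (*-distribˡ-∸ M n (2 * size V₁)))
      (m≤n+o⇒m∸n≤o (M * n) (M * (2 * size V₁)) (≤-trans half≤ (≤-reflexive (cong (_+ 14 * n) (*-left-comm 2 M (size V₁))))))))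
      where
      m∸n≤o⇒m≤n+o : ∀ m n {o} → m ∸ n ≤ o → m ≤ n + o
      m∸n≤o⇒m≤n+o m n h = ≤-trans (m≤n+m∸n m n) (+-monoʳ-≤ n h)

reciprocal-≤ : ∀ {a b} → a ≤ b → + 1 / suc b Q.≤ + 1 / suc a
reciprocal-≤ {a} {b} h = Q.toℚᵘ-cancel-≤ (ℚᵘ.≤-respˡ-≃ (ℚᵘ.≃-sym (Q.toℚᵘ-fromℚᵘ (ℚᵘ.mkℚᵘ (+ 1) b)))
  (ℚᵘ.≤-respʳ-≃ (ℚᵘ.≃-sym (Q.toℚᵘ-fromℚᵘ (ℚᵘ.mkℚᵘ (+ 1) a)))
    (ℚᵘ.*≤* (≡.subst₂ ℤ._≤_ (≡.sym (ℤ.*-identityˡ (+ suc a))) (≡.sym (ℤ.*-identityˡ (+ suc b))) (ℤ.+≤+ (s≤s h))))))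

theorem3p2 : Σ ℚ λ β₀ → (0ℚ Q.< β₀) × (β₀ Q.≤ (+ 1 / 98260)) ×
    ((β : ℚ) → 0ℚ Q.< β → β Q.≤ β₀ →
    Σ ℕ λ N → (n : ℕ) → N ≤ n → (G : Graph n) →
    ((v : Fin n) → n + 1 ≤ 2 * degree G v) →
    (V₁ : Fin n → Bool) →
    ((½ Q.- (+ 7 / 1) Q.* β) Q.* (+ n / 1) Q.≤ (+ size V₁ / 1)) →
    ((v : Fin n) → V₁ v ≡ true → (+ degreeIn G V₁ v / 1) Q.≤ β Q.* (+ n / 1)) →
    HasSpanningHalin G)
-- L = 2500 ensures 500·5·⌊n/L⌋ ≤ n, and 350000000 = 56·L².
theorem3p2 = small 2500 349999999 (≤ᵇ⇒≤ 2500 2500 tt) (≤ᵇ⇒≤ 98259 349999999 tt) (≤ᵇ⇒≤ 350000000 350000000 tt)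
  where
  small : ∀ L m .⦃ _ : NonZero L ⦄ → 2500 ≤ L → 98259 ≤ m → 56 * (L * L) ≤ suc m →
    Σ ℚ λ β₀ → (0ℚ Q.< β₀) × (β₀ Q.≤ (+ 1 / 98260)) ×
    ((β : ℚ) → 0ℚ Q.< β → β Q.≤ β₀ →
    Σ ℕ λ N → (n : ℕ) → N ≤ n → (G : Graph n) →
    ((v : Fin n) → n + 1 ≤ 2 * degree G v) →
    (V₁ : Fin n → Bool) →
    ((½ Q.- (+ 7 / 1) Q.* β) Q.* (+ n / 1) Q.≤ (+ size V₁ / 1)) →
    ((v : Fin n) → V₁ v ≡ true → (+ degreeIn G V₁ v / 1) Q.≤ β Q.* (+ n / 1)) →
    HasSpanningHalin G)
  small L m L≥ m≥ M≥ = + 1 / suc m , Q.positive⁻¹ (+ 1 / suc m) ⦃ Q.normalize-pos 1 (suc m) ⦄ , reciprocal-≤ m≥ , λ β _ β≤ → 4 * L , λ n n≥ G δ≥ V₁ half≤ sparse →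
    near-bipartite⇒halin L (suc m) L≥ M≥ G V₁ n≥ (size-bound m β≤ n {size V₁} half≤) (λ v v₁ → degree-bound m β≤ n {degreeIn G V₁ v} (sparse v v₁)) δ≥
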